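{- Let $n$ be a positive integer and let $f:[n]\to[n]$ be a Hessenberg function such that a longest chain in the poset $P(f)$ has exactly $3$ elements. Write $\omega X_{G(f)}(\mathbf{x})=\sum_{\lambda\vdash n} c_\lambda h_\lambda(\mathbf{x})$. Then every coefficient $c_\lambda$ is a nonnegative integer; that is, $\omega X_{G(f)}(\mathbf{x})$ is $h$-positive.
   Context: $[n]=\{1,\dots,n\}$. A Hessenberg function is a non-decreasing function $f:[n]\to[n]$ with $i\le f(i)$ for all $i\in[n]$. The natural unit interval order $P(f)$ is the poset on $[n]$ with $i\prec_f j$ if and only if $f(i)<j$. The graph $G(f)$ has vertex set $[n]$, and for $i<j$, $\{i,j\}$ is an edge if and only if $f(i)\ge j$ (it is the incomparability graph of $P(f)$). For a graph $G$ on vertex set $V$, a proper coloring is a map $\kappa:V\to\mathbb{P}$ (positive integers) with $\kappa(u)\neq\kappa(v)$ whenever $\{u,v\}$ is an edge, and Stanley's chromatic symmetric function is $X_G(\mathbf{x})=\sum_\kappa\prod_{v\in V}x_{\kappa(v)}$, summed over all proper colorings, in infinitely many variables $\mathbf{x}=(x_1,x_2,\dots)$. For a partition $\lambda=(\lambda_1,\dots,\lambda_\ell)$, $h_\lambda=h_{\lambda_1}\cdots h_{\lambda_\ell}$ where $h_k$ is the complete homogeneous symmetric function of degree $k$. $\omega$ is the standard involution on symmetric functions with $\omega(e_k)=h_k$ (equivalently $\omega(s_\lambda)=s_{\lambda'}$). -}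

module Defs where

open import Data.Nat using (ℕ; zero; suc; _+_; _*_; _≤_; _<_; _≥_; _≤?_; _<?_)
import Data.Nat as ℕ
import Data.List
open import Data.Fin using (Fin; toℕ)
import Data.Fin as Fin
open import Data.Bool using (Bool; true; false; _∧_; _∨_; not; if_then_else_)
open import Data.List using (List; []; _∷_; map; concatMap; foldr; length; allFin)
open import Data.Nat.ListAction using (sum)
open import Data.List.Relation.Unary.All using (All)
open import Data.List.Relation.Unary.Linked using (Linked)
open import Data.Vec using (Vec; []; _∷_; lookup; toList)
open import Data.Product using (_×_; Σ; ∃; _,_)
open import Relation.Nullary.Decidable using (⌊_⌋)
open import Relation.Binary.PropositionalEquality using (_≡_)

-- Conventions: [n] = {1,…,n} is represented by Fin n (element i ↔ toℕ i + 1).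
-- The shift is harmless: all conditions below are order-theoretic.

record IsHessenberg {n : ℕ} (f : Fin n → Fin n) : Set where
  field
    extensive : ∀ (i : Fin n) → toℕ i ≤ toℕ (f i)
    monotone  : ∀ (i j : Fin n) → toℕ i ≤ toℕ j → toℕ (f i) ≤ toℕ (f j)

_≺[_]_ : {n : ℕ} → Fin n → (Fin n → Fin n) → Fin n → Set
i ≺[ f ] j = toℕ (f i) < toℕ j

-- A chain of P(f), listed in increasing order (≺_f is transitive, so a
-- list whose consecutive entries are ≺_f-related is exactly a chain).
Chain : {n : ℕ} → (Fin n → Fin n) → List (Fin n) → Set
Chain f = Linked (λ i j → i ≺[ f ] j)

LongestChainHas : {n : ℕ} → (Fin n → Fin n) → ℕ → Set
LongestChainHas f k =
  (Σ (List _) λ c → Chain f c × length c ≡ k) ×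
  (∀ c → Chain f c → length c ≤ k)

record IsPartition (n : ℕ) (λ′ : List ℕ) : Set where
  field
    positive    : All (λ k → 1 ≤ k) λ′
    decreasing  : Linked _≥_ λ′
    sums        : sum λ′ ≡ n

countB : {A : Set} → (A → Bool) → List A → ℕ
countB p [] = 0
countB p (x ∷ xs) = (if p x then 1 else 0) + countB p xs

allB : {A : Set} → (A → Bool) → List A → Bool
allB p = foldr (λ x b → p x ∧ b) true

allVecs : {A : Set} → List A → (m : ℕ) → List (Vec A m)
allVecs xs zero = [] ∷ []
allVecs xs (suc m) = concatMap (λ x → map (x ∷_) (allVecs xs m)) xs

-- Symmetric functions of degree n are compared through their
-- specialisations to N variables x₁,…,x_N, for every N, via the
-- coefficient of each monomial x^α (α : Vec ℕ N an exponent vector).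

edgeB : {n : ℕ} → (Fin n → Fin n) → Fin n → Fin n → Bool
edgeB f i j = ⌊ toℕ i <? toℕ j ⌋ ∧ ⌊ toℕ j ≤? toℕ (f i) ⌋

properB : {n N : ℕ} → (Fin n → Fin n) → Vec (Fin N) n → Bool
properB {n} f κ =
  allB (λ i → allB (λ j → not (edgeB f i j) ∨ not ⌊ lookup κ i Fin.≟ lookup κ j ⌋)
                   (allFin n))
       (allFin n)

hasMonomialB : {n N : ℕ} → Vec ℕ N → Vec (Fin N) n → Bool
hasMonomialB {n} {N} α κ =
  allB (λ c → ⌊ countB (λ v → ⌊ v Fin.≟ c ⌋) (toList κ) ℕ.≟ lookup α c ⌋) (allFin N)

coeffX : {n : ℕ} → (Fin n → Fin n) → (N : ℕ) → Vec ℕ N → ℕ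
coeffX {n} f N α = countB (λ κ → properB f κ ∧ hasMonomialB α κ) (allVecs (allFin N) n)

-- Subsets of [N] (characteristic vectors) of size k: the monomials of e_k.
subsetsOfSize : (N k : ℕ) → List (Vec Bool N)
subsetsOfSize N k =
  Data.List.filter (λ S → countB (λ b → b) (toList S) ℕ.≟ k) (allVecs (true ∷ false ∷ []) N)

-- Monomials of e_λ = e_{λ₁} ⋯ e_{λ_ℓ}: tuples (S₁,…,S_ℓ) with |S_i| = λ_i.
subsetTuples : (N : ℕ) → List ℕ → List (List (Vec Bool N))
subsetTuples N [] = [] ∷ []
subsetTuples N (k ∷ ks) =
  concatMap (λ S → map (S ∷_) (subsetTuples N ks)) (subsetsOfSize N k)

coeffE : (N : ℕ) → List ℕ → Vec ℕ N → ℕ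
coeffE N λ′ α =
  countB (λ T → allB (λ c → ⌊ countB (λ S → lookup S c) T ℕ.≟ lookup α c ⌋) (allFin N))
         (subsetTuples N λ′)

coeffESum : (N : ℕ) → List (ℕ × List ℕ) → Vec ℕ N → ℕ
coeffESum N [] α = 0
coeffESum N ((c , λ′) ∷ L) α = c * coeffE N λ′ α + coeffESum N L α

{-# OPTIONS --safe #-}
module Submission where

{- At q = 1, Hikita's process grows a Young diagram: vertices arrive in order, and a vertex whose
   earlier neighbours sit in the columns C is put into column e + 1 with probability μ C e.  These
   numbers are residues of a rational function, hence manifestly nonnegative.  If the vertices of
   a natural unit interval graph are queued, arrivals being letters u and departures letters d,
   then both the proper colourings and Hikita's process are weighted by a kernel depending only on
   the queue, and for both the generating function satisfies the modular laws
   2 udu = duu + uud and 2 dud = ddu + udd wherever the two vertices involved are twins.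

   On the words of a rectangle these laws say that ud - du is central, as in a Heisenberg algebra,
   so a functional on such words is determined by its values at the words u^i d^s u^j; moving
   twins together in this way reduces every Dyck word to disjoint unions of cliques, where the
   chromatic symmetric function is a product of the a! e_a and the process is deterministic.
   Hence X_G is the sum, over the outcomes of the process, of the probability times λ₁! e_λ₁ ⋯ λ_ℓ! e_λ_ℓ.
   The coefficients are nonnegative rationals, and integers because e_λ is unitriangular in the
   monomials. -}

open import Defs
open import Data.Bool using (Bool; true; false; if_then_else_; not; _∧_; _∨_)
import Data.Bool.Properties as Bool
open import Data.Empty using (⊥-elim)
open import Data.Fin using (Fin; zero; suc; toℕ)
import Data.Fin as Fin
import Data.Fin.Properties as Fin
open import Data.List
  using (List; []; _∷_; _++_; [_]; allFin; concatMap; filter; length; map; replicate; reverse; tabulate; upTo; _ʳ++_)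
open import Data.List.Membership.Propositional using (_∈_; _∉_; find)
open import Data.List.Membership.Propositional.Properties
  using (∈-++⁺ˡ; ∈-++⁺ʳ; ∈-++⁻; ∈-filter⁻; ∈-upTo⁺; ∈-allFin; ∈-map⁻; ∈-concatMap⁻)
open import Data.List.Properties using (++-assoc; ++-identityʳ; filter-notAll; length-++; length-replicate)
import Data.List.Properties as List
open import Data.List.Relation.Binary.Permutation.Propositional as Perm using (_↭_; ↭-sym)
import Data.List.Relation.Binary.Permutation.Propositional.Properties as Perm
open import Data.List.Relation.Unary.All using (All)
import Data.List.Relation.Unary.All as All
import Data.List.Relation.Unary.All.Properties as All
open import Data.List.Relation.Unary.AllPairs using (AllPairs)
import Data.List.Relation.Unary.AllPairs as AllPairs
import Data.List.Relation.Unary.AllPairs.Properties as AllPairs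
open import Data.List.Relation.Unary.Any using (Any; here; there)
import Data.List.Relation.Unary.Any as Any
open import Data.List.Relation.Unary.Linked using (Linked)
import Data.List.Relation.Unary.Linked as Linked
open import Data.List.Relation.Unary.Unique.Propositional using (Unique)
import Data.List.Relation.Unary.Unique.Propositional.Properties as Unique
open import Data.Nat using (ℕ; zero; suc; _≤_; _∸_; _!)
import Data.Nat as ℕ
open import Data.List.Membership.DecPropositional ℕ._≟_ using (_∈?_)
open import Data.Nat.ListAction using (product; sum)
open import Data.Nat.ListAction.Properties using (product-↭; sum-++)
import Data.Nat.Properties as ℕ
import Data.Nat.Tactic.RingSolver as NatSolver
open import Data.Product using (Σ; _×_; _,_; ∃; ∃₂; proj₁; proj₂)
open import Data.Rational using (ℚ; 0ℚ; 1ℚ; _+_; _*_; _-_; -_; 1/_; ≢-nonZero; nonNegative)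
import Data.Rational as ℚ
import Data.Rational.Properties as ℚ
open import Data.Sum using (_⊎_; inj₁; inj₂)
open import Data.Vec using (Vec; []; _∷_; lookup; toList)
import Data.Vec as Vec
import Data.Vec.Properties as Vec
open import Function using (_∘_; case_of_; mk⇔)
open import Relation.Binary.Definitions using (tri<; tri≈; tri>)
open import Relation.Binary.PropositionalEquality hiding ([_])
open import Relation.Nullary using (¬_; ¬?; Dec; yes; no)
open import Relation.Nullary.Decidable using (⌊_⌋; dec⇒maybe)
open import Tactic.RingSolver using (solve-∀)
open import Tactic.RingSolver.Core.AlmostCommutativeRing using (AlmostCommutativeRing; fromCommutativeRing)
open ≡-Reasoning

-- The modular laws do not hold outcome by outcome; in general only the sum over both orders of the
-- symbols of two vertices cancels. Each law therefore asks for twins: in `law₁` the two vertices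
-- leave by consecutive letters, in `law₂` they arrived by consecutive letters. The first condition
-- depends on the suffix of the word, so a factor of a word obeys the Heisenberg relations only if
-- the suffix removes its arrivals together. This obstacle shapes the reduction: a suffix is first
-- replaced by suffixes that empty the queue in whole blocks (`Unsplit`), by induction on its
-- length, and only then do letters move.
--
-- The rational function behind `μ C` is 1/x times the product of (x - s)/(x - s - 1) over s in C,
-- and `μ C e` is its residue at x = e when C has no repetition. The cancellations are partial
-- fraction identities for such products.

ℚ-ring : AlmostCommutativeRing _ _
ℚ-ring = fromCommutativeRing ℚ.+-*-commutativeRing (λ x → dec⇒maybe (0ℚ ℚ.≟ x))

-- Naturals inside the rationals

2ℚ : ℚ
2ℚ = 1ℚ + 1ℚ

-- By this recursion `ι (suc n)` unfolds to `1ℚ + ι n`, so the ring solver sees the shifts by one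
-- between neighbouring columns.
ι : ℕ → ℚ
ι zero = 0ℚ
ι (suc n) = 1ℚ + ι n

-- Inverse with the junk value inv 0 = 0.
opaque
 inv : ℚ → ℚ
 inv p with p ℚ.≟ 0ℚ
 ... | yes _ = 0ℚ
 ... | no p≢0 = (1/ p) {{≢-nonZero p≢0}}

 inv-inverseʳ : ∀ {p} → p ≢ 0ℚ → p * inv p ≡ 1ℚ
 inv-inverseʳ {p} p≢0 with p ℚ.≟ 0ℚ
 ... | yes p≡0 = ⊥-elim (p≢0 p≡0)
 ... | no p≢0′ = ℚ.*-inverseʳ p {{≢-nonZero p≢0′}}

*-cancel-0 : ∀ {p q} → p ≢ 0ℚ → p * q ≡ 0ℚ → q ≡ 0ℚ
*-cancel-0 {p} {q} p≢0 pq≡0 = begin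
  q               ≡⟨ sym (ℚ.*-identityˡ q) ⟩
  1ℚ * q          ≡⟨ cong (_* q) (sym (inv-inverseʳ p≢0)) ⟩
  (p * inv p) * q ≡⟨ lemma p (inv p) q ⟩
  inv p * (p * q) ≡⟨ cong (inv p *_) pq≡0 ⟩
  inv p * 0ℚ      ≡⟨ ℚ.*-zeroʳ (inv p) ⟩
  0ℚ              ∎
  where
  lemma : ∀ p i q → (p * i) * q ≡ i * (p * q)
  lemma = solve-∀ ℚ-ring

zero-*ˡ : ∀ {p} q → p ≡ 0ℚ → p * q ≡ 0ℚ
zero-*ˡ q refl = ℚ.*-zeroˡ q

zero-*ʳ : ∀ p {q} → q ≡ 0ℚ → p * q ≡ 0ℚ
zero-*ʳ p refl = ℚ.*-zeroʳ p

0≤1 : 0ℚ ℚ.≤ 1ℚ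
0≤1 = ℚ.nonNegative⁻¹ 1ℚ

+-nonneg : ∀ {p q} → 0ℚ ℚ.≤ p → 0ℚ ℚ.≤ q → 0ℚ ℚ.≤ p + q
+-nonneg = ℚ.+-mono-≤

*-nonneg : ∀ {p q} → 0ℚ ℚ.≤ p → 0ℚ ℚ.≤ q → 0ℚ ℚ.≤ p * q
*-nonneg {p} {q} 0≤p 0≤q =
  subst (ℚ._≤ p * q) (ℚ.*-zeroʳ p) (ℚ.*-monoˡ-≤-nonNeg p {{nonNegative 0≤p}} 0≤q)

ι-nonneg : ∀ n → 0ℚ ℚ.≤ ι n
ι-nonneg zero = ℚ.≤-refl
ι-nonneg (suc n) = +-nonneg 0≤1 (ι-nonneg n)

ι-suc≢0 : ∀ n → ι (suc n) ≢ 0ℚ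
ι-suc≢0 n eq = ℚ.<-irrefl (sym eq)
  (ℚ.<-≤-trans (ℚ.positive⁻¹ 1ℚ)
    (subst (ℚ._≤ ι (suc n)) (ℚ.+-identityʳ 1ℚ) (ℚ.+-monoʳ-≤ 1ℚ (ι-nonneg n))))

ι-+ : ∀ m n → ι (m ℕ.+ n) ≡ ι m + ι n
ι-+ zero n = sym (ℚ.+-identityˡ (ι n))
ι-+ (suc m) n = trans (cong (1ℚ +_) (ι-+ m n)) (sym (ℚ.+-assoc 1ℚ (ι m) (ι n)))

ι-* : ∀ m n → ι (m ℕ.* n) ≡ ι m * ι n
ι-* zero n = sym (ℚ.*-zeroˡ (ι n))
ι-* (suc m) n = begin
  ι (n ℕ.+ m ℕ.* n)  ≡⟨ ι-+ n (m ℕ.* n) ⟩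
  ι n + ι (m ℕ.* n)  ≡⟨ cong (ι n +_) (ι-* m n) ⟩
  ι n + ι m * ι n    ≡⟨ lemma (ι n) (ι m) ⟩
  (1ℚ + ι m) * ι n   ∎
  where
  lemma : ∀ n m → n + m * n ≡ (1ℚ + m) * n
  lemma = solve-∀ ℚ-ring

ι-injective : ∀ {m n} → ι m ≡ ι n → m ≡ n
ι-injective {zero} {zero} _ = refl
ι-injective {zero} {suc n} eq = ⊥-elim (ι-suc≢0 n (sym eq))
ι-injective {suc m} {zero} eq = ⊥-elim (ι-suc≢0 m eq)
ι-injective {suc m} {suc n} eq = cong suc (ι-injective (begin
  ι m               ≡⟨ lemma (ι m) ⟩
  (1ℚ + ι m) - 1ℚ   ≡⟨ cong (_- 1ℚ) eq ⟩
  (1ℚ + ι n) - 1ℚ   ≡⟨ sym (lemma (ι n)) ⟩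
  ι n               ∎))
  where
  lemma : ∀ x → x ≡ (1ℚ + x) - 1ℚ
  lemma = solve-∀ ℚ-ring

difference-0 : ∀ {p q} → p - q ≡ 0ℚ → p ≡ q
difference-0 {p} {q} eq = trans (restore p q) (trans (cong (_+ q) eq) (ℚ.+-identityˡ q))
  where
  restore : ∀ p q → p ≡ (p - q) + q
  restore = solve-∀ ℚ-ring

ι-diff≢0 : ∀ {m n} → m ≢ n → ι m - ι n ≢ 0ℚ
ι-diff≢0 m≢n eq = m≢n (ι-injective (difference-0 eq))

inv-unique : ∀ {p x} → p * x ≡ 1ℚ → inv p ≡ x
inv-unique {p} {x} px≡1 = begin
  inv p             ≡⟨ sym (ℚ.*-identityʳ (inv p)) ⟩
  inv p * 1ℚ        ≡⟨ cong (inv p *_) (sym px≡1) ⟩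
  inv p * (p * x)   ≡⟨ lemma (inv p) p x ⟩
  (p * inv p) * x   ≡⟨ cong (_* x) (inv-inverseʳ p≢0) ⟩
  1ℚ * x            ≡⟨ ℚ.*-identityˡ x ⟩
  x                 ∎
  where
  lemma : ∀ i p x → i * (p * x) ≡ (p * i) * x
  lemma = solve-∀ ℚ-ring
  p≢0 : p ≢ 0ℚ
  p≢0 refl = ℚ.1≢0 (trans (sym px≡1) (ℚ.*-zeroˡ x))

-- The transition kernel `μ`

-- The Kerov-type factor 1 + 1/(e - s - 1).  At the pole e = s + 1 the value is 1:
-- the kernel μ below is a residue, and the pole itself is accounted for by mem.
opaque
  θ : ℕ → ℕ → ℚ
  θ e s with e ℕ.≟ suc s
  ... | yes _ = 1ℚ
  ... | no _ = 1ℚ + inv (ι e - ι (suc s))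

  θ-pole : ∀ s → θ (suc s) s ≡ 1ℚ
  θ-pole s with suc s ℕ.≟ suc s
  ... | yes _ = refl
  ... | no ≢ = ⊥-elim (≢ refl)

  θ-off : ∀ {e s} → e ≢ suc s → θ e s ≡ 1ℚ + inv (ι e - ι (suc s))
  θ-off {e} {s} e≢ with e ℕ.≟ suc s
  ... | yes eq = ⊥-elim (e≢ eq)
  ... | no _ = refl

θ-value : ∀ {e s x} → e ≢ suc s → (ι e - ι (suc s)) * x ≡ 1ℚ → θ e s ≡ 1ℚ + x
θ-value e≢ h = trans (θ-off e≢) (cong (1ℚ +_) (inv-unique h))

θ-self : ∀ s → θ s s ≡ 0ℚ
θ-self s = trans (θ-value (ℕ.1+n≢n ∘ sym) (lemma (ι s))) refl
  where
  lemma : ∀ x → (x - (1ℚ + x)) * - 1ℚ ≡ 1ℚ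
  lemma = solve-∀ ℚ-ring

θ-above : ∀ s → θ (suc (suc s)) s ≡ 2ℚ
θ-above s = trans (θ-value ℕ.1+n≢n (lemma (ι s))) refl
  where
  lemma : ∀ x → (1ℚ + (1ℚ + x) - (1ℚ + x)) * 1ℚ ≡ 1ℚ
  lemma = solve-∀ ℚ-ring

θ-below : ∀ s → 2ℚ * θ s (suc s) ≡ 1ℚ
θ-below s = trans (cong (2ℚ *_) (θ-value (λ ()) (lemma (ι s)))) refl
  where
  lemma : ∀ x → (x - (1ℚ + (1ℚ + x))) * ℚ.-½ ≡ 1ℚ
  lemma = solve-∀ ℚ-ring

opaque
  -- The indicator of a pole at e: either e = 0, the pole of 1/x, or e - 1 is in the list.
  mem : List ℕ → ℕ → ℚ
  mem [] zero = 1ℚ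
  mem [] (suc e) = 0ℚ
  mem (x ∷ C) e with e ℕ.≟ suc x
  ... | yes _ = 1ℚ
  ... | no _ = mem C e

  mem-[] : ∀ e → mem [] (suc e) ≡ 0ℚ
  mem-[] e = refl

  mem-zero : ∀ C → mem C zero ≡ 1ℚ
  mem-zero [] = refl
  mem-zero (x ∷ C) = mem-zero C

  mem-here : ∀ x C → mem (x ∷ C) (suc x) ≡ 1ℚ
  mem-here x C with suc x ℕ.≟ suc x
  ... | yes _ = refl
  ... | no ≢ = ⊥-elim (≢ refl)

  mem-there : ∀ {e x} C → e ≢ suc x → mem (x ∷ C) e ≡ mem C e
  mem-there {e} {x} C e≢ with e ℕ.≟ suc x
  ... | yes eq = ⊥-elim (e≢ eq)
  ... | no _ = refl

Θ : List ℕ → ℕ → ℚ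
Θ [] e = 1ℚ
Θ (x ∷ C) e = θ e x * Θ C e

-- The factor 1/x at x = e; at its own pole e = 0 it contributes the residue 1.
κ : ℕ → ℚ
κ zero = 1ℚ
κ (suc e) = inv (ι (suc e))

-- Symbol s stands for column s + 1 of Hikita's tableaux; μ C e is the probability (at q = 1)
-- that the next box goes to column e + 1 when C are the columns of the adjacent boxes.
μ : List ℕ → ℕ → ℚ
μ C e = mem C e * (κ e * Θ C e)

Θ-∈ : ∀ {C e} → e ∈ C → Θ C e ≡ 0ℚ
Θ-∈ {x ∷ C} {e} (here refl) = zero-*ˡ (Θ C e) (θ-self e)
Θ-∈ {x ∷ C} {e} (there e∈) = zero-*ʳ (θ e x) (Θ-∈ e∈)

mem-dichotomy : ∀ C s → mem C (suc s) ≡ 0ℚ ⊎ s ∈ C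
mem-dichotomy [] s = inj₁ (mem-[] s)
mem-dichotomy (x ∷ C) s with s ℕ.≟ x
... | yes eq = inj₂ (here eq)
... | no s≢x with mem-dichotomy C s
...   | inj₁ eq = inj₁ (trans (mem-there C (s≢x ∘ ℕ.suc-injective)) eq)
...   | inj₂ s∈ = inj₂ (there s∈)

mem-∉ : ∀ {C s} → s ∉ C → mem C (suc s) ≡ 0ℚ
mem-∉ {C} {s} s∉ with mem-dichotomy C s
... | inj₁ eq = eq
... | inj₂ s∈ = ⊥-elim (s∉ s∈)

-- If s + 1 is a pole, then s is in C and is a zero of the product. For two adjacent columns this
-- kills the order in which the right one is chosen first.
mem*Θ : ∀ C s → mem C (suc s) * Θ C s ≡ 0ℚ
mem*Θ C s with mem-dichotomy C s
... | inj₁ eq = zero-*ˡ (Θ C s) eq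
... | inj₂ s∈ = zero-*ʳ (mem C (suc s)) (Θ-∈ s∈)

-- Partial fractions and the exchange identities for `μ`

inv-diff : ∀ x y α β → x * α ≡ 1ℚ → y * β ≡ 1ℚ → α - β ≡ (y - x) * (α * β)
inv-diff x y α β hα hβ = begin
  α - β                        ≡⟨ e₁ α β ⟩
  α * 1ℚ - β * 1ℚ              ≡⟨ cong₂ (λ u v → α * u - β * v) (sym hβ) (sym hα) ⟩
  α * (y * β) - β * (x * α)    ≡⟨ e₂ x y α β ⟩
  (y - x) * (α * β)            ∎
  where
  e₁ : ∀ α β → α - β ≡ α * 1ℚ - β * 1ℚ
  e₁ = solve-∀ ℚ-ring
  e₂ : ∀ x y α β → α * (y * β) - β * (x * α) ≡ (y - x) * (α * β)
  e₂ = solve-∀ ℚ-ring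

1+inv : ∀ x γ → x * γ ≡ 1ℚ → 1ℚ + γ ≡ (x + 1ℚ) * γ
1+inv x γ h = trans (cong (_+ γ) (sym h)) (e x γ)
  where
  e : ∀ x γ → x * γ + γ ≡ (x + 1ℚ) * γ
  e = solve-∀ ℚ-ring

-- Together with pole-identity this is all the modular laws need: α, β, γ, δ are reciprocals of
-- differences of columns, shifted by one.
residue-identity : ∀ d e α β γ δ → α - β ≡ (e - d) * (α * β) →
  (e - (1ℚ + d)) * γ ≡ 1ℚ → (d - (1ℚ + e)) * δ ≡ 1ℚ →
  (1ℚ + γ) * (α * β - (α - β)) + (1ℚ + δ) * (α * β + (α - β)) ≡ 0ℚ
residue-identity d e α β γ δ hαβ hγ hδ = begin
  (1ℚ + γ) * (α * β - (α - β)) + (1ℚ + δ) * (α * β + (α - β))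
    -- Here 1 + γ = (e - d) γ and 1 + δ = (d - e) δ; with the given value of α - β the two summands
    -- become -(e - d) α β and (e - d) α β.
    ≡⟨ cong₂ (λ u v → u * (α * β - (α - β)) + v * (α * β + (α - β)))
         (1+inv (e - (1ℚ + d)) γ hγ) (1+inv (d - (1ℚ + e)) δ hδ) ⟩
  g * (α * β - (α - β)) + h * (α * β + (α - β))
    ≡⟨ cong (λ x → g * (α * β - x) + h * (α * β + x)) hαβ ⟩
  g * (α * β - (e - d) * (α * β)) + h * (α * β + (e - d) * (α * β))
    ≡⟨ rearrange d e (α * β) γ δ ⟩
  (e - d) * (α * β) * ((d - (1ℚ + e)) * δ - (e - (1ℚ + d)) * γ)
    ≡⟨ cong₂ (λ u v → (e - d) * (α * β) * (u - v)) hδ hγ ⟩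
  (e - d) * (α * β) * (1ℚ - 1ℚ)
    ≡⟨ ℚ.*-zeroʳ ((e - d) * (α * β)) ⟩
  0ℚ ∎
  where
  g = ((e - (1ℚ + d)) + 1ℚ) * γ
  h = ((d - (1ℚ + e)) + 1ℚ) * δ
  rearrange : ∀ d e ab γ δ →
    ((e - (1ℚ + d)) + 1ℚ) * γ * (ab - (e - d) * ab) + ((d - (1ℚ + e)) + 1ℚ) * δ * (ab + (e - d) * ab)
    ≡ (e - d) * ab * ((d - (1ℚ + e)) * δ - (e - (1ℚ + d)) * γ)
  rearrange = solve-∀ ℚ-ring

-- The same cancellation when one factor sits at its pole and takes the value 1. Since τ is the
-- reciprocal of e - d, writing 1 as (e - d) τ makes the sum a multiple of (e - d) τ.
pole-identity : ∀ d e τ γ δ → (e - d) * τ ≡ 1ℚ → (e - (1ℚ + d)) * γ ≡ 1ℚ → (d - (1ℚ + e)) * δ ≡ 1ℚ →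
  (1ℚ + γ) * ((1ℚ + τ) - 2ℚ) + (1ℚ + τ) * (1ℚ + δ) ≡ 0ℚ
pole-identity d e τ γ δ hτ hγ hδ = begin
  (1ℚ + γ) * ((1ℚ + τ) - 2ℚ) + (1ℚ + τ) * (1ℚ + δ)
    ≡⟨ cong₂ (λ u v → u * ((1ℚ + τ) - 2ℚ) + (1ℚ + τ) * v)
         (1+inv (e - (1ℚ + d)) γ hγ) (1+inv (d - (1ℚ + e)) δ hδ) ⟩
  g * ((1ℚ + τ) - 2ℚ) + (1ℚ + τ) * h
    ≡⟨ cong (λ o → g * ((o + τ) - (o + o)) + (o + τ) * h) (sym hτ) ⟩
  g * ((o + τ) - (o + o)) + (o + τ) * h
    ≡⟨ rearrange d e τ γ δ ⟩
  o * ((d - (1ℚ + e)) * δ - (e - (1ℚ + d)) * γ)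
    ≡⟨ cong₂ (λ u v → o * (u - v)) hδ hγ ⟩
  o * (1ℚ - 1ℚ)
    ≡⟨ ℚ.*-zeroʳ o ⟩
  0ℚ ∎
  where
  g = ((e - (1ℚ + d)) + 1ℚ) * γ
  h = ((d - (1ℚ + e)) + 1ℚ) * δ
  o = (e - d) * τ
  rearrange : ∀ d e τ γ δ →
    ((e - (1ℚ + d)) + 1ℚ) * γ * (((e - d) * τ + τ) - ((e - d) * τ + (e - d) * τ))
      + ((e - d) * τ + τ) * (((d - (1ℚ + e)) + 1ℚ) * δ)
    ≡ (e - d) * τ * ((d - (1ℚ + e)) * δ - (e - (1ℚ + d)) * γ)
  rearrange = solve-∀ ℚ-ring

pole-inv : ℕ → ℕ → ℚ
pole-inv e s = inv (ι e - ι (suc s))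

pole-inv-inverse : ∀ {e s} → e ≢ suc s → (ι e - ι (suc s)) * pole-inv e s ≡ 1ℚ
pole-inv-inverse e≢ = inv-inverseʳ (ι-diff≢0 e≢)

pole-inv-diffʳ : ∀ z a b → z ≢ suc a → z ≢ suc b →
  pole-inv z a - pole-inv z b ≡ (ι a - ι b) * (pole-inv z a * pole-inv z b)
pole-inv-diffʳ z a b z≢a z≢b = trans
  (inv-diff (ι z - ι (suc a)) (ι z - ι (suc b)) (pole-inv z a) (pole-inv z b) (pole-inv-inverse z≢a) (pole-inv-inverse z≢b))
  (cong (_* (pole-inv z a * pole-inv z b)) (lemma (ι z) (ι a) (ι b)))
  where
  lemma : ∀ z a b → (z - (1ℚ + b)) - (z - (1ℚ + a)) ≡ a - b
  lemma = solve-∀ ℚ-ring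

pole-inv-diffˡ : ∀ d e a → d ≢ suc a → e ≢ suc a →
  pole-inv d a - pole-inv e a ≡ (ι e - ι d) * (pole-inv d a * pole-inv e a)
pole-inv-diffˡ d e a d≢ e≢ = trans
  (inv-diff (ι d - ι (suc a)) (ι e - ι (suc a)) (pole-inv d a) (pole-inv e a) (pole-inv-inverse d≢) (pole-inv-inverse e≢))
  (cong (_* (pole-inv d a * pole-inv e a)) (lemma (ι d) (ι e) (ι a)))
  where
  lemma : ∀ d e a → (e - (1ℚ + a)) - (d - (1ℚ + a)) ≡ e - d
  lemma = solve-∀ ℚ-ring

-- The weights of two arrivals d, e in the combination duu - 2 udu + uud: a is the oldest symbol of
-- the queue, and an arrival sees it only before the letter d.
Exchange₁ : ∀ {S : Set} → (List S → S → ℚ) → S → List S → S → S → ℚ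
Exchange₁ ρ a C d e = ρ C d * ρ (d ∷ C) e - 2ℚ * (ρ (a ∷ C) d * ρ (d ∷ C) e) + ρ (a ∷ C) d * ρ (a ∷ d ∷ C) e

bracket₁ : (mᵈ mᵈᵉ mᵃᵈ mᵃᵈᵉ ted tda tea : ℚ) → ℚ
bracket₁ mᵈ mᵈᵉ mᵃᵈ mᵃᵈᵉ ted tda tea =
  ted * (mᵈ * mᵈᵉ - 2ℚ * (mᵃᵈ * tda * mᵈᵉ) + mᵃᵈ * tda * (mᵃᵈᵉ * tea))

module _ (a : ℕ) (C : List ℕ) (d e : ℕ) where
  bracket₁-μ : ℚ
  bracket₁-μ = bracket₁ (mem C d) (mem (d ∷ C) e) (mem (a ∷ C) d) (mem (a ∷ d ∷ C) e) (θ e d) (θ d a) (θ e a)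

  -- The factor split off is symmetric in d and e, so only the brackets of the two orders have to
  -- cancel.
  Exchange₁-μ : Exchange₁ μ a C d e ≡ bracket₁-μ * (κ d * κ e * (Θ C d * Θ C e))
  Exchange₁-μ =
    lemma (mem C d) (mem (d ∷ C) e) (mem (a ∷ C) d) (mem (a ∷ d ∷ C) e) (θ e d) (θ d a) (θ e a)
          (κ d) (κ e) (Θ C d) (Θ C e)
    where
    lemma : ∀ m₁ m₂ m₃ m₄ t₁ t₂ t₃ kd ke Td Te →
      m₁ * (kd * Td) * (m₂ * (ke * (t₁ * Te))) - 2ℚ * (m₃ * (kd * (t₂ * Td)) * (m₂ * (ke * (t₁ * Te))))
        + m₃ * (kd * (t₂ * Td)) * (m₄ * (ke * (t₃ * (t₁ * Te))))
      ≡ t₁ * (m₁ * m₂ - 2ℚ * (m₃ * t₂ * m₂) + m₃ * t₂ * (m₄ * t₃)) * (kd * ke * (Td * Te))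
    lemma = solve-∀ ℚ-ring

Exchange₁-sum-μ : ∀ a C d e → Exchange₁ μ a C d e + Exchange₁ μ a C e d ≡
  bracket₁-μ a C d e * (κ d * κ e * (Θ C d * Θ C e)) + bracket₁-μ a C e d * (κ d * κ e * (Θ C d * Θ C e))
Exchange₁-sum-μ a C d e = cong₂ _+_ (Exchange₁-μ a C d e) (trans (Exchange₁-μ a C e d)
  (cong (bracket₁-μ a C e d *_) (swap (κ e) (κ d) (Θ C e) (Θ C d))))
  where
  swap : ∀ ke kd Te Td → ke * kd * (Te * Td) ≡ kd * ke * (Td * Te)
  swap = solve-∀ ℚ-ring

module _ (md me mde mad made mae maed med ted tde tda tea k Td Te : ℚ) where
  -- The values of `mem` and `θ` are free scalars here; each case below fixes them by equations and
  -- leaves an identity for the ring solver.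
  combined₁ : ℚ
  combined₁ = bracket₁ md mde mad made ted tda tea * (k * (Td * Te))
            + bracket₁ me med mae maed tde tea tda * (k * (Td * Te))

case₁-generic : ∀ {md me mde mad made mae maed med ted tde tda tea} k Td Te d e α β γ δ →
  mde ≡ me → mad ≡ md → made ≡ me → mae ≡ me → maed ≡ md → med ≡ md →
  ted ≡ 1ℚ + γ → tde ≡ 1ℚ + δ → tda ≡ 1ℚ + α → tea ≡ 1ℚ + β → α - β ≡ (e - d) * (α * β) →
  (e - (1ℚ + d)) * γ ≡ 1ℚ → (d - (1ℚ + e)) * δ ≡ 1ℚ →
  combined₁ md me mde mad made mae maed med ted tde tda tea k Td Te ≡ 0ℚ
case₁-generic {md} {me} k Td Te d e α β γ δ refl refl refl refl refl refl refl refl refl refl hαβ hγ hδ =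
  trans (lemma md me k Td Te α β γ δ)
    (zero-*ʳ (md * me * (k * (Td * Te))) (residue-identity d e α β γ δ hαβ hγ hδ))
  where
  lemma : ∀ md me k Td Te α β γ δ →
    (1ℚ + γ) * (md * me - 2ℚ * (md * (1ℚ + α) * me) + md * (1ℚ + α) * (me * (1ℚ + β))) * (k * (Td * Te))
      + (1ℚ + δ) * (me * md - 2ℚ * (me * (1ℚ + β) * md) + me * (1ℚ + β) * (md * (1ℚ + α))) * (k * (Td * Te))
    ≡ md * me * (k * (Td * Te)) * ((1ℚ + γ) * (α * β - (α - β)) + (1ℚ + δ) * (α * β + (α - β)))
  lemma = solve-∀ ℚ-ring

-- Here e = d + 1, so the choice of d opens column e; in the order e, d every term contains
-- `me * Td`.
case₁-chain : ∀ {md me mde mad made mae maed med ted tde tda tea} k Td Te α β →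
  mde ≡ 1ℚ → mad ≡ md → made ≡ 1ℚ → mae ≡ me → maed ≡ md → med ≡ md →
  ted ≡ 1ℚ → tda ≡ 1ℚ + α → tea ≡ 1ℚ + β → α - β ≡ 1ℚ * (α * β) → me * Td ≡ 0ℚ →
  combined₁ md me mde mad made mae maed med ted tde tda tea k Td Te ≡ 0ℚ
case₁-chain {md} {me} {tde = tde} k Td Te α β refl refl refl refl refl refl refl refl refl hαβ h =
  trans (lemma md me tde k Td Te α β)
    (trans (cong₂ (λ u v → md * (k * (Td * Te)) * (α * β - u) + v * rest) hαβ h) (finish (md * (k * (Td * Te))) (α * β) rest))
  where
  rest = tde * (md - 2ℚ * ((1ℚ + β) * md) + (1ℚ + β) * (md * (1ℚ + α))) * (k * Te)
  lemma : ∀ md me tde k Td Te α β →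
    1ℚ * (md * 1ℚ - 2ℚ * (md * (1ℚ + α) * 1ℚ) + md * (1ℚ + α) * (1ℚ * (1ℚ + β))) * (k * (Td * Te))
      + tde * (me * md - 2ℚ * (me * (1ℚ + β) * md) + me * (1ℚ + β) * (md * (1ℚ + α))) * (k * (Td * Te))
    ≡ md * (k * (Td * Te)) * (α * β - (α - β))
      + me * Td * (tde * (md - 2ℚ * ((1ℚ + β) * md) + (1ℚ + β) * (md * (1ℚ + α))) * (k * Te))
  lemma = solve-∀ ℚ-ring
  finish : ∀ x y z → x * (y - 1ℚ * y) + 0ℚ * z ≡ 0ℚ
  finish = solve-∀ ℚ-ring

-- Here d = a + 1 is a pole only while a is queued, so every term in which d arrives after a has
-- left vanishes.
case₁-new : ∀ {md me mde mad made mae maed med ted tde tda tea} k Td Te d e τ γ δ →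
  md ≡ 0ℚ → mde ≡ me → mad ≡ 1ℚ → made ≡ me → mae ≡ me → maed ≡ 1ℚ → med ≡ md →
  ted ≡ 1ℚ + γ → tde ≡ 1ℚ + δ → tda ≡ 1ℚ → tea ≡ 1ℚ + τ →
  (e - d) * τ ≡ 1ℚ → (e - (1ℚ + d)) * γ ≡ 1ℚ → (d - (1ℚ + e)) * δ ≡ 1ℚ →
  combined₁ md me mde mad made mae maed med ted tde tda tea k Td Te ≡ 0ℚ
case₁-new {me = me} k Td Te d e τ γ δ refl refl refl refl refl refl refl refl refl refl refl hτ hγ hδ =
  trans (lemma me k Td Te τ γ δ)
    (zero-*ʳ (me * (k * (Td * Te))) (pole-identity d e τ γ δ hτ hγ hδ))
  where
  lemma : ∀ me k Td Te τ γ δ →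
    (1ℚ + γ) * (0ℚ * me - 2ℚ * (1ℚ * 1ℚ * me) + 1ℚ * 1ℚ * (me * (1ℚ + τ))) * (k * (Td * Te))
      + (1ℚ + δ) * (me * 0ℚ - 2ℚ * (me * (1ℚ + τ) * 0ℚ) + me * (1ℚ + τ) * (1ℚ * 1ℚ)) * (k * (Td * Te))
    ≡ me * (k * (Td * Te)) * ((1ℚ + γ) * ((1ℚ + τ) - 2ℚ) + (1ℚ + τ) * (1ℚ + δ))
  lemma = solve-∀ ℚ-ring

-- The columns a, d, e are consecutive: `tea` = 2 balances the coefficient 2 of the middle term, and
-- the order e, d vanishes through `me * Td`.
case₁-new-chain : ∀ {md me mde mad made mae maed med ted tde tda tea} k Td Te →
  md ≡ 0ℚ → mde ≡ 1ℚ → mad ≡ 1ℚ → made ≡ 1ℚ → med ≡ md →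
  mae ≡ me → ted ≡ 1ℚ → tda ≡ 1ℚ → tea ≡ 2ℚ → me * Td ≡ 0ℚ →
  combined₁ md me mde mad made mae maed med ted tde tda tea k Td Te ≡ 0ℚ
case₁-new-chain {me = me} {maed = maed} {tde = tde} k Td Te refl refl refl refl refl refl refl refl refl h =
  trans (lemma me maed tde k Td Te) (zero-*ˡ (tde * (2ℚ * maed) * (k * Te)) h)
  where
  lemma : ∀ me maed tde k Td Te →
    1ℚ * (0ℚ * 1ℚ - 2ℚ * (1ℚ * 1ℚ * 1ℚ) + 1ℚ * 1ℚ * (1ℚ * 2ℚ)) * (k * (Td * Te))
      + tde * (me * 0ℚ - 2ℚ * (me * 2ℚ * 0ℚ) + me * 2ℚ * (maed * 1ℚ)) * (k * (Td * Te))
    ≡ me * Td * (tde * (2ℚ * maed) * (k * Te))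
  lemma = solve-∀ ℚ-ring

-- Here d = a + 1 and e = a. Column a cannot be chosen while a is queued, and what survives is a
-- multiple of 1 - 2 `ted`, where `ted` is one half.
case₁-new-below : ∀ {md me mde mad made mae maed med ted tde tda tea} k Td Te →
  md ≡ 0ℚ → mde ≡ me → mad ≡ 1ℚ → med ≡ 1ℚ → mae ≡ me →
  2ℚ * ted ≡ 1ℚ → tde ≡ 1ℚ → tda ≡ 1ℚ → tea ≡ 0ℚ →
  combined₁ md me mde mad made mae maed med ted tde tda tea k Td Te ≡ 0ℚ
case₁-new-below {me = me} {made = made} {maed = maed} {ted = ted} k Td Te refl refl refl refl refl h refl refl refl =
  trans (lemma me made maed ted k Td Te)
    (trans (cong (λ x → me * (k * (Td * Te)) * (1ℚ - x)) h) (ℚ.*-zeroʳ (me * (k * (Td * Te)))))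
  where
  lemma : ∀ me made maed ted k Td Te →
    ted * (0ℚ * me - 2ℚ * (1ℚ * 1ℚ * me) + 1ℚ * 1ℚ * (made * 0ℚ)) * (k * (Td * Te))
      + 1ℚ * (me * 1ℚ - 2ℚ * (me * 0ℚ * 1ℚ) + me * 0ℚ * (maed * 1ℚ)) * (k * (Td * Te))
    ≡ me * (k * (Td * Te)) * (1ℚ - 2ℚ * ted)
  lemma = solve-∀ ℚ-ring

-- The claim is symmetric in d and e; in this normalisation only d may lie directly after a, and
-- only e directly after d.
μ-exchange₁-ordered : ∀ {a C} d e → a ∉ C → e ≢ suc a → d ≢ suc e →
  Exchange₁ μ a C d e + Exchange₁ μ a C e d ≡ 0ℚ
μ-exchange₁-ordered {a} {C} d e a∉ e≢a d≢e =
  trans (Exchange₁-sum-μ a C d e) (cases (d ℕ.≟ suc a) (e ℕ.≟ suc d))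
  where
  K = κ d * κ e
  Goal = combined₁ (mem C d) (mem C e) (mem (d ∷ C) e) (mem (a ∷ C) d) (mem (a ∷ d ∷ C) e) (mem (a ∷ C) e)
      (mem (a ∷ e ∷ C) d) (mem (e ∷ C) d) (θ e d) (θ d e) (θ d a) (θ e a) K (Θ C d) (Θ C e) ≡ 0ℚ
  cases : Dec (d ≡ suc a) → Dec (e ≡ suc d) → Goal
  cases (no d≢a) (no e≢d) =
    case₁-generic K (Θ C d) (Θ C e) (ι d) (ι e) (pole-inv d a) (pole-inv e a) (pole-inv e d) (pole-inv d e)
      (mem-there C e≢d) (mem-there C d≢a)
      (trans (mem-there (d ∷ C) e≢a) (mem-there C e≢d)) (mem-there C e≢a)
      (trans (mem-there (e ∷ C) d≢a) (mem-there C d≢e)) (mem-there C d≢e)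
      (θ-off e≢d) (θ-off d≢e) (θ-off d≢a) (θ-off e≢a)
      (pole-inv-diffˡ d e a d≢a e≢a) (pole-inv-inverse e≢d) (pole-inv-inverse d≢e)
  cases (no d≢a) (yes refl) =
    case₁-chain {tde = θ d e} K (Θ C d) (Θ C e) (pole-inv d a) (pole-inv e a) (mem-here d C) (mem-there C d≢a)
      (trans (mem-there (d ∷ C) e≢a) (mem-here d C)) (mem-there C e≢a)
      (trans (mem-there (e ∷ C) d≢a) (mem-there C d≢e)) (mem-there C d≢e)
      (θ-pole d) (θ-off d≢a) (θ-off e≢a)
      (trans (pole-inv-diffˡ d e a d≢a e≢a) (cong (_* (pole-inv d a * pole-inv e a)) (one (ι d)))) (mem*Θ C d)
    where
    one : ∀ x → 1ℚ + x - x ≡ 1ℚ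
    one = solve-∀ ℚ-ring
  cases (yes refl) (no e≢d) =
    case₁-new K (Θ C d) (Θ C e) (ι d) (ι e) (pole-inv e a) (pole-inv e d) (pole-inv d e)
      (mem-∉ a∉) (mem-there C e≢d) (mem-here a C)
      (trans (mem-there (d ∷ C) e≢a) (mem-there C e≢d)) (mem-there C e≢a) (mem-here a (e ∷ C))
      (mem-there C d≢e) (θ-off e≢d) (θ-off d≢e) (θ-pole a) (θ-off e≢a)
      (pole-inv-inverse e≢a) (pole-inv-inverse e≢d) (pole-inv-inverse d≢e)
  cases (yes refl) (yes refl) =
    case₁-new-chain {maed = mem (a ∷ e ∷ C) d} {tde = θ d e} K (Θ C d) (Θ C e)
      (mem-∉ a∉) (mem-here d C) (mem-here a C)
      (trans (mem-there (d ∷ C) e≢a) (mem-here d C)) (mem-there C d≢e) (mem-there C e≢a)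
      (θ-pole d) (θ-pole a) (θ-above a) (mem*Θ C d)

μ-exchange₁-equal : ∀ a C d → Exchange₁ μ a C d d ≡ 0ℚ
μ-exchange₁-equal a C d = trans (Exchange₁-μ a C d d) (trans (cong (λ t → t * m * k) (θ-self d)) (lemma m k))
  where
  k = κ d * κ d * (Θ C d * Θ C d)
  m = mem C d * mem (d ∷ C) d - 2ℚ * (mem (a ∷ C) d * θ d a * mem (d ∷ C) d)
    + mem (a ∷ C) d * θ d a * (mem (a ∷ d ∷ C) d * θ d a)
  lemma : ∀ x y → 0ℚ * x * y ≡ 0ℚ
  lemma = solve-∀ ℚ-ring

μ-exchange₁-below : ∀ {a C} → a ∉ C → Exchange₁ μ a C (suc a) a + Exchange₁ μ a C a (suc a) ≡ 0ℚ
μ-exchange₁-below {a} {C} a∉ = trans (Exchange₁-sum-μ a C d a)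
  (case₁-new-below {made = mem (a ∷ d ∷ C) a} {maed = mem (a ∷ a ∷ C) d} {ted = θ a d} (κ d * κ a) (Θ C d) (Θ C a)
      (mem-∉ a∉) (mem-there C (λ ())) (mem-here a C) (mem-here a C) (mem-there C (ℕ.1+n≢n ∘ sym))
      (θ-below a) (θ-pole a) (θ-pole a) (θ-self a))
  where
  d = suc a

μ-exchange₁ : ∀ {a C} d e → a ∉ C → Exchange₁ μ a C d e + Exchange₁ μ a C e d ≡ 0ℚ
μ-exchange₁ {a} {C} d e a∉ with d ℕ.≟ e
... | yes refl = cong₂ _+_ (μ-exchange₁-equal a C d) (μ-exchange₁-equal a C d)
... | no d≢e with d ℕ.≟ suc a | e ℕ.≟ suc a | d ℕ.≟ suc e | e ℕ.≟ suc d
...   | yes refl | yes refl | _ | _ = ⊥-elim (d≢e refl)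
...   | yes refl | no _ | yes eq | _ =
  subst (λ e → Exchange₁ μ a C (suc a) e + Exchange₁ μ a C e (suc a) ≡ 0ℚ) (ℕ.suc-injective eq) (μ-exchange₁-below a∉)
...   | no _ | yes refl | _ | yes eq =
  subst (λ d → Exchange₁ μ a C d (suc a) + Exchange₁ μ a C (suc a) d ≡ 0ℚ) (ℕ.suc-injective eq)
    (trans (ℚ.+-comm (Exchange₁ μ a C a (suc a)) (Exchange₁ μ a C (suc a) a)) (μ-exchange₁-below a∉))
...   | _ | no e≢a | no d≢e′ | _ = μ-exchange₁-ordered d e a∉ e≢a d≢e′
...   | no d≢a | _ | _ | no e≢d =
  trans (ℚ.+-comm (Exchange₁ μ a C d e) (Exchange₁ μ a C e d)) (μ-exchange₁-ordered e d a∉ d≢a e≢d)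
...   | no _ | no _ | yes refl | yes eq = ⊥-elim (ℕ.1+n≰n (ℕ.≤-trans (ℕ.n≤1+n _) (ℕ.≤-reflexive (sym eq))))

-- The weight of one arrival z in the combination udd - 2 dud + ddu, where the queue is a, b, C. The
-- factor in front is the weight with which the twins a, b were once appended to the queue C₀.
Exchange₂ : ∀ {S : Set} → (List S → S → ℚ) → List S → List S → S → S → S → ℚ
Exchange₂ ρ C₀ C a b z = ρ C₀ a * ρ (a ∷ C₀) b * (ρ (a ∷ b ∷ C) z - 2ℚ * ρ (b ∷ C) z + ρ C z)

bracket₂ : (mz mabz mbz tza tzb : ℚ) → ℚ
bracket₂ mz mabz mbz tza tzb = mabz * (tza * tzb) - 2ℚ * (mbz * tzb) + mz

module _ (C₀ C : List ℕ) (a b z : ℕ) where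
  weight₂-μ bracket₂-μ : ℚ
  weight₂-μ = mem C₀ a * mem (a ∷ C₀) b * θ b a
  bracket₂-μ = bracket₂ (mem C z) (mem (a ∷ b ∷ C) z) (mem (b ∷ C) z) (θ z a) (θ z b)

  Exchange₂-μ : Exchange₂ μ C₀ C a b z ≡ weight₂-μ * bracket₂-μ * (κ a * κ b * (κ z * Θ C z) * (Θ C₀ a * Θ C₀ b))
  Exchange₂-μ =
    lemma (mem C₀ a) (mem (a ∷ C₀) b) (θ b a) (mem C z) (mem (a ∷ b ∷ C) z) (mem (b ∷ C) z) (θ z a) (θ z b)
      (κ a) (κ b) (κ z) (Θ C z) (Θ C₀ a) (Θ C₀ b)
    where
    lemma : ∀ ma mab tba mz mabz mbz tza tzb ka kb kz Tz Ta Tb →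
      ma * (ka * Ta) * (mab * (kb * (tba * Tb)))
        * (mabz * (kz * (tza * (tzb * Tz))) - 2ℚ * (mbz * (kz * (tzb * Tz))) + mz * (kz * Tz))
      ≡ ma * mab * tba * (mabz * (tza * tzb) - 2ℚ * (mbz * tzb) + mz) * (ka * kb * (kz * Tz) * (Ta * Tb))
    lemma = solve-∀ ℚ-ring

Exchange₂-sum-μ : ∀ C₀ C a b z → Exchange₂ μ C₀ C a b z + Exchange₂ μ C₀ C b a z ≡
  weight₂-μ C₀ C a b z * bracket₂-μ C₀ C a b z * (κ a * κ b * (κ z * Θ C z) * (Θ C₀ a * Θ C₀ b))
  + weight₂-μ C₀ C b a z * bracket₂-μ C₀ C b a z * (κ a * κ b * (κ z * Θ C z) * (Θ C₀ a * Θ C₀ b))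
Exchange₂-sum-μ C₀ C a b z = cong₂ _+_ (Exchange₂-μ C₀ C a b z) (trans (Exchange₂-μ C₀ C b a z)
  (cong (weight₂-μ C₀ C b a z * bracket₂-μ C₀ C b a z *_) (swap (κ a) (κ b) (κ z * Θ C z) (Θ C₀ a) (Θ C₀ b))))
  where
  swap : ∀ ka kb z Ta Tb → kb * ka * z * (Tb * Ta) ≡ ka * kb * z * (Ta * Tb)
  swap = solve-∀ ℚ-ring

module _ (ma mb mab mba tab tba mz mabz mbaz maz mbz tza tzb k Ta Tb : ℚ) where
  combined₂ : ℚ
  combined₂ = ma * mab * tba * bracket₂ mz mabz mbz tza tzb * (k * (Ta * Tb))
            + mb * mba * tab * bracket₂ mz mbaz maz tzb tza * (k * (Ta * Tb))

case₂-generic : ∀ {ma mb mab mba tab tba mz mabz mbaz maz mbz tza tzb} k Ta Tb a b α β γ δ →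
  mab ≡ mb → mba ≡ ma → mabz ≡ mz → mbaz ≡ mz → maz ≡ mz → mbz ≡ mz →
  tba ≡ 1ℚ + γ → tab ≡ 1ℚ + δ → tza ≡ 1ℚ + α → tzb ≡ 1ℚ + β → β - α ≡ (b - a) * (β * α) →
  (b - (1ℚ + a)) * γ ≡ 1ℚ → (a - (1ℚ + b)) * δ ≡ 1ℚ →
  combined₂ ma mb mab mba tab tba mz mabz mbaz maz mbz tza tzb k Ta Tb ≡ 0ℚ
case₂-generic {ma} {mb} {mz = mz} k Ta Tb a b α β γ δ refl refl refl refl refl refl refl refl refl refl hαβ hγ hδ =
  trans (lemma ma mb mz k Ta Tb α β γ δ)
    (zero-*ʳ (ma * mb * mz * (k * (Ta * Tb))) (residue-identity a b β α γ δ hαβ hγ hδ))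
  where
  lemma : ∀ ma mb mz k Ta Tb α β γ δ →
    ma * mb * (1ℚ + γ) * (mz * ((1ℚ + α) * (1ℚ + β)) - 2ℚ * (mz * (1ℚ + β)) + mz) * (k * (Ta * Tb))
      + mb * ma * (1ℚ + δ) * (mz * ((1ℚ + β) * (1ℚ + α)) - 2ℚ * (mz * (1ℚ + α)) + mz) * (k * (Ta * Tb))
    ≡ ma * mb * mz * (k * (Ta * Tb)) * ((1ℚ + γ) * (β * α - (β - α)) + (1ℚ + δ) * (β * α + (β - α)))
  lemma = solve-∀ ℚ-ring

case₂-pole : ∀ {ma mb mab mba tab tba mz mabz mbaz maz mbz tza tzb} k Ta Tb a b τ γ δ →
  mz ≡ 0ℚ → mab ≡ mb → mba ≡ ma → mabz ≡ 1ℚ → mbaz ≡ 1ℚ → maz ≡ 1ℚ → mbz ≡ mz →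
  tba ≡ 1ℚ + γ → tab ≡ 1ℚ + δ → tza ≡ 1ℚ → tzb ≡ 1ℚ + τ →
  (a - b) * τ ≡ 1ℚ → (b - (1ℚ + a)) * γ ≡ 1ℚ → (a - (1ℚ + b)) * δ ≡ 1ℚ →
  combined₂ ma mb mab mba tab tba mz mabz mbaz maz mbz tza tzb k Ta Tb ≡ 0ℚ
case₂-pole {ma} {mb} k Ta Tb a b τ γ δ refl refl refl refl refl refl refl refl refl refl refl hτ hγ hδ =
  trans (lemma ma mb k Ta Tb τ γ δ)
    (zero-*ʳ (ma * mb * (k * (Ta * Tb))) (pole-identity b a τ δ γ hτ hδ hγ))
  where
  lemma : ∀ ma mb k Ta Tb τ γ δ →
    ma * mb * (1ℚ + γ) * (1ℚ * (1ℚ * (1ℚ + τ)) - 2ℚ * (0ℚ * (1ℚ + τ)) + 0ℚ) * (k * (Ta * Tb))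
      + mb * ma * (1ℚ + δ) * (1ℚ * ((1ℚ + τ) * 1ℚ) - 2ℚ * (1ℚ * 1ℚ) + 0ℚ) * (k * (Ta * Tb))
    ≡ ma * mb * (k * (Ta * Tb)) * ((1ℚ + δ) * ((1ℚ + τ) - 2ℚ) + (1ℚ + τ) * (1ℚ + γ))
  lemma = solve-∀ ℚ-ring

case₂-vanishing : ∀ ma mb mab mba tab tba mz mabz mbaz maz mbz tza tzb k Ta Tb →
  bracket₂ mz mabz mbz tza tzb ≡ 0ℚ → mb * Ta ≡ 0ℚ →
  combined₂ ma mb mab mba tab tba mz mabz mbaz maz mbz tza tzb k Ta Tb ≡ 0ℚ
case₂-vanishing ma mb mab mba tab tba mz mabz mbaz maz mbz tza tzb k Ta Tb hb hT =
  trans (lemma₁ (ma * mab * tba) (bracket₂ mz mabz mbz tza tzb) mb mba tab (bracket₂ mz mbaz maz tzb tza) k Ta Tb)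
    (trans (cong₂ (λ u v → u * (ma * mab * tba * (k * (Ta * Tb))) + v *
        (mba * tab * bracket₂ mz mbaz maz tzb tza * (k * Tb))) hb hT)
      (lemma₂ (ma * mab * tba * (k * (Ta * Tb))) (mba * tab * bracket₂ mz mbaz maz tzb tza * (k * Tb))))
  where
  lemma₁ : ∀ w b mb mba tab b′ k Ta Tb →
    w * b * (k * (Ta * Tb)) + mb * mba * tab * b′ * (k * (Ta * Tb))
    ≡ b * (w * (k * (Ta * Tb))) + mb * Ta * (mba * tab * b′ * (k * Tb))
  lemma₁ = solve-∀ ℚ-ring
  lemma₂ : ∀ x y → 0ℚ * x + 0ℚ * y ≡ 0ℚ
  lemma₂ = solve-∀ ℚ-ring

bracket₂-generic : ∀ {mz mabz mbz tza tzb} α β → mabz ≡ mz → mbz ≡ mz → tza ≡ 1ℚ + α → tzb ≡ 1ℚ + β →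
  α - β ≡ - 1ℚ * (α * β) → bracket₂ mz mabz mbz tza tzb ≡ 0ℚ
bracket₂-generic {mz} α β refl refl refl refl h =
  trans (lemma mz α β) (trans (cong (λ x → mz * (α * β + x)) h) (cancel mz (α * β)))
  where
  lemma : ∀ m α β → m * ((1ℚ + α) * (1ℚ + β)) - 2ℚ * (m * (1ℚ + β)) + m ≡ m * (α * β + (α - β))
  lemma = solve-∀ ℚ-ring
  cancel : ∀ m x → m * (x + - 1ℚ * x) ≡ 0ℚ
  cancel = solve-∀ ℚ-ring

bracket₂-pole : ∀ {mz tzb} mabz mbz tza → mz ≡ 0ℚ → tzb ≡ 0ℚ → bracket₂ mz mabz mbz tza tzb ≡ 0ℚ
bracket₂-pole mabz mbz tza refl refl = lemma mabz mbz tza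
  where
  lemma : ∀ x y t → x * (t * 0ℚ) - 2ℚ * (y * 0ℚ) + 0ℚ ≡ 0ℚ
  lemma = solve-∀ ℚ-ring

bracket₂-above : ∀ {mz mabz mbz tza tzb} → mz ≡ 0ℚ → mabz ≡ 1ℚ → mbz ≡ 1ℚ → tza ≡ 2ℚ → tzb ≡ 1ℚ →
  bracket₂ mz mabz mbz tza tzb ≡ 0ℚ
bracket₂-above refl refl refl refl refl = refl

-- For adjacent columns the alternating sum vanishes for each z by itself. The opposite order of the
-- twins does not cancel against it but has weight 0 by `mem*Θ`.
bracket₂-chain : ∀ {a C} z → a ∉ C → suc a ∉ C →
  bracket₂ (mem C z) (mem (a ∷ suc a ∷ C) z) (mem (suc a ∷ C) z) (θ z a) (θ z (suc a)) ≡ 0ℚ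
bracket₂-chain {a} {C} z a∉ b∉ with z ℕ.≟ suc a | z ℕ.≟ suc (suc a)
... | yes refl | _ = bracket₂-pole (mem (a ∷ z ∷ C) z) (mem (z ∷ C) z) (θ z a) (mem-∉ a∉) (θ-self z)
... | no z≢ | yes refl = bracket₂-above (mem-∉ b∉)
  (trans (mem-there (suc a ∷ C) z≢) (mem-here (suc a) C)) (mem-here (suc a) C) (θ-above a) (θ-pole (suc a))
... | no z≢a | no z≢b = bracket₂-generic (pole-inv z a) (pole-inv z (suc a))
  (trans (mem-there (suc a ∷ C) z≢a) (mem-there C z≢b)) (mem-there C z≢b) (θ-off z≢a) (θ-off z≢b)
  (trans (pole-inv-diffʳ z a (suc a) z≢a z≢b) (cong (_* (pole-inv z a * pole-inv z (suc a))) (lemma (ι a))))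
  where
  lemma : ∀ x → x - (1ℚ + x) ≡ - 1ℚ
  lemma = solve-∀ ℚ-ring

μ-exchange₂-ordered : ∀ {C₀ C} a b z → a ∉ C → b ∉ C → a ≢ b → a ≢ suc b → z ≢ suc b ⊎ b ≡ suc a →
  Exchange₂ μ C₀ C a b z + Exchange₂ μ C₀ C b a z ≡ 0ℚ
μ-exchange₂-ordered {C₀} {C} a b z a∉ b∉ a≢b a≢sb h =
  trans (Exchange₂-sum-μ C₀ C a b z) (cases (b ℕ.≟ suc a) (z ℕ.≟ suc a) h)
  where
  K = κ a * κ b * (κ z * Θ C z)
  Goal = combined₂ (mem C₀ a) (mem C₀ b) (mem (a ∷ C₀) b) (mem (b ∷ C₀) a) (θ a b) (θ b a) (mem C z)
    (mem (a ∷ b ∷ C) z) (mem (b ∷ a ∷ C) z) (mem (a ∷ C) z) (mem (b ∷ C) z) (θ z a) (θ z b) K (Θ C₀ a) (Θ C₀ b) ≡ 0ℚ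
  cases : Dec (b ≡ suc a) → Dec (z ≡ suc a) → z ≢ suc b ⊎ b ≡ suc a → Goal
  cases (yes refl) _ _ =
    case₂-vanishing (mem C₀ a) (mem C₀ b) (mem (a ∷ C₀) b) (mem (b ∷ C₀) a) (θ a b) (θ b a) (mem C z)
      (mem (a ∷ b ∷ C) z) (mem (b ∷ a ∷ C) z) (mem (a ∷ C) z) (mem (b ∷ C) z) (θ z a) (θ z b) K (Θ C₀ a) (Θ C₀ b)
      (bracket₂-chain z a∉ b∉) (mem*Θ C₀ a)
  cases (no b≢) _ (inj₂ b≡) = ⊥-elim (b≢ b≡)
  cases (no b≢) (yes refl) (inj₁ z≢b) =
    case₂-pole K (Θ C₀ a) (Θ C₀ b) (ι a) (ι b) (pole-inv z b) (pole-inv b a) (pole-inv a b)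
      (mem-∉ a∉) (mem-there C₀ b≢) (mem-there C₀ a≢sb) (mem-here a (b ∷ C))
      (trans (mem-there (a ∷ C) z≢b) (mem-here a C)) (mem-here a C) (mem-there C z≢b)
      (θ-off b≢) (θ-off a≢sb) (θ-pole a) (θ-off z≢b)
      (trans (cong (_* pole-inv z b) (lemma (ι a) (ι b))) (pole-inv-inverse z≢b))
      (pole-inv-inverse b≢) (pole-inv-inverse a≢sb)
    where
    lemma : ∀ x y → x - y ≡ (1ℚ + x) - (1ℚ + y)
    lemma = solve-∀ ℚ-ring
  cases (no b≢) (no z≢a) (inj₁ z≢b) =
    case₂-generic K (Θ C₀ a) (Θ C₀ b) (ι a) (ι b) (pole-inv z a) (pole-inv z b) (pole-inv b a) (pole-inv a b)
      (mem-there C₀ b≢) (mem-there C₀ a≢sb)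
      (trans (mem-there (b ∷ C) z≢a) (mem-there C z≢b)) (trans (mem-there (a ∷ C) z≢b) (mem-there C z≢a))
      (mem-there C z≢a) (mem-there C z≢b) (θ-off b≢) (θ-off a≢sb) (θ-off z≢a) (θ-off z≢b)
      (pole-inv-diffʳ z b a z≢b z≢a) (pole-inv-inverse b≢) (pole-inv-inverse a≢sb)

μ-exchange₂-equal : ∀ C₀ C a z → Exchange₂ μ C₀ C a a z ≡ 0ℚ
μ-exchange₂-equal C₀ C a z = trans (Exchange₂-μ C₀ C a a z)
  (trans (cong (λ t → m * t * bracket₂-μ C₀ C a a z * k) (θ-self a)) (lemma m (bracket₂-μ C₀ C a a z) k))
  where
  m = mem C₀ a * mem (a ∷ C₀) a
  k = κ a * κ a * (κ z * Θ C z) * (Θ C₀ a * Θ C₀ a)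
  lemma : ∀ x y k → x * 0ℚ * y * k ≡ 0ℚ
  lemma = solve-∀ ℚ-ring

μ-exchange₂ : ∀ {C₀ C} a b z → a ∉ C → b ∉ C →
  Exchange₂ μ C₀ C a b z + Exchange₂ μ C₀ C b a z ≡ 0ℚ
μ-exchange₂ {C₀} {C} a b z a∉ b∉ with a ℕ.≟ b
... | yes refl = cong₂ _+_ (μ-exchange₂-equal C₀ C a z) (μ-exchange₂-equal C₀ C a z)
... | no a≢b with a ℕ.≟ suc b | b ℕ.≟ suc a | z ℕ.≟ suc b
...   | yes a≡ | _ | _ = trans (ℚ.+-comm (Exchange₂ μ C₀ C a b z) (Exchange₂ μ C₀ C b a z))
  (μ-exchange₂-ordered b a z b∉ a∉ (a≢b ∘ sym) (λ b≡ → ℕ.1+n≰n (ℕ.≤-trans (ℕ.n≤1+n _)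
      (ℕ.≤-reflexive (trans (cong suc (sym a≡)) (sym b≡))))) (inj₂ a≡))
...   | no a≢ | yes b≡ | _ = μ-exchange₂-ordered a b z a∉ b∉ a≢b a≢ (inj₂ b≡)
...   | no a≢ | no b≢ | no z≢ = μ-exchange₂-ordered a b z a∉ b∉ a≢b a≢ (inj₁ z≢)
...   | no a≢ | no b≢ | yes refl = trans (ℚ.+-comm (Exchange₂ μ C₀ C a b z) (Exchange₂ μ C₀ C b a z))
  (μ-exchange₂-ordered b a z b∉ a∉ (a≢b ∘ sym) b≢ (inj₁ (a≢b ∘ sym ∘ ℕ.suc-injective)))

-- Symmetry, freshness and positivity of `μ`

mem-cong : ∀ x {C C′} e → mem C e ≡ mem C′ e → mem (x ∷ C) e ≡ mem (x ∷ C′) e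
mem-cong x {C} {C′} e eq with e ℕ.≟ suc x
... | yes refl = trans (mem-here x C) (sym (mem-here x C′))
... | no e≢ = trans (mem-there C e≢) (trans eq (sym (mem-there C′ e≢)))

mem-swap : ∀ x y C e → mem (x ∷ y ∷ C) e ≡ mem (y ∷ x ∷ C) e
mem-swap x y C e with e ℕ.≟ suc x | e ℕ.≟ suc y
... | yes refl | yes refl = refl
... | yes refl | no e≢y = trans (mem-here x (y ∷ C)) (sym (trans (mem-there (x ∷ C) e≢y) (mem-here x C)))
... | no e≢x | yes refl = trans (trans (mem-there (y ∷ C) e≢x) (mem-here y C)) (sym (mem-here y (x ∷ C)))
... | no e≢x | no e≢y = trans (trans (mem-there (y ∷ C) e≢x) (mem-there C e≢y))
  (sym (trans (mem-there (x ∷ C) e≢y) (mem-there C e≢x)))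

mem-↭ : ∀ {C C′} → C ↭ C′ → ∀ e → mem C e ≡ mem C′ e
mem-↭ Perm.refl e = refl
mem-↭ (Perm.prep x p) e = mem-cong x e (mem-↭ p e)
mem-↭ (Perm.swap {xs = C} x y p) e = trans (mem-swap x y C e) (mem-cong y e (mem-cong x e (mem-↭ p e)))
mem-↭ (Perm.trans p q) e = trans (mem-↭ p e) (mem-↭ q e)

Θ-↭ : ∀ {C C′} → C ↭ C′ → ∀ e → Θ C e ≡ Θ C′ e
Θ-↭ Perm.refl e = refl
Θ-↭ (Perm.prep x p) e = cong (θ e x *_) (Θ-↭ p e)
Θ-↭ (Perm.swap {ys = C′} x y p) e =
  trans (cong (λ t → θ e x * (θ e y * t)) (Θ-↭ p e)) (lemma (θ e x) (θ e y) (Θ C′ e))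
  where
  lemma : ∀ a b c → a * (b * c) ≡ b * (a * c)
  lemma = solve-∀ ℚ-ring
Θ-↭ (Perm.trans p q) e = trans (Θ-↭ p e) (Θ-↭ q e)

μ-↭ : ∀ {C C′} → C ↭ C′ → ∀ e → μ C e ≡ μ C′ e
μ-↭ p e = cong₂ (λ m t → m * (κ e * t)) (mem-↭ p e) (Θ-↭ p e)

-- A symbol of nonzero weight is new, so queues that count never repeat a symbol. This supplies the
-- conditions a ∉ C of the exchange identities.
μ-fresh : ∀ C e → μ C e ≡ 0ℚ ⊎ e ∉ C
μ-fresh C e with e ∈? C
... | no e∉ = inj₂ e∉
... | yes e∈ = inj₁ (trans (cong (λ t → mem C e * (κ e * t)) (Θ-∈ e∈)) (lemma (mem C e) (κ e)))
  where
  lemma : ∀ x y → x * (y * 0ℚ) ≡ 0ℚ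
  lemma = solve-∀ ℚ-ring

inv-nonneg : ∀ {p} → p ≢ 0ℚ → 0ℚ ℚ.≤ p → 0ℚ ℚ.≤ inv p
inv-nonneg {p} p≢0 0≤p with ℚ.≤-total 0ℚ (inv p)
... | inj₁ 0≤inv = 0≤inv
... | inj₂ inv≤0 = ⊥-elim (ℚ.<-irrefl refl (ℚ.<-≤-trans (ℚ.positive⁻¹ 1ℚ)
  (subst₂ ℚ._≤_ (inv-inverseʳ p≢0) (ℚ.*-zeroʳ p) (ℚ.*-monoˡ-≤-nonNeg p {{nonNegative 0≤p}} inv≤0))))

-- Away from the pole the value is (e - s)/(e - s - 1), a quotient of consecutive integers: they
-- have the same sign unless the numerator is 0.
θ-nonneg : ∀ e s → 0ℚ ℚ.≤ θ e s
θ-nonneg e s with e ℕ.≟ suc s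
... | yes refl = subst (0ℚ ℚ.≤_) (sym (θ-pole s)) 0≤1
... | no e≢ with ℕ.<-cmp e (suc s)
...   | tri≈ _ eq _ = ⊥-elim (e≢ eq)
...   | tri> _ _ s<e with ℕ.m≤n⇒∃[o]m+o≡n (ℕ.<⇒≤ s<e)
...     | k , refl = subst (0ℚ ℚ.≤_) (sym (θ-off e≢))
  (+-nonneg 0≤1 (inv-nonneg (ι-diff≢0 e≢) (subst (0ℚ ℚ.≤_) (sym diff) (ι-nonneg k))))
  where
  cancel : ∀ x y → (x + y) - x ≡ y
  cancel = solve-∀ ℚ-ring
  diff : ι (suc s ℕ.+ k) - ι (suc s) ≡ ι k
  diff = trans (cong (_- ι (suc s)) (ι-+ (suc s) k)) (cancel (ι (suc s)) (ι k))
θ-nonneg e s | no e≢ | tri< (ℕ.s≤s e≤s) _ _ with ℕ.m≤n⇒∃[o]m+o≡n e≤s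
... | k , refl = subst (0ℚ ℚ.≤_) (sym (trans (θ-value e≢ inverse) collapse))
    (*-nonneg (ι-nonneg k) (inv-nonneg (ι-suc≢0 k) (ι-nonneg (suc k))))
  where
  y = inv (ι (suc k))
  rearrange : ∀ e k y → (e - (1ℚ + (e + k))) * - y ≡ (1ℚ + k) * y
  rearrange = solve-∀ ℚ-ring
  inverse : (ι e - ι (suc (e ℕ.+ k))) * - y ≡ 1ℚ
  inverse = trans (cong (λ x → (ι e - (1ℚ + x)) * - y) (ι-+ e k))
    (trans (rearrange (ι e) (ι k) y) (inv-inverseʳ (ι-suc≢0 k)))
  expand : ∀ k y → (1ℚ + k) * y + - y ≡ k * y
  expand = solve-∀ ℚ-ring
  collapse : 1ℚ + - y ≡ ι k * y
  collapse = trans (cong (_+ - y) (sym (inv-inverseʳ (ι-suc≢0 k)))) (expand (ι k) y)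

mem-nonneg : ∀ C e → 0ℚ ℚ.≤ mem C e
mem-nonneg [] zero = subst (0ℚ ℚ.≤_) (sym (mem-zero [])) 0≤1
mem-nonneg [] (suc e) = subst (0ℚ ℚ.≤_) (sym (mem-[] e)) ℚ.≤-refl
mem-nonneg (x ∷ C) e with e ℕ.≟ suc x
... | yes refl = subst (0ℚ ℚ.≤_) (sym (mem-here x C)) 0≤1
... | no e≢ = subst (0ℚ ℚ.≤_) (sym (mem-there C e≢)) (mem-nonneg C e)

Θ-nonneg : ∀ C e → 0ℚ ℚ.≤ Θ C e
Θ-nonneg [] e = 0≤1
Θ-nonneg (x ∷ C) e = *-nonneg (θ-nonneg e x) (Θ-nonneg C e)

κ-nonneg : ∀ e → 0ℚ ℚ.≤ κ e
κ-nonneg zero = 0≤1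
κ-nonneg (suc e) = inv-nonneg (ι-suc≢0 e) (ι-nonneg (suc e))

μ-nonneg : ∀ C e → 0ℚ ℚ.≤ μ C e
μ-nonneg C e = *-nonneg (mem-nonneg C e) (*-nonneg (κ-nonneg e) (Θ-nonneg C e))

-- The kernel on a clique

Θ-∷ʳ : ∀ C x e → Θ (C ++ [ x ]) e ≡ θ e x * Θ C e
Θ-∷ʳ C x e = Θ-↭ (∷↭∷ʳ x C) e
  where
  ∷↭∷ʳ : ∀ x (C : List ℕ) → C ++ [ x ] ↭ x ∷ C
  ∷↭∷ʳ x C = ↭-sym (Perm.∷↭∷ʳ x C)

firstColumns : ℕ → List ℕ
firstColumns zero = []
firstColumns (suc i) = firstColumns i ++ [ i ]

∈-firstColumns⁺ : ∀ {e i} → e ℕ.< i → e ∈ firstColumns i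
∈-firstColumns⁺ {e} {suc i} (ℕ.s≤s e≤i) with ℕ.m≤n⇒m<n∨m≡n e≤i
... | inj₁ e<i = ∈-++⁺ˡ (∈-firstColumns⁺ e<i)
... | inj₂ refl = ∈-++⁺ʳ (firstColumns i) (here refl)

∈-firstColumns⁻ : ∀ {e} i → e ∈ firstColumns i → e ℕ.< i
∈-firstColumns⁻ (suc i) e∈ with ∈-++⁻ (firstColumns i) e∈
... | inj₁ e∈′ = ℕ.m<n⇒m<1+n (∈-firstColumns⁻ i e∈′)
... | inj₂ (here refl) = ℕ.n<1+n i

mem-∈ : ∀ {C s} → s ∈ C → mem C (suc s) ≡ 1ℚ
mem-∈ {x ∷ C} (here refl) = mem-here x C
mem-∈ {x ∷ C} {s} (there s∈) with s ℕ.≟ x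
... | yes refl = mem-here x C
... | no s≢ = trans (mem-there C (s≢ ∘ ℕ.suc-injective)) (mem-∈ s∈)

-- The product of (i - s)/(i - s - 1) over s < j telescopes to i/(i - j).
Θ-firstColumns : ∀ i j → j ℕ.< i → (ι i - ι j) * Θ (firstColumns j) i ≡ ι i
Θ-firstColumns i zero _ = lemma (ι i)
  where
  lemma : ∀ x → (x - 0ℚ) * 1ℚ ≡ x
  lemma = solve-∀ ℚ-ring
Θ-firstColumns i (suc j) j<i = begin
  (ι i - ι (suc j)) * Θ (firstColumns j ++ [ j ]) i
    ≡⟨ cong ((ι i - ι (suc j)) *_) (trans (Θ-∷ʳ (firstColumns j) j i) (cong (_* Θ (firstColumns j) i) (θ-off i≢))) ⟩
  (ι i - ι (suc j)) * ((1ℚ + pole-inv i j) * Θ (firstColumns j) i)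
    ≡⟨ expand (ι i) (ι j) (pole-inv i j) (Θ (firstColumns j) i) ⟩
  ((ι i - ι (suc j)) + (ι i - ι (suc j)) * pole-inv i j) * Θ (firstColumns j) i
    ≡⟨ cong (λ x → ((ι i - ι (suc j)) + x) * Θ (firstColumns j) i) (pole-inv-inverse i≢) ⟩
  ((ι i - ι (suc j)) + 1ℚ) * Θ (firstColumns j) i
    ≡⟨ cong (_* Θ (firstColumns j) i) (collapse (ι i) (ι j)) ⟩
  (ι i - ι j) * Θ (firstColumns j) i
    ≡⟨ Θ-firstColumns i j (ℕ.<-trans (ℕ.n<1+n j) j<i) ⟩
  ι i ∎
  where
  i≢ : i ≢ suc j
  i≢ = ℕ.<⇒≢ j<i ∘ sym
  expand : ∀ i j x t → (i - (1ℚ + j)) * ((1ℚ + x) * t) ≡ ((i - (1ℚ + j)) + (i - (1ℚ + j)) * x) * t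
  expand = solve-∀ ℚ-ring
  collapse : ∀ i j → (i - (1ℚ + j)) + 1ℚ ≡ i - j
  collapse = solve-∀ ℚ-ring

μ-firstColumns : ∀ i → μ (firstColumns i) i ≡ 1ℚ
μ-firstColumns zero = cong (_* (1ℚ * 1ℚ)) (mem-zero [])
μ-firstColumns (suc j) = begin
  mem C (suc j) * (κ (suc j) * Θ C (suc j))
    ≡⟨ cong₂ (λ m t → m * (κ (suc j) * t)) (mem-∈ (∈-firstColumns⁺ (ℕ.n<1+n j))) Θ≡ ⟩
  1ℚ * (inv (ι (suc j)) * ι (suc j))
    ≡⟨ ℚ.*-identityˡ (inv (ι (suc j)) * ι (suc j)) ⟩
  inv (ι (suc j)) * ι (suc j)
    ≡⟨ ℚ.*-comm (inv (ι (suc j))) (ι (suc j)) ⟩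
  ι (suc j) * inv (ι (suc j))
    ≡⟨ inv-inverseʳ (ι-suc≢0 j) ⟩
  1ℚ ∎
  where
  C = firstColumns (suc j)
  simplify : ∀ t j → 1ℚ * t ≡ ((1ℚ + j) - j) * t
  simplify = solve-∀ ℚ-ring
  -- The factor at s = j is at its pole and counts 1; the others telescope to j + 1, which `κ` then
  -- cancels.
  Θ≡ : Θ C (suc j) ≡ ι (suc j)
  Θ≡ = trans (Θ-∷ʳ (firstColumns j) j (suc j))
    (trans (cong (_* Θ (firstColumns j) (suc j)) (θ-pole j))
      (trans (simplify (Θ (firstColumns j) (suc j)) (ι j)) (Θ-firstColumns (suc j) j (ℕ.n<1+n j))))

μ-firstColumns-≢ : ∀ i e → e ≢ i → μ (firstColumns i) e ≡ 0ℚ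
μ-firstColumns-≢ i e e≢i with ℕ.<-cmp e i
... | tri≈ _ e≡i _ = ⊥-elim (e≢i e≡i)
... | tri< e<i _ _ with μ-fresh (firstColumns i) e
...   | inj₁ eq = eq
...   | inj₂ e∉ = ⊥-elim (e∉ (∈-firstColumns⁺ e<i))
μ-firstColumns-≢ i (suc e) e≢i | tri> _ _ (ℕ.s≤s i≤e) =
  zero-*ˡ (κ (suc e) * Θ (firstColumns i) (suc e)) (mem-∉ (λ e∈ → ℕ.<⇒≱ (∈-firstColumns⁻ i e∈) i≤e))

-- Modular relations determine a functional on Dyck words

data Step : Set where
  u d : Step

Word : Set
Word = List Step

u^_ d^_ : ℕ → Word
u^ n = replicate n u
d^ n = replicate n d

uu dd udu duu uud dud ddu udd : Word
uu = u ∷ u ∷ []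
dd = d ∷ d ∷ []
udu = u ∷ d ∷ u ∷ []
duu = d ∷ u ∷ u ∷ []
uud = u ∷ u ∷ d ∷ []
dud = d ∷ u ∷ d ∷ []
ddu = d ∷ d ∷ u ∷ []
udd = u ∷ d ∷ d ∷ []

isU isD : Step → ℕ
isU u = 1
isU d = 0
isD u = 0
isD d = 1

#u #d : Word → ℕ
#u [] = 0
#u (a ∷ w) = isU a ℕ.+ #u w
#d [] = 0
#d (a ∷ w) = isD a ℕ.+ #d w

#u-++ : ∀ x y → #u (x ++ y) ≡ #u x ℕ.+ #u y
#u-++ [] y = refl
#u-++ (a ∷ x) y = trans (cong (isU a ℕ.+_) (#u-++ x y)) (sym (ℕ.+-assoc (isU a) (#u x) (#u y)))

#d-++ : ∀ x y → #d (x ++ y) ≡ #d x ℕ.+ #d y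
#d-++ [] y = refl
#d-++ (a ∷ x) y = trans (cong (isD a ℕ.+_) (#d-++ x y)) (sym (ℕ.+-assoc (isD a) (#d x) (#d y)))

#u-u^ : ∀ n → #u (u^ n) ≡ n
#u-u^ zero = refl
#u-u^ (suc n) = cong suc (#u-u^ n)

#d-u^ : ∀ n → #d (u^ n) ≡ 0
#d-u^ zero = refl
#d-u^ (suc n) = #d-u^ n

#u-d^ : ∀ n → #u (d^ n) ≡ 0
#u-d^ zero = refl
#u-d^ (suc n) = #u-d^ n

#d-d^ : ∀ n → #d (d^ n) ≡ n
#d-d^ zero = refl
#d-d^ (suc n) = cong suc (#d-d^ n)

replicate-+ : ∀ {A : Set} (x : A) m n → replicate (m ℕ.+ n) x ≡ replicate m x ++ replicate n x
replicate-+ x zero n = refl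
replicate-+ x (suc m) n = cong (x ∷_) (replicate-+ x m n)

-- Functionals on words with c letters u and s letters d for which the commutator ud - du is
-- central, as in the enveloping algebra of the Heisenberg Lie algebra.
Central : ℕ → ℕ → (Word → ℚ) → Set
Central c s f = ∀ x l y → #u (x ++ l ∷ u ∷ d ∷ y) ≡ c → #d (x ++ l ∷ u ∷ d ∷ y) ≡ s →
  f (x ++ l ∷ u ∷ d ∷ y) - f (x ++ l ∷ d ∷ u ∷ y) ≡ f (x ++ u ∷ d ∷ l ∷ y) - f (x ++ d ∷ u ∷ l ∷ y)

commutator : (Word → ℚ) → Word → ℚ
commutator f v = f (u ∷ d ∷ v) - f (d ∷ u ∷ v)

Central-∷ : ∀ a {c s f} → Central (isU a ℕ.+ c) (isD a ℕ.+ s) f → Central c s (f ∘ (a ∷_))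
Central-∷ a h x l y hu hd = h (a ∷ x) l y (cong (isU a ℕ.+_) hu) (cong (isD a ℕ.+_) hd)

Central-commutator : ∀ {c s f} → Central (suc c) (suc s) f → Central c s (commutator f)
Central-commutator {f = f} h x l y hu hd = begin
  (f (u ∷ d ∷ x ++ l ∷ u ∷ d ∷ y) - f (d ∷ u ∷ x ++ l ∷ u ∷ d ∷ y))
    - (f (u ∷ d ∷ x ++ l ∷ d ∷ u ∷ y) - f (d ∷ u ∷ x ++ l ∷ d ∷ u ∷ y))
    ≡⟨ exchange (f (u ∷ d ∷ x ++ l ∷ u ∷ d ∷ y)) (f (d ∷ u ∷ x ++ l ∷ u ∷ d ∷ y))
                (f (u ∷ d ∷ x ++ l ∷ d ∷ u ∷ y)) (f (d ∷ u ∷ x ++ l ∷ d ∷ u ∷ y)) ⟩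
  (f (u ∷ d ∷ x ++ l ∷ u ∷ d ∷ y) - f (u ∷ d ∷ x ++ l ∷ d ∷ u ∷ y))
    - (f (d ∷ u ∷ x ++ l ∷ u ∷ d ∷ y) - f (d ∷ u ∷ x ++ l ∷ d ∷ u ∷ y))
    ≡⟨ cong₂ _-_ (h (u ∷ d ∷ x) l y (cong suc hu) (cong suc hd)) (h (d ∷ u ∷ x) l y (cong suc hu) (cong suc hd)) ⟩
  (f (u ∷ d ∷ x ++ u ∷ d ∷ l ∷ y) - f (u ∷ d ∷ x ++ d ∷ u ∷ l ∷ y))
    - (f (d ∷ u ∷ x ++ u ∷ d ∷ l ∷ y) - f (d ∷ u ∷ x ++ d ∷ u ∷ l ∷ y))
    ≡⟨ exchange (f (u ∷ d ∷ x ++ u ∷ d ∷ l ∷ y)) (f (u ∷ d ∷ x ++ d ∷ u ∷ l ∷ y))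
                (f (d ∷ u ∷ x ++ u ∷ d ∷ l ∷ y)) (f (d ∷ u ∷ x ++ d ∷ u ∷ l ∷ y)) ⟩
  (f (u ∷ d ∷ x ++ u ∷ d ∷ l ∷ y) - f (d ∷ u ∷ x ++ u ∷ d ∷ l ∷ y))
    - (f (u ∷ d ∷ x ++ d ∷ u ∷ l ∷ y) - f (d ∷ u ∷ x ++ d ∷ u ∷ l ∷ y)) ∎
  where
  exchange : ∀ p q r s → (p - q) - (r - s) ≡ (p - r) - (q - s)
  exchange = solve-∀ ℚ-ring

-- Centrality carries the commutator to the front, past one letter of x at a time.
slide : ∀ {c s} f x y → Central c s f → #u (x ++ u ∷ d ∷ y) ≡ c → #d (x ++ u ∷ d ∷ y) ≡ s →
  f (x ++ u ∷ d ∷ y) - f (x ++ d ∷ u ∷ y) ≡ commutator f (x ++ y)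
slide f [] y h hu hd = refl
slide f (a ∷ x) y h refl refl =
  trans (slide (f ∘ (a ∷_)) x y (Central-∷ a {f = f} h) refl refl)
    (h [] a (x ++ y) (cong (isU a ℕ.+_) (move-u x)) (cong (isD a ℕ.+_) (move-d x)))
  where
  move-u : ∀ x → suc (#u (x ++ y)) ≡ #u (x ++ u ∷ d ∷ y)
  move-u x = trans (cong suc (#u-++ x y)) (trans (sym (ℕ.+-suc (#u x) (#u y))) (sym (#u-++ x (u ∷ d ∷ y))))
  move-d : ∀ x → suc (#d (x ++ y)) ≡ #d (x ++ u ∷ d ∷ y)
  move-d x = trans (cong suc (#d-++ x y)) (trans (sym (ℕ.+-suc (#d x) (#d y))) (sym (#d-++ x (u ∷ d ∷ y))))

-- The Heisenberg relation [u, d^(k+1)] = (k+1) [u, d] d^k: one central commutator for each letter d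
-- that is passed.
move-u-past-d^ : ∀ {c s} f k y → Central c s f → #u (u ∷ d^ (suc k) ++ y) ≡ c → #d (u ∷ d^ (suc k) ++ y) ≡ s →
  f (u ∷ d^ (suc k) ++ y) - f (d^ (suc k) ++ u ∷ y) ≡ ι (suc k) * commutator f (d^ k ++ y)
move-u-past-d^ f zero y h hu hd = one (f (u ∷ d ∷ y) - f (d ∷ u ∷ y))
  where
  one : ∀ x → x ≡ (1ℚ + 0ℚ) * x
  one = solve-∀ ℚ-ring
move-u-past-d^ f (suc k) y h refl refl = begin
  f (u ∷ d ∷ w) - f (d ∷ w′)
    ≡⟨ telescope (f (u ∷ d ∷ w)) (f (d ∷ u ∷ w)) (f (d ∷ w′)) ⟩
  (f (u ∷ d ∷ w) - f (d ∷ u ∷ w)) + (f (d ∷ u ∷ w) - f (d ∷ w′))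
    ≡⟨ cong ((f (u ∷ d ∷ w) - f (d ∷ u ∷ w)) +_)
         (move-u-past-d^ (f ∘ (d ∷_)) k y (Central-∷ d {f = f} h) refl refl) ⟩
  commutator f w + ι (suc k) * commutator (f ∘ (d ∷_)) (d^ k ++ y)
    ≡⟨ cong (λ x → commutator f w + ι (suc k) * x) (h [] d (d^ k ++ y) refl refl) ⟩
  commutator f w + ι (suc k) * commutator f w
    ≡⟨ collect (commutator f w) (ι (suc k)) ⟩
  ι (suc (suc k)) * commutator f w ∎
  where
  w = d ∷ d^ k ++ y
  w′ = d^ (suc k) ++ u ∷ y
  telescope : ∀ p q r → p - r ≡ (p - q) + (q - r)
  telescope = solve-∀ ℚ-ring
  collect : ∀ x k → x + k * x ≡ (1ℚ + k) * x
  collect = solve-∀ ℚ-ring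

Symmetric : ℕ → ℕ → (Word → ℚ) → Set
Symmetric c s f = ∀ x y → #u (x ++ u ∷ d ∷ y) ≡ c → #d (x ++ u ∷ d ∷ y) ≡ s →
  f (x ++ u ∷ d ∷ y) ≡ f (x ++ d ∷ u ∷ y)

Symmetric-∷ : ∀ a {c s f} → Symmetric (isU a ℕ.+ c) (isD a ℕ.+ s) f → Symmetric c s (f ∘ (a ∷_))
Symmetric-∷ a h x y hu hd = h (a ∷ x) y (cong (isU a ℕ.+_) hu) (cong (isD a ℕ.+_) hd)

move-d-past-u^ : ∀ {c s} f k y → Symmetric c s f → #u (u^ k ++ y) ≡ c → suc (#d (u^ k ++ y)) ≡ s →
  f (d ∷ u^ k ++ y) ≡ f (u^ k ++ d ∷ y)
move-d-past-u^ f zero y h _ _ = refl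
move-d-past-u^ f (suc k) y h refl refl =
  trans (sym (h [] (u^ k ++ y) refl refl)) (move-d-past-u^ (f ∘ (u ∷_)) k y (Symmetric-∷ u {f = f} h) refl refl)

u^d^ : ℕ → ℕ → Word
u^d^ c s = u^ c ++ d^ s

#u-u^d^ : ∀ c s → #u (u^d^ c s) ≡ c
#u-u^d^ c s = trans (#u-++ (u^ c) (d^ s)) (trans (cong₂ ℕ._+_ (#u-u^ c) (#u-d^ s)) (ℕ.+-identityʳ c))

#d-u^d^ : ∀ c s → #d (u^d^ c s) ≡ s
#d-u^d^ c s = trans (#d-++ (u^ c) (d^ s)) (cong₂ ℕ._+_ (#d-u^ c) (#d-d^ s))

sorted-value : ∀ {c s} f t → Symmetric c s f → #u t ≡ c → #d t ≡ s → f t ≡ f (u^d^ c s)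
sorted-value f [] h refl refl = refl
sorted-value f (u ∷ t) h refl refl = sorted-value (f ∘ (u ∷_)) t (Symmetric-∷ u {f = f} h) refl refl
sorted-value f (d ∷ t) h refl refl =
  trans (sorted-value (f ∘ (d ∷_)) t (Symmetric-∷ d {f = f} h) refl refl)
    (move-d-past-u^ f (#u t) (d^ (#d t)) h (#u-u^d^ (#u t) (#d t)) (cong suc (#d-u^d^ (#u t) (#d t))))

no-u : ∀ t → #u t ≡ 0 → t ≡ d^ (#d t)
no-u [] _ = refl
no-u (d ∷ t) h = cong (d ∷_) (no-u t h)

no-d : ∀ t → #d t ≡ 0 → t ≡ u^ (#u t)
no-d [] _ = refl
no-d (u ∷ t) h = cong (u ∷_) (no-d t h)

Central-u^ : ∀ i {c s} f → Central (i ℕ.+ c) s f → Central c s (f ∘ (u^ i ++_))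
Central-u^ zero f h = h
Central-u^ (suc i) f h = Central-u^ i (f ∘ (u ∷_)) (Central-∷ u {f = f} h)

-- By induction on c, s: the endpoint values determine the commutator functional, and if that
-- vanishes then f does not depend on the order of the letters.
endpoints-determine : ∀ c s f → Central c s f →
  (∀ i j → i ℕ.+ j ≡ c → f (u^ i ++ d^ s ++ u^ j) ≡ 0ℚ) →
  ∀ t → #u t ≡ c → #d t ≡ s → f t ≡ 0ℚ
endpoints-determine zero s f h ends t hu refl =
  trans (cong f (trans (no-u t hu) (sym (++-identityʳ (d^ s))))) (ends 0 0 refl)
endpoints-determine (suc c) zero f h ends t hu hd =
  trans (cong f (trans (no-d t hd) (cong u^_ hu))) (ends 0 (suc c) refl)
endpoints-determine (suc c) (suc s) f h ends t hu hd =
  trans (sorted-value f t symmetric hu hd)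
    (trans (cong (λ w → f (u^ (suc c) ++ w)) (sym (++-identityʳ (d^ (suc s))))) (ends (suc c) 0 (ℕ.+-identityʳ (suc c))))
  where
  f′ = commutator f
  ends′ : ∀ i j → i ℕ.+ j ≡ c → f′ (u^ i ++ d^ s ++ u^ j) ≡ 0ℚ
  -- Two neighbouring endpoint words of f differ by s + 1 times an endpoint value of the commutator
  -- functional, which therefore vanishes too.
  ends′ i j i+j≡c = *-cancel-0 (ι-suc≢0 s) (begin
    ι (suc s) * f′ (u^ i ++ y)
      ≡⟨ cong (ι (suc s) *_) (sym (slide f (u^ i) y h counts-u counts-d)) ⟩
    ι (suc s) * (g (u ∷ d ∷ y) - g (d ∷ u ∷ y))
      ≡⟨ sym (move-u-past-d^ g s (u^ j) (Central-u^ i f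
          (subst (λ c → Central c (suc s) f) (sym (trans (ℕ.+-suc i j) (cong suc i+j≡c))) h))
               counts-u′ counts-d′) ⟩
    f (u^ i ++ u ∷ d^ (suc s) ++ u^ j) - f (u^ i ++ d^ (suc s) ++ u ∷ u^ j)
      ≡⟨ cong₂ _-_ (trans (cong f (snoc i (d^ (suc s) ++ u^ j))) (ends (suc i) j (cong suc i+j≡c)))
                   (ends i (suc j) (trans (ℕ.+-suc i j) (cong suc i+j≡c))) ⟩
    0ℚ - 0ℚ ≡⟨⟩
    0ℚ ∎)
    where
    y = d^ s ++ u^ j
    g = f ∘ (u^ i ++_)
    snoc : ∀ i w → u^ i ++ u ∷ w ≡ u^ (suc i) ++ w
    snoc zero w = refl
    snoc (suc i) w = cong (u ∷_) (snoc i w)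
    uy : #u y ≡ j
    uy = trans (#u-++ (d^ s) (u^ j)) (cong₂ ℕ._+_ (#u-d^ s) (#u-u^ j))
    dy : #d y ≡ s
    dy = trans (#d-++ (d^ s) (u^ j)) (trans (cong₂ ℕ._+_ (#d-d^ s) (#d-u^ j)) (ℕ.+-identityʳ s))
    counts-u : #u (u^ i ++ u ∷ d ∷ y) ≡ suc c
    counts-u = trans (#u-++ (u^ i) (u ∷ d ∷ y))
      (trans (cong₂ ℕ._+_ (#u-u^ i) (cong suc uy)) (trans (ℕ.+-suc i j) (cong suc i+j≡c)))
    counts-d : #d (u^ i ++ u ∷ d ∷ y) ≡ suc s
    counts-d = trans (#d-++ (u^ i) (u ∷ d ∷ y)) (cong₂ ℕ._+_ (#d-u^ i) (cong suc dy))
    counts-u′ : #u (u ∷ d^ (suc s) ++ u^ j) ≡ suc j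
    counts-u′ = cong suc uy
    counts-d′ : #d (u ∷ d^ (suc s) ++ u^ j) ≡ suc s
    counts-d′ = cong suc dy
  symmetric : Symmetric (suc c) (suc s) f
  symmetric x y hu hd = difference-0 (trans (slide f x y h hu hd)
    (endpoints-determine c s f′ (Central-commutator {f = f} h) ends′ (x ++ y)
      (ℕ.suc-injective (trans (sym (trans (#u-++ x (u ∷ d ∷ y))
          (trans (ℕ.+-suc (#u x) (#u y)) (cong suc (sym (#u-++ x y)))))) hu))
      (ℕ.suc-injective (trans (sym (trans (#d-++ x (u ∷ d ∷ y))
          (trans (ℕ.+-suc (#d x) (#d y)) (cong suc (sym (#d-++ x y)))))) hd))))

-- The arrivals number j and j + 1, counted from 0, are consecutive letters. As the oldest vertex
-- leaves first, arrival number `#d p` heads the queue after p.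
TwinAt : Word → ℕ → Set
TwinAt p j = ∃₂ λ A B → p ≡ A ++ uu ++ B × #u A ≡ j

-- The side conditions express that two vertices are twins. In `law₁` the queue after A has `#d B` +
-- 1 members, so dd removes exactly the two vertices added by the middle letters. In `law₂` the two
-- oldest members of the queue after A arrived consecutively.
record Modular (D : Word → ℚ) : Set where
  field
    law₁ : ∀ A B C → #u A ≡ #d A ℕ.+ suc (#d B) →
      D (A ++ udu ++ B ++ dd ++ C) + D (A ++ udu ++ B ++ dd ++ C)
        ≡ D (A ++ duu ++ B ++ dd ++ C) + D (A ++ uud ++ B ++ dd ++ C)
    law₂ : ∀ A C → TwinAt A (#d A) →
      D (A ++ dud ++ C) + D (A ++ dud ++ C)
        ≡ D (A ++ ddu ++ C) + D (A ++ udd ++ C)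

TwinAt-++ : ∀ {p j} x → TwinAt p j → TwinAt (p ++ x) j
TwinAt-++ x (A , B , refl , eq) = A , B ++ x , ++-assoc A (uu ++ B) x , eq

data Dyck : ℕ → Word → Set where
  stop : Dyck 0 []
  up   : ∀ {h w} → Dyck (suc h) w → Dyck h (u ∷ w)
  down : ∀ {h w} → Dyck h w → Dyck (suc h) (d ∷ w)

Dyck-u^ : ∀ n {h w} → Dyck (n ℕ.+ h) w → Dyck h (u^ n ++ w)
Dyck-u^ zero D = D
Dyck-u^ (suc n) {h} {w} D = up (Dyck-u^ n (subst (λ h → Dyck h w) (sym (ℕ.+-suc n h)) D))

Dyck-d^ : ∀ n {h w} → Dyck h w → Dyck (n ℕ.+ h) (d^ n ++ w)
Dyck-d^ zero D = D
Dyck-d^ (suc n) D = down (Dyck-d^ n D)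

next-down : ∀ {h w} → Dyck (suc h) w → ∃₂ λ e w′ → w ≡ u^ e ++ d ∷ w′ × Dyck (e ℕ.+ h) w′
next-down (down D) = 0 , _ , refl , D
next-down (up D) with next-down D
... | e , w′ , refl , D′ = suc e , w′ , refl , subst (λ h → Dyck h w′) (ℕ.+-suc e _) D′

-- Twin Q k : positions k and k + 1 of a queue lie in a common block, the block sizes being Q.
data Twin : List ℕ → ℕ → Set where
  here  : ∀ {c Q k} → 2 ℕ.+ k ℕ.≤ c → Twin (c ∷ Q) k
  there : ∀ {c Q k} → Twin Q k → Twin (c ∷ Q) (c ℕ.+ k)

Twin-++ : ∀ {Q k} R → Twin Q k → Twin (Q ++ R) k
Twin-++ R (here le) = here le
Twin-++ R (there t) = there (Twin-++ R t)

Twin-suffix : ∀ Q {R k} → Twin R k → Twin (Q ++ R) (sum Q ℕ.+ k)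
Twin-suffix [] t = t
Twin-suffix (c ∷ Q) {R} {k} t = subst (Twin (c ∷ Q ++ R)) (sym (ℕ.+-assoc c (sum Q) k)) (there (Twin-suffix Q t))

Twin-∷ʳ⁻ : ∀ Q {a k} → Twin (Q ++ [ a ]) k → Twin Q k ⊎ ∃ λ k′ → k ≡ sum Q ℕ.+ k′ × 2 ℕ.+ k′ ℕ.≤ a
Twin-∷ʳ⁻ [] (here le) = inj₂ (_ , refl , le)
Twin-∷ʳ⁻ (c ∷ Q) (here le) = inj₁ (here le)
Twin-∷ʳ⁻ (c ∷ Q) (there t) with Twin-∷ʳ⁻ Q t
... | inj₁ t′ = inj₁ (there t′)
... | inj₂ (k′ , refl , le) = inj₂ (k′ , sym (ℕ.+-assoc c (sum Q) k′) , le)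

-- The words that empty a queue with block sizes Q by removing whole blocks only, each block
-- pushed on the way being removed as a whole too; they are unconstrained after that.
data Unsplit : List ℕ → Word → Set where
  done : ∀ {v} → Unsplit [] v
  skip : ∀ {Q v} → Unsplit Q v → Unsplit (0 ∷ Q) v
  pop  : ∀ {c Q v} a → Unsplit (Q ++ [ a ]) v → Unsplit (suc c ∷ Q) (u^ a ++ d^ (suc c) ++ v)

-- A whole block leaves in one run of letters d, so its neighbouring members leave by consecutive
-- letters. This provides the dd that `law₁` asks for.
unsplit-twins : ∀ {Q v k} → Unsplit Q v → Twin Q k → ∃₂ λ B C → v ≡ B ++ dd ++ C × #d B ≡ k
unsplit-twins (skip U) (here ())
unsplit-twins (skip U) (there t) = unsplit-twins U t
unsplit-twins {k = k} (pop {c} {v = v} a U) (here le) with ℕ.m≤n⇒∃[o]m+o≡n le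
... | r , refl = u^ a ++ d^ k , d^ r ++ v ,
  trans (cong (u^ a ++_) (trans (cong (_++ v) split) (++-assoc (d^ k) (d ∷ d ∷ d^ r) v)))
    (sym (++-assoc (u^ a) (d^ k) (d ∷ d ∷ d^ r ++ v))) ,
  trans (#d-++ (u^ a) (d^ k)) (cong₂ ℕ._+_ (#d-u^ a) (#d-d^ k))
  where
  split : d^ (2 ℕ.+ k ℕ.+ r) ≡ d^ k ++ d ∷ d ∷ d^ r
  split = trans (cong d^_ (trans (cong suc (sym (ℕ.+-suc k r))) (sym (ℕ.+-suc k (suc r))))) (replicate-+ d k (2 ℕ.+ r))
unsplit-twins (pop {c} a U) (there t) with unsplit-twins U (Twin-++ [ a ] t)
... | B , C , refl , eq = u^ a ++ d^ (suc c) ++ B , C ,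
  sym (trans (++-assoc (u^ a) (d^ (suc c) ++ B) (dd ++ C)) (cong (u^ a ++_) (++-assoc (d^ (suc c)) B (dd ++ C)))) ,
  trans (#d-++ (u^ a) (d^ (suc c) ++ B)) (cong₂ ℕ._+_ (#d-u^ a)
    (trans (#d-++ (d^ (suc c)) B) (cong₂ ℕ._+_ (#d-d^ (suc c)) eq)))

-- After the prefix p the queue consists of blocks of sizes Q, each pushed by consecutive letters.
record Blocks (p : Word) (Q : List ℕ) : Set where
  constructor blocks
  field
    count : #u p ≡ #d p ℕ.+ sum Q
    twins : ∀ k → Twin Q k → TwinAt p (#d p ℕ.+ k)

#u-push : ∀ p a → #u (p ++ u^ a) ≡ #u p ℕ.+ a
#u-push p a = trans (#u-++ p (u^ a)) (cong (#u p ℕ.+_) (#u-u^ a))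

#d-push : ∀ p a → #d (p ++ u^ a) ≡ #d p
#d-push p a = trans (#d-++ p (u^ a)) (trans (cong (#d p ℕ.+_) (#d-u^ a)) (ℕ.+-identityʳ (#d p)))

Blocks-push : ∀ {p Q} a → Blocks p Q → Blocks (p ++ u^ a) (Q ++ [ a ])
Blocks-push {p} {Q} a (blocks sz tw) = blocks count′ twins′
  where
  count′ : #u (p ++ u^ a) ≡ #d (p ++ u^ a) ℕ.+ sum (Q ++ [ a ])
  count′ = begin
    #u (p ++ u^ a)             ≡⟨ #u-push p a ⟩
    #u p ℕ.+ a                 ≡⟨ cong (ℕ._+ a) sz ⟩
    #d p ℕ.+ sum Q ℕ.+ a       ≡⟨ ℕ.+-assoc (#d p) (sum Q) a ⟩
    #d p ℕ.+ (sum Q ℕ.+ a)     ≡⟨ cong₂ ℕ._+_ (sym (#d-push p a))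
                                    (sym (trans (sum-++ Q [ a ]) (cong (sum Q ℕ.+_) (ℕ.+-identityʳ a)))) ⟩
    #d (p ++ u^ a) ℕ.+ sum (Q ++ [ a ]) ∎
  twins′ : ∀ k → Twin (Q ++ [ a ]) k → TwinAt (p ++ u^ a) (#d (p ++ u^ a) ℕ.+ k)
  twins′ k t with Twin-∷ʳ⁻ Q t
  ... | inj₁ t′ = subst (λ x → TwinAt (p ++ u^ a) (x ℕ.+ k)) (sym (#d-push p a)) (TwinAt-++ (u^ a) (tw k t′))
  ... | inj₂ (k′ , refl , le) with ℕ.m≤n⇒∃[o]m+o≡n le
  ...   | r , refl = p ++ u^ k′ , u^ r ,
    trans (cong (p ++_) (trans (cong u^_ (trans (cong suc (sym (ℕ.+-suc k′ r)))
        (sym (ℕ.+-suc k′ (suc r))))) (replicate-+ u k′ (2 ℕ.+ r))))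
      (sym (++-assoc p (u^ k′) (u ∷ u ∷ u^ r))) ,
    trans (#u-push p k′) (trans (cong (ℕ._+ k′) sz) (trans (ℕ.+-assoc (#d p) (sum Q) k′)
      (cong (ℕ._+ (sum Q ℕ.+ k′)) (sym (#d-push p a)))))

Blocks-pop : ∀ {p c Q} → Blocks p (suc c ∷ Q) → Blocks (p ++ [ d ]) (c ∷ Q)
Blocks-pop {p} {c} {Q} (blocks sz tw) = blocks
  (trans (#u-++ p [ d ]) (trans (ℕ.+-identityʳ (#u p))
      (trans sz (trans (ℕ.+-suc (#d p) (c ℕ.+ sum Q)) (cong (ℕ._+ (c ℕ.+ sum Q)) (sym #d-p′))))))
  (λ k t → subst (TwinAt (p ++ [ d ])) (trans (ℕ.+-suc (#d p) k) (cong (ℕ._+ k) (sym #d-p′)))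
      (TwinAt-++ [ d ] (tw (suc k) (shift t))))
  where
  #d-p′ : #d (p ++ [ d ]) ≡ suc (#d p)
  #d-p′ = trans (#d-++ p [ d ]) (ℕ.+-comm (#d p) 1)
  shift : ∀ {k} → Twin (c ∷ Q) k → Twin (suc c ∷ Q) (suc k)
  shift (here le) = here (ℕ.s≤s le)
  shift (there t) = there t

Blocks-pops : ∀ b {p c Q} → Blocks p (b ℕ.+ c ∷ Q) → Blocks (p ++ d^ b) (c ∷ Q)
Blocks-pops zero {p} {c} {Q} bl = subst (λ p → Blocks p (c ∷ Q)) (sym (++-identityʳ p)) bl
Blocks-pops (suc b) {p} {c} {Q} bl = subst (λ p → Blocks p (c ∷ Q)) (++-assoc p [ d ] (d^ b)) (Blocks-pops b (Blocks-pop bl))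

Blocks-skip : ∀ {p Q} → Blocks p (0 ∷ Q) → Blocks p Q
Blocks-skip (blocks sz tw) = blocks sz (λ k t → tw k (there t))

-- Reduction of Dyck words to unions of cliques

module Reduction {D : Word → ℚ} (modular : Modular D) where
  open Modular modular

  rebracket : ∀ (p x w y v : Word) → p ++ (x ++ w ++ y) ++ v ≡ (p ++ x) ++ w ++ (y ++ v)
  rebracket p x w y v = begin
    p ++ (x ++ w ++ y) ++ v   ≡⟨ cong (p ++_) (++-assoc x (w ++ y) v) ⟩
    p ++ x ++ (w ++ y) ++ v   ≡⟨ cong (λ z → p ++ x ++ z) (++-assoc w y v) ⟩
    p ++ x ++ w ++ y ++ v     ≡⟨ sym (++-assoc p x (w ++ y ++ v)) ⟩
    (p ++ x) ++ w ++ y ++ v   ∎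

  balance : ∀ x y z → x + x ≡ y + z → x - y ≡ z - x
  balance x y z eq = trans (split x y) (trans (cong (λ t → t - y - x) eq) (merge x y z))
    where
    split : ∀ x y → x - y ≡ x + x - y - x
    split = solve-∀ ℚ-ring
    merge : ∀ x y z → y + z - y - x ≡ z - x
    merge = solve-∀ ℚ-ring

  -- Every arrangement t of the e arrivals and b + 1 departures keeps both twin conditions: the
  -- departing vertices lie in the first block, hence arrived together, and the arrivals form a
  -- block that the unsplit v removes together. So D (p ++ t ++ v) is central as a functional of t,
  -- and its endpoint values decide.
  rectangle : ∀ {p m Q} b e v → Blocks p (b ℕ.+ suc m ∷ Q) → Unsplit (m ∷ Q ++ [ e ]) v →
    (∀ i j → i ℕ.+ j ≡ e → D (p ++ (u^ i ++ d^ (suc b) ++ u^ j) ++ v) ≡ 0ℚ) →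
    D (p ++ (d^ b ++ u^ e ++ [ d ]) ++ v) ≡ 0ℚ
  rectangle {p} {m} {Q} b e v bl U ends =
    endpoints-determine e (suc b) f central ends (d^ b ++ u^ e ++ [ d ])
      (trans (#u-++ (d^ b) (u^ e ++ [ d ])) (trans (cong₂ ℕ._+_ (#u-d^ b)
          (trans (#u-++ (u^ e) [ d ]) (cong (ℕ._+ 0) (#u-u^ e)))) (ℕ.+-identityʳ e)))
      (trans (#d-++ (d^ b) (u^ e ++ [ d ])) (trans (cong₂ ℕ._+_ (#d-d^ b)
          (trans (#d-++ (u^ e) [ d ]) (cong (ℕ._+ 1) (#d-u^ e)))) (ℕ.+-comm b 1)))
    where
    f : Word → ℚ
    f t = D (p ++ t ++ v)
    central : Central e (suc b) f
    central x u y hu hd with unsplit-twins U (subst (Twin (m ∷ Q ++ [ e ]))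
        (sym (ℕ.+-assoc m (sum Q) (#u x))) (there (Twin-suffix Q (here bound))))
      where
      bound : 2 ℕ.+ #u x ℕ.≤ e
      bound = ℕ.≤-trans (ℕ.≤-reflexive (ℕ.+-comm 2 (#u x)))
        (ℕ.≤-trans (ℕ.+-monoʳ-≤ (#u x) (ℕ.s≤s (ℕ.s≤s ℕ.z≤n)))
          (ℕ.≤-reflexive (trans (sym (#u-++ x (uud ++ y))) hu)))
    ... | B , C , refl , #dB = trans (cong₂ _-_ (at uud) (at udu))
        (trans (sym (balance (value udu) (value duu) (value uud) (law₁ (p ++ x) (y ++ B) C count)))
            (sym (cong₂ _-_ (at udu) (at duu))))
      where
      value : Word → ℚ
      value w = D ((p ++ x) ++ w ++ (y ++ B) ++ dd ++ C)
      at : ∀ w → f (x ++ w ++ y) ≡ value w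
      at w = cong D (trans (rebracket p x w y v) (cong (λ z → (p ++ x) ++ w ++ z) (sym (++-assoc y B (dd ++ C)))))
      dxy : suc (#d x ℕ.+ #d y) ≡ suc b
      dxy = trans (trans (sym (ℕ.+-suc (#d x) (#d y))) (sym (#d-++ x (uud ++ y)))) hd
      arith : ∀ P X Y M S U → P ℕ.+ (X ℕ.+ Y ℕ.+ suc M ℕ.+ S) ℕ.+ U ≡ P ℕ.+ X ℕ.+ suc (Y ℕ.+ (M ℕ.+ S ℕ.+ U))
      arith = NatSolver.solve-∀
      count : #u (p ++ x) ≡ #d (p ++ x) ℕ.+ suc (#d (y ++ B))
      count = begin
        #u (p ++ x)                                                         ≡⟨ #u-++ p x ⟩
        #u p ℕ.+ #u x                                                       ≡⟨ cong (ℕ._+ #u x) (Blocks.count bl) ⟩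
        #d p ℕ.+ (b ℕ.+ suc m ℕ.+ sum Q) ℕ.+ #u x                           ≡⟨ cong
            (λ b → #d p ℕ.+ (b ℕ.+ suc m ℕ.+ sum Q) ℕ.+ #u x) (sym (ℕ.suc-injective dxy)) ⟩
        #d p ℕ.+ (#d x ℕ.+ #d y ℕ.+ suc m ℕ.+ sum Q) ℕ.+ #u x               ≡⟨ arith (#d p) (#d x) (#d y) m (sum Q) (#u x) ⟩
        #d p ℕ.+ #d x ℕ.+ suc (#d y ℕ.+ (m ℕ.+ sum Q ℕ.+ #u x))             ≡⟨ cong₂
            (λ s t → s ℕ.+ suc (#d y ℕ.+ t)) (sym (#d-++ p x)) (sym #dB) ⟩
        #d (p ++ x) ℕ.+ suc (#d y ℕ.+ #d B)                                 ≡⟨ cong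
            (λ t → #d (p ++ x) ℕ.+ suc t) (sym (#d-++ y B)) ⟩
        #d (p ++ x) ℕ.+ suc (#d (y ++ B))                                   ∎
    central x d y hu hd = trans (cong₂ _-_ (at dud) (at ddu))
        (trans (balance (value dud) (value ddu) (value udd) (law₂ (p ++ x) (y ++ v) twin)) (sym (cong₂ _-_ (at udd) (at dud))))
      where
      value : Word → ℚ
      value w = D ((p ++ x) ++ w ++ (y ++ v))
      at : ∀ w → f (x ++ w ++ y) ≡ value w
      at w = cong D (rebracket p x w y v)
      bound : 2 ℕ.+ #d x ℕ.≤ b ℕ.+ suc m
      bound = ℕ.≤-trans (ℕ.≤-reflexive (ℕ.+-comm 2 (#d x)))
        (ℕ.≤-trans (ℕ.+-monoʳ-≤ (#d x) (ℕ.s≤s (ℕ.s≤s ℕ.z≤n)))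
          (ℕ.≤-trans (ℕ.≤-reflexive (trans (sym (#d-++ x (dud ++ y))) hd))
            (ℕ.≤-trans (ℕ.s≤s (ℕ.m≤m+n b m)) (ℕ.≤-reflexive (sym (ℕ.+-suc b m))))))
      twin : TwinAt (p ++ x) (#d (p ++ x))
      twin = subst (TwinAt (p ++ x)) (sym (#d-++ p x)) (TwinAt-++ x (Blocks.twins bl (#d x) (here bound)))

  -- The unsplit continuations have the length of the original one because the surrounding
  -- inductions measure lengths.
  ReducesToUnsplit : ℕ → Set
  ReducesToUnsplit n = ∀ p Q v → length v ℕ.≤ n → Blocks p Q → Dyck (sum Q) v →
    (∀ v′ → length v′ ≡ length v → Dyck (sum Q) v′ → Unsplit Q v′ → D (p ++ v′) ≡ 0ℚ) → D (p ++ v) ≡ 0ℚ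

  sum-∷ʳ : ∀ Q a → sum (Q ++ [ a ]) ≡ sum Q ℕ.+ a
  sum-∷ʳ Q a = trans (sum-++ Q [ a ]) (cong (sum Q ℕ.+_) (ℕ.+-identityʳ a))

  -- `rectangle` needs an unsplit suffix, so `reduce` first replaces v by unsplit suffixes v′. Then
  -- the departure behind u^e joins the run d^b, while the e arrivals are divided between the two
  -- sides of the longer run.
  absorb : ∀ {n p m Q} b e v → ReducesToUnsplit n → length v ℕ.≤ n → Blocks p (b ℕ.+ suc m ∷ Q) →
    Dyck (m ℕ.+ sum Q ℕ.+ e) v →
    (∀ i j v′ → i ℕ.+ j ≡ e → length v′ ≡ length v → Dyck (m ℕ.+ sum Q ℕ.+ e) v′ →
      D (p ++ (u^ i ++ d^ (suc b) ++ u^ j) ++ v′) ≡ 0ℚ) →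
    D (p ++ (d^ b ++ u^ e ++ [ d ]) ++ v) ≡ 0ℚ
  absorb {p = p} {m} {Q} b e v reduce len bl dy ends =
    trans (cong D (reassoc v)) (reduce (((p ++ d^ b) ++ u^ e) ++ [ d ]) (m ∷ Q ++ [ e ]) v len
      (Blocks-pop (Blocks-push e (Blocks-pops b bl))) (subst (λ h → Dyck h v) (sym height) dy)
      (λ v′ len′ dy′ U → trans (sym (cong D (reassoc v′)))
        (rectangle b e v′ bl U (λ i j eq → ends i j v′ eq len′ (subst (λ h → Dyck h v′) height dy′)))))
    where
    height : sum (m ∷ Q ++ [ e ]) ≡ m ℕ.+ sum Q ℕ.+ e
    height = trans (cong (m ℕ.+_) (sum-∷ʳ Q e)) (sym (ℕ.+-assoc m (sum Q) e))
    reassoc : ∀ v → p ++ (d^ b ++ u^ e ++ [ d ]) ++ v ≡ (((p ++ d^ b) ++ u^ e) ++ [ d ]) ++ v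
    reassoc v = begin
      p ++ (d^ b ++ u^ e ++ [ d ]) ++ v         ≡⟨ sym (++-assoc p (d^ b ++ u^ e ++ [ d ]) v) ⟩
      (p ++ d^ b ++ u^ e ++ [ d ]) ++ v         ≡⟨ cong (_++ v) (sym (++-assoc p (d^ b) (u^ e ++ [ d ]))) ⟩
      ((p ++ d^ b) ++ u^ e ++ [ d ]) ++ v       ≡⟨ cong (_++ v) (sym (++-assoc (p ++ d^ b) (u^ e) [ d ])) ⟩
      (((p ++ d^ b) ++ u^ e) ++ [ d ]) ++ v     ∎

  regroup : ∀ p a b e w → p ++ u^ a ++ d^ b ++ u^ e ++ d ∷ w ≡ (p ++ u^ a) ++ (d^ b ++ u^ e ++ [ d ]) ++ w
  regroup p a b e w = trans (sym (++-assoc p (u^ a) (d^ b ++ u^ e ++ d ∷ w))) (cong ((p ++ u^ a) ++_)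
    (sym (trans (++-assoc (d^ b) (u^ e ++ [ d ]) w) (cong (d^ b ++_) (++-assoc (u^ e) [ d ] w)))))

  merge-blocks : ∀ p a b i j w →
    (p ++ u^ a) ++ (u^ i ++ d^ b ++ u^ j) ++ w ≡ p ++ u^ (a ℕ.+ i) ++ d^ b ++ u^ j ++ w
  merge-blocks p a b i j w = begin
    (p ++ u^ a) ++ (u^ i ++ d^ b ++ u^ j) ++ w   ≡⟨ ++-assoc p (u^ a) ((u^ i ++ d^ b ++ u^ j) ++ w) ⟩
    p ++ u^ a ++ (u^ i ++ d^ b ++ u^ j) ++ w     ≡⟨ cong (λ z → p ++ u^ a ++ z)
        (trans (++-assoc (u^ i) (d^ b ++ u^ j) w) (cong (u^ i ++_) (++-assoc (d^ b) (u^ j) w))) ⟩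
    p ++ u^ a ++ u^ i ++ d^ b ++ u^ j ++ w       ≡⟨ cong (p ++_) (sym (++-assoc (u^ a) (u^ i) (d^ b ++ u^ j ++ w))) ⟩
    p ++ (u^ a ++ u^ i) ++ d^ b ++ u^ j ++ w     ≡⟨ cong (λ z → p ++ z ++ d^ b ++ u^ j ++ w) (sym (replicate-+ u a i)) ⟩
    p ++ u^ (a ℕ.+ i) ++ d^ b ++ u^ j ++ w       ∎

  length-u^ : ∀ a w → length (u^ a ++ w) ≡ a ℕ.+ length w
  length-u^ a w = trans (length-++ (u^ a)) (cong (ℕ._+ length w) (length-replicate a))

  length-u^d^ : ∀ a b w → length (u^ a ++ d^ b ++ w) ≡ a ℕ.+ (b ℕ.+ length w)
  length-u^d^ a b w = trans (length-u^ a (d^ b ++ w))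
    (cong (a ℕ.+_) (trans (length-++ (d^ b)) (cong (ℕ._+ length w) (length-replicate b))))

  -- In `shrink`, b vertices of the first block leave in one run after u^a and m remain. `absorb`
  -- lengthens the run by one, and the i arrivals that move in front of it merge with u^a. At m = 0
  -- the block has left as a whole, and the induction on length takes the rest.
  reduce-to-unsplit : ∀ n → ReducesToUnsplit n
  reduce-to-unsplit n p [] v len bl dy given = given v refl dy done
  reduce-to-unsplit n p (zero ∷ Q) v len bl dy given =
    reduce-to-unsplit n p Q v len (Blocks-skip bl) dy (λ v′ l dy′ U → given v′ l dy′ (skip U))
  reduce-to-unsplit zero p (suc c ∷ Q) (_ ∷ _) () bl dy given
  reduce-to-unsplit (suc n) p (suc c ∷ Q) v len bl dy given =
    shrink (suc c) 0 0 v refl refl (subst (λ h → Dyck h v) (cong (suc c ℕ.+_) (sym (ℕ.+-identityʳ (sum Q)))) dy)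
    where
    shrink : ∀ m b a w → b ℕ.+ m ≡ suc c → length (u^ a ++ d^ b ++ w) ≡ length v →
      Dyck (m ℕ.+ (sum Q ℕ.+ a)) w → D (p ++ u^ a ++ d^ b ++ w) ≡ 0ℚ
    shrink zero b a w b≡ lw dw = trans (cong D (reassoc w))
      (reduce-to-unsplit n ((p ++ u^ a) ++ d^ b) (Q ++ [ a ]) w shorter
        (Blocks-skip (Blocks-pops b (subst (λ c → Blocks (p ++ u^ a) (c ∷ Q ++ [ a ])) (sym b≡) (Blocks-push a bl))))
        (subst (λ h → Dyck h w) (sym (sum-∷ʳ Q a)) dw)
        (λ w′ lw′ dw′ U → trans (cong D (trans (sym (reassoc w′)) (cong (λ b → p ++ u^ a ++ d^ b ++ w′) b≡suc)))
          (given (u^ a ++ d^ (suc c) ++ w′) (trans (same-length w′ lw′) lw) (dyck′ w′ dw′) (pop a U))))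
      where
      b≡suc : b ≡ suc c
      b≡suc = trans (sym (ℕ.+-identityʳ b)) b≡
      reassoc : ∀ w → p ++ u^ a ++ d^ b ++ w ≡ ((p ++ u^ a) ++ d^ b) ++ w
      reassoc w = sym (trans (++-assoc (p ++ u^ a) (d^ b) w) (++-assoc p (u^ a) (d^ b ++ w)))
      same-length : ∀ w′ → length w′ ≡ length w → length (u^ a ++ d^ (suc c) ++ w′) ≡ length (u^ a ++ d^ b ++ w)
      same-length w′ lw′ = trans (length-u^d^ a (suc c) w′)
        (trans (cong₂ (λ b l → a ℕ.+ (b ℕ.+ l)) (sym b≡suc) lw′) (sym (length-u^d^ a b w)))
      dyck′ : ∀ w′ → Dyck (sum (Q ++ [ a ])) w′ → Dyck (suc c ℕ.+ sum Q) (u^ a ++ d^ (suc c) ++ w′)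
      dyck′ w′ dw′ = Dyck-u^ a (subst (λ h → Dyck h (d^ (suc c) ++ w′))
        (trans (cong (suc c ℕ.+_) (sum-∷ʳ Q a)) (trans (sym (ℕ.+-assoc (suc c) (sum Q) a)) (ℕ.+-comm (suc c ℕ.+ sum Q) a)))
        (Dyck-d^ (suc c) dw′))
      shorter : length w ℕ.≤ n
      shorter = ℕ.≤-pred (ℕ.≤-trans (ℕ.≤-trans (ℕ.m≤n+m (suc (length w)) (a ℕ.+ c))
          (ℕ.≤-reflexive (trans (ℕ.+-assoc a c (suc (length w))) (trans (cong (a ℕ.+_) (ℕ.+-suc c (length w)))
            (trans (cong (λ b → a ℕ.+ (b ℕ.+ length w)) (sym b≡suc)) (sym (length-u^d^ a b w)))))))
        (ℕ.≤-trans (ℕ.≤-reflexive lw) len))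
    shrink (suc m) b a w b≡ lw dw with next-down dw
    ... | e , w′ , refl , dw′ = trans (cong D (regroup p a b e w′))
      (absorb b e w′ (reduce-to-unsplit n) shorter bl′ (subst (λ h → Dyck h w′) height dw′)
        (λ i j v′ i+j≡e lv′ dv′ → trans (cong D (merge-blocks p a (suc b) i j v′))
          (shrink m (suc b) (a ℕ.+ i) (u^ j ++ v′) (trans (sym (ℕ.+-suc b m)) b≡)
            (trans (lengths′ i j v′ i+j≡e lv′) lw)
            (Dyck-u^ j (subst (λ h → Dyck h v′) (height′ i j i+j≡e) dv′)))))
      where
      bl′ : Blocks (p ++ u^ a) (b ℕ.+ suc m ∷ Q ++ [ a ])
      bl′ = subst (λ c → Blocks (p ++ u^ a) (c ∷ Q ++ [ a ])) (sym b≡) (Blocks-push a bl)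
      height : e ℕ.+ (m ℕ.+ (sum Q ℕ.+ a)) ≡ m ℕ.+ sum (Q ++ [ a ]) ℕ.+ e
      height = trans (ℕ.+-comm e (m ℕ.+ (sum Q ℕ.+ a))) (cong (λ s → m ℕ.+ s ℕ.+ e) (sym (sum-∷ʳ Q a)))
      height′ : ∀ i j → i ℕ.+ j ≡ e → m ℕ.+ sum (Q ++ [ a ]) ℕ.+ e ≡ j ℕ.+ (m ℕ.+ (sum Q ℕ.+ (a ℕ.+ i)))
      height′ i j refl = trans (cong (λ s → m ℕ.+ s ℕ.+ (i ℕ.+ j)) (sum-∷ʳ Q a)) (arith m (sum Q) a i j)
        where
        arith : ∀ m s a i j → m ℕ.+ (s ℕ.+ a) ℕ.+ (i ℕ.+ j) ≡ j ℕ.+ (m ℕ.+ (s ℕ.+ (a ℕ.+ i)))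
        arith = NatSolver.solve-∀
      total : length (u^ a ++ d^ b ++ u^ e ++ d ∷ w′) ≡ a ℕ.+ (b ℕ.+ (e ℕ.+ suc (length w′)))
      total = trans (length-u^d^ a b (u^ e ++ d ∷ w′)) (cong (λ l → a ℕ.+ (b ℕ.+ l)) (length-u^ e (d ∷ w′)))
      lengths′ : ∀ i j v′ → i ℕ.+ j ≡ e → length v′ ≡ length w′ →
        length (u^ (a ℕ.+ i) ++ d^ (suc b) ++ u^ j ++ v′) ≡ length (u^ a ++ d^ b ++ u^ e ++ d ∷ w′)
      lengths′ i j v′ refl lv′ = trans (trans (length-u^d^ (a ℕ.+ i) (suc b) (u^ j ++ v′))
          (cong (λ l → a ℕ.+ i ℕ.+ (suc b ℕ.+ l)) (trans (length-u^ j v′) (cong (j ℕ.+_) lv′))))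
        (trans (arith a i b j (length w′)) (sym total))
        where
        arith : ∀ a i b j l → a ℕ.+ i ℕ.+ suc (b ℕ.+ (j ℕ.+ l)) ≡ a ℕ.+ (b ℕ.+ (i ℕ.+ j ℕ.+ suc l))
        arith = NatSolver.solve-∀
      shorter : length w′ ℕ.≤ n
      shorter = ℕ.≤-pred (ℕ.≤-trans (ℕ.m≤n+m (suc (length w′)) (a ℕ.+ (b ℕ.+ e)))
        (ℕ.≤-trans (ℕ.≤-reflexive (trans (arith a b e (suc (length w′))) (sym total))) (ℕ.≤-trans (ℕ.≤-reflexive lw) len)))
        where
        arith : ∀ a b e l → a ℕ.+ (b ℕ.+ e) ℕ.+ l ≡ a ℕ.+ (b ℕ.+ (e ℕ.+ l))
        arith = NatSolver.solve-∀

data CliqueUnion : Word → Set where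
  empty : CliqueUnion []
  _▹_   : ∀ {K} → CliqueUnion K → ∀ a → CliqueUnion (K ++ u^ a ++ d^ a)

CliqueUnion-balanced : ∀ {K} → CliqueUnion K → #u K ≡ #d K
CliqueUnion-balanced empty = refl
CliqueUnion-balanced (_▹_ {K} K∪ a) = begin
  #u (K ++ u^d^ a a)           ≡⟨ #u-++ K (u^d^ a a) ⟩
  #u K ℕ.+ #u (u^d^ a a)       ≡⟨ cong₂ ℕ._+_ (CliqueUnion-balanced K∪) (trans (#u-u^d^ a a) (sym (#d-u^d^ a a))) ⟩
  #d K ℕ.+ #d (u^d^ a a)       ≡⟨ sym (#d-++ K (u^d^ a a)) ⟩
  #d (K ++ u^d^ a a)           ∎

module _ {D : Word → ℚ} (modular : Modular D) (base : ∀ {K} → CliqueUnion K → D K ≡ 0ℚ) where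
  open Reduction modular

  -- `grow` acts like `shrink` on a single block, the clique being built, but arrivals moved to the
  -- front enlarge this block, so the recursion is on the length of the rest. When no vertex is left
  -- (h = 0), u^a d^a is a complete clique and joins K.
  modular-determined : ∀ n {K} v → length v ℕ.≤ n → CliqueUnion K → Dyck 0 v → D (K ++ v) ≡ 0ℚ
  modular-determined n {K} [] len K∪ dy = trans (cong D (++-identityʳ K)) (base K∪)
  modular-determined (suc n) {K} (u ∷ v) (ℕ.s≤s len) K∪ (up dy) = grow (suc (length v)) 1 0 1 v (ℕ.≤-refl) len refl dy
    where
    K-blocks : Blocks K []
    K-blocks = blocks (trans (CliqueUnion-balanced K∪) (sym (ℕ.+-identityʳ (#d K)))) (λ k ())
    grow : ∀ m a b h w → length w ℕ.< m → length w ℕ.≤ n → b ℕ.+ h ≡ a → Dyck h w → D (K ++ u^ a ++ d^ b ++ w) ≡ 0ℚ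
    grow m a b zero w lt le b≡a dw = trans (cong D reassoc) (modular-determined n w le (K∪ ▹ a) dw)
      where
      reassoc : K ++ u^ a ++ d^ b ++ w ≡ (K ++ u^ a ++ d^ a) ++ w
      reassoc = trans (cong (λ b → K ++ u^ a ++ d^ b ++ w) (trans (sym (ℕ.+-identityʳ b)) b≡a))
        (trans (cong (K ++_) (sym (++-assoc (u^ a) (d^ a) w))) (sym (++-assoc K (u^ a ++ d^ a) w)))
    grow (suc m) a b (suc h) w (ℕ.s≤s lt) le b≡a dw with next-down dw
    ... | e , w′ , refl , dw′ = trans (cong D (regroup K a b e w′))
      (absorb b e w′ (reduce-to-unsplit (length w′)) ℕ.≤-refl bl (subst (λ h → Dyck h w′) (height h e) dw′)
        (λ i j v′ i+j≡e lv′ dv′ → trans (cong D (merge-blocks K a (suc b) i j v′))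
          (grow m (a ℕ.+ i) (suc b) (h ℕ.+ i) (u^ j ++ v′) (ℕ.≤-trans (smaller i j v′ i+j≡e lv′) lt)
              (ℕ.≤-trans (ℕ.<⇒≤ (smaller i j v′ i+j≡e lv′)) le)
            (trans (cong suc (sym (ℕ.+-assoc b h i))) (cong (ℕ._+ i) (trans (sym (ℕ.+-suc b h)) b≡a)))
            (Dyck-u^ j (subst (λ h → Dyck h v′) (height′ i j i+j≡e) dv′)))))
      where
      bl : Blocks (K ++ u^ a) (b ℕ.+ suc h ∷ [])
      bl = subst (λ c → Blocks (K ++ u^ a) (c ∷ [])) (sym b≡a) (Blocks-push a K-blocks)
      height : ∀ h e → e ℕ.+ h ≡ h ℕ.+ 0 ℕ.+ e
      height = NatSolver.solve-∀
      height′ : ∀ i j → i ℕ.+ j ≡ e → h ℕ.+ 0 ℕ.+ e ≡ j ℕ.+ (h ℕ.+ i)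
      height′ i j refl = arith h i j
        where
        arith : ∀ h i j → h ℕ.+ 0 ℕ.+ (i ℕ.+ j) ≡ j ℕ.+ (h ℕ.+ i)
        arith = NatSolver.solve-∀
      smaller : ∀ i j v′ → i ℕ.+ j ≡ e → length v′ ≡ length w′ → length (u^ j ++ v′) ℕ.< length (u^ e ++ d ∷ w′)
      smaller i j v′ refl lv′ = subst₂ ℕ._<_
        (sym (trans (length-u^ j v′) (cong (j ℕ.+_) lv′))) (sym (length-u^ e (d ∷ w′)))
        (ℕ.≤-trans (ℕ.≤-reflexive (sym (ℕ.+-suc j (length w′)))) (ℕ.+-monoˡ-≤ (suc (length w′)) (ℕ.m≤n+m j i)))

-- Queue processes satisfy the modular relations

∑ : ∀ {A : Set} → List A → (A → ℚ) → ℚ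
∑ [] f = 0ℚ
∑ (x ∷ xs) f = f x + ∑ xs f

∑-cong : ∀ {A : Set} (xs : List A) {f g : A → ℚ} → (∀ x → f x ≡ g x) → ∑ xs f ≡ ∑ xs g
∑-cong [] eq = refl
∑-cong (x ∷ xs) eq = cong₂ _+_ (eq x) (∑-cong xs eq)

∑-0 : ∀ {A : Set} (xs : List A) {f : A → ℚ} → (∀ x → f x ≡ 0ℚ) → ∑ xs f ≡ 0ℚ
∑-0 [] eq = refl
∑-0 (x ∷ xs) eq = cong₂ _+_ (eq x) (∑-0 xs eq)

∑-+ : ∀ {A : Set} (xs : List A) (f g : A → ℚ) → ∑ xs f + ∑ xs g ≡ ∑ xs (λ x → f x + g x)
∑-+ [] f g = refl
∑-+ (x ∷ xs) f g = trans (lemma (f x) (∑ xs f) (g x) (∑ xs g)) (cong (f x + g x +_) (∑-+ xs f g))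
  where
  lemma : ∀ a b c d → (a + b) + (c + d) ≡ (a + c) + (b + d)
  lemma = solve-∀ ℚ-ring

∑-* : ∀ {A : Set} (xs : List A) c (f : A → ℚ) → c * ∑ xs f ≡ ∑ xs (λ x → c * f x)
∑-* [] c f = ℚ.*-zeroʳ c
∑-* (x ∷ xs) c f = trans (ℚ.*-distribˡ-+ c (f x) (∑ xs f)) (cong (c * f x +_) (∑-* xs c f))

∑-swap : ∀ {A B : Set} (xs : List A) (ys : List B) (f : A → B → ℚ) →
  ∑ xs (λ x → ∑ ys (f x)) ≡ ∑ ys (λ y → ∑ xs (λ x → f x y))
∑-swap [] ys f = sym (∑-0 ys (λ _ → refl))
∑-swap (x ∷ xs) ys f = trans (cong (∑ ys (f x) +_) (∑-swap xs ys f)) (∑-+ ys (f x) (λ y → ∑ xs (λ x → f x y)))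

∑-antisymmetric : ∀ {A : Set} (xs : List A) (f : A → A → ℚ) → (∀ x y → f x y + f y x ≡ 0ℚ) →
  ∑ xs (λ x → ∑ xs (f x)) ≡ 0ℚ
∑-antisymmetric xs f anti = *-cancel-0 (ι-suc≢0 1) (begin
  (1ℚ + (1ℚ + 0ℚ)) * t                 ≡⟨ double t ⟩
  t + t                                ≡⟨ cong (t +_) (∑-swap xs xs f) ⟩
  t + ∑ xs (λ y → ∑ xs (λ x → f x y))  ≡⟨ ∑-+ xs (λ x → ∑ xs (f x)) (λ x → ∑ xs (λ y → f y x)) ⟩
  ∑ xs (λ x → ∑ xs (f x) + ∑ xs (λ y → f y x))
    ≡⟨ ∑-0 xs (λ x → trans (∑-+ xs (f x) (λ y → f y x)) (∑-0 xs (anti x))) ⟩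
  0ℚ ∎)
  where
  t = ∑ xs (λ x → ∑ xs (f x))
  double : ∀ t → (1ℚ + (1ℚ + 0ℚ)) * t ≡ t + t
  double = solve-∀ ℚ-ring

-- `exchange₁` yields `law₁` and `exchange₂` yields `law₂`. The lists C₀ and C are independent,
-- since many letters may lie between the arrival of twins and their departure.
record Kernel {S : Set} (ρ : List S → S → ℚ) : Set where
  field
    ρ-↭       : ∀ {C C′} → C ↭ C′ → ∀ z → ρ C z ≡ ρ C′ z
    fresh     : ∀ C z → ρ C z ≡ 0ℚ ⊎ z ∉ C
    exchange₁ : ∀ {a C} x y → a ∉ C → Exchange₁ ρ a C x y + Exchange₁ ρ a C y x ≡ 0ℚ
    exchange₂ : ∀ {C₀ C} a b z → a ∉ C → b ∉ C → Exchange₂ ρ C₀ C a b z + Exchange₂ ρ C₀ C b a z ≡ 0ℚ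

-- A letter u appends a symbol z to the queue with weight ρ queue z, and d removes the oldest symbol.
module Process {S : Set} (symbols : List S) (ρ : List S → S → ℚ) (T : List S → ℚ) where

  value : Word → List S → List S → ℚ
  value [] q acc = T acc
  value (u ∷ w) q acc = ∑ symbols (λ z → ρ q z * value w (q ++ [ z ]) (z ∷ acc))
  -- A departure from an empty queue does not occur in Dyck words; with the value 0 the laws hold
  -- for such words as well.
  value (d ∷ w) [] acc = 0ℚ
  value (d ∷ w) (_ ∷ q) acc = value w q acc

  module _ (kernel : Kernel ρ) (T-↭ : ∀ {a b} → a ↭ b → T a ≡ T b) where
    open Kernel kernel

    value-↭ : ∀ w q {acc acc′} → acc ↭ acc′ → value w q acc ≡ value w q acc′
    value-↭ [] q p = T-↭ p
    value-↭ (u ∷ w) q p = ∑-cong symbols (λ z → cong (ρ q z *_) (value-↭ w (q ++ [ z ]) (Perm.prep z p)))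
    value-↭ (d ∷ w) [] p = refl
    value-↭ (d ∷ w) (_ ∷ q) p = value-↭ w q p

    -- As x and y leave by consecutive letters, no arrival sees only one of them, and the weights
    -- depend on the queue only up to order.
    value-swap : ∀ B C q₁ x y q₂ {acc acc′} → #d B ≡ length q₁ → acc ↭ acc′ →
      value (B ++ dd ++ C) (q₁ ++ x ∷ y ∷ q₂) acc ≡ value (B ++ dd ++ C) (q₁ ++ y ∷ x ∷ q₂) acc′
    value-swap [] C [] x y q₂ eq p = value-↭ C q₂ p
    value-swap (u ∷ B) C q₁ x y q₂ eq p = ∑-cong symbols (λ z → cong₂ _*_
      (ρ-↭ (Perm.++⁺ˡ q₁ (Perm.swap x y Perm.refl)) z)
      (trans (cong (λ q → value (B ++ dd ++ C) q _) (++-assoc q₁ (x ∷ y ∷ q₂) [ z ]))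
        (trans (value-swap B C q₁ x y (q₂ ++ [ z ]) eq (Perm.prep z p))
          (cong (λ q → value (B ++ dd ++ C) q _) (sym (++-assoc q₁ (y ∷ x ∷ q₂) [ z ]))))))
    value-swap (d ∷ B) C (_ ∷ q₁) x y q₂ eq p = value-swap B C q₁ x y q₂ (ℕ.suc-injective eq) p

    defect : Word → Word → Word → List S → List S → ℚ
    defect w₁ w₂ w₃ q acc = (value w₁ q acc + value w₁ q acc) - (value w₂ q acc + value w₃ q acc)

    ∑-defect : ∀ {A : Set} (xs : List A) (f g h : A → ℚ) →
      (∑ xs f + ∑ xs f) - (∑ xs g + ∑ xs h) ≡ ∑ xs (λ x → (f x + f x) - (g x + h x))
    ∑-defect [] f g h = refl
    ∑-defect (x ∷ xs) f g h = trans (lemma (f x) (g x) (h x) (∑ xs f) (∑ xs g) (∑ xs h))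
        (cong ((f x + f x) - (g x + h x) +_) (∑-defect xs f g h))
      where
      lemma : ∀ a b c x y z → (a + x + (a + x)) - (b + y + (c + z)) ≡ (a + a) - (b + c) + ((x + x) - (y + z))
      lemma = solve-∀ ℚ-ring

    defect-u : ∀ w₁ w₂ w₃ q acc →
      defect (u ∷ w₁) (u ∷ w₂) (u ∷ w₃) q acc ≡ ∑ symbols (λ z → ρ q z * defect w₁ w₂ w₃ (q ++ [ z ]) (z ∷ acc))
    defect-u w₁ w₂ w₃ q acc = trans
      (∑-defect symbols (λ z → ρ q z * v w₁ z) (λ z → ρ q z * v w₂ z) (λ z → ρ q z * v w₃ z))
      (∑-cong symbols (λ z → lemma (ρ q z) (v w₁ z) (v w₂ z) (v w₃ z)))
      where
      v : Word → S → ℚ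
      v w z = value w (q ++ [ z ]) (z ∷ acc)
      lemma : ∀ r a b c → (r * a + r * a) - (r * b + r * c) ≡ r * ((a + a) - (b + c))
      lemma = solve-∀ ℚ-ring

    Unique-∷ʳ : ∀ {q : List S} {z} → Unique q → z ∉ q → Unique (q ++ [ z ])
    Unique-∷ʳ {q} {z} uq z∉ = AllPairs.++⁺ {xs = q} uq (All.[] AllPairs.∷ AllPairs.[])
      (All.tabulate (λ x∈ → (λ x≡z → z∉ (subst (_∈ q) x≡z x∈)) All.∷ All.[]))

    -- The claim is pushed to the queues reached after A. Those with a repeated symbol have weight 0
    -- by freshness, so only repetition-free queues of the right length remain.
    defect-prefix : ∀ A w₁ w₂ w₃ q acc → Unique q →
      (∀ q′ acc′ → Unique q′ → length q′ ℕ.+ #d A ≡ length q ℕ.+ #u A → defect w₁ w₂ w₃ q′ acc′ ≡ 0ℚ) →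
      defect (A ++ w₁) (A ++ w₂) (A ++ w₃) q acc ≡ 0ℚ
    defect-prefix [] w₁ w₂ w₃ q acc uq h = h q acc uq refl
    defect-prefix (u ∷ A) w₁ w₂ w₃ q acc uq h =
      trans (defect-u (A ++ w₁) (A ++ w₂) (A ++ w₃) q acc) (∑-0 symbols step)
      where
      step : ∀ z → ρ q z * defect (A ++ w₁) (A ++ w₂) (A ++ w₃) (q ++ [ z ]) (z ∷ acc) ≡ 0ℚ
      step z with fresh q z
      ... | inj₁ eq = zero-*ˡ (defect (A ++ w₁) (A ++ w₂) (A ++ w₃) (q ++ [ z ]) (z ∷ acc)) eq
      ... | inj₂ z∉ = zero-*ʳ (ρ q z) (defect-prefix A w₁ w₂ w₃ (q ++ [ z ]) (z ∷ acc) (Unique-∷ʳ uq z∉)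
          (λ q′ acc′ uq′ eq → h q′ acc′ uq′
              (trans eq (trans (cong (ℕ._+ #u A) (trans (length-++ q) (ℕ.+-comm (length q) 1)))
                  (sym (ℕ.+-suc (length q) (#u A)))))))
    defect-prefix (d ∷ A) w₁ w₂ w₃ [] acc uq h = refl
    defect-prefix (d ∷ A) w₁ w₂ w₃ (x ∷ q) acc (_ AllPairs.∷ uq) h =
      defect-prefix A w₁ w₂ w₃ q acc uq (λ q′ acc′ uq′ eq → h q′ acc′ uq′
        (trans (ℕ.+-suc (length q′) (#d A)) (cong suc eq)))

    double : (S → S → ℚ) → ℚ
    double f = ∑ symbols (λ x → ∑ symbols (f x))

    value-uu : ∀ w q acc → value (u ∷ u ∷ w) q acc ≡
      double (λ x y → ρ q x * (ρ (q ++ [ x ]) y * value w ((q ++ [ x ]) ++ [ y ]) (y ∷ x ∷ acc)))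
    value-uu w q acc = ∑-cong symbols (λ x → ∑-* symbols (ρ q x)
        (λ y → ρ (q ++ [ x ]) y * value w ((q ++ [ x ]) ++ [ y ]) (y ∷ x ∷ acc)))

    ∷ʳ↭∷ : ∀ q (x : S) → q ++ [ x ] ↭ x ∷ q
    ∷ʳ↭∷ q x = ↭-sym (Perm.∷↭∷ʳ x q)

    -- By `value-swap` the rest of the word has the same value for both orders of the two new
    -- symbols, so the two orders together give a multiple of the symmetrised `Exchange₁`.
    law₁-at : ∀ B C a q acc → a ∉ q → #d B ≡ length q →
      defect (udu ++ B ++ dd ++ C) (duu ++ B ++ dd ++ C) (uud ++ B ++ dd ++ C) (a ∷ q) acc ≡ 0ℚ
    law₁-at B C a q acc a∉ eq = begin
      (value (udu ++ R) (a ∷ q) acc + value (udu ++ R) (a ∷ q) acc)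
        - (value (u ∷ u ∷ R) q acc + value (uud ++ R) (a ∷ q) acc)
        ≡⟨ cong₂ _-_ (cong₂ _+_ expand expand) (cong₂ _+_ (value-uu R q acc) (value-uu (d ∷ R) (a ∷ q) acc)) ⟩
      (double f + double f) - (double g + double h)
        ≡⟨ trans (∑-defect symbols (λ x → ∑ symbols (f x)) (λ x → ∑ symbols (g x)) (λ x → ∑ symbols (h x)))
             (∑-cong symbols (λ x → ∑-defect symbols (f x) (g x) (h x))) ⟩
      double (λ x y → (f x y + f x y) - (g x y + h x y))
        ≡⟨ ∑-antisymmetric symbols _ antisymmetric ⟩
      0ℚ ∎
      where
      R = B ++ dd ++ C
      V f g h : S → S → ℚ
      V x y = value R ((q ++ [ x ]) ++ [ y ]) (y ∷ x ∷ acc)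
      f x y = ρ (a ∷ q) x * (ρ (q ++ [ x ]) y * V x y)
      g x y = ρ q x * (ρ (q ++ [ x ]) y * V x y)
      h x y = ρ (a ∷ q) x * (ρ (a ∷ q ++ [ x ]) y * V x y)
      expand : value (udu ++ R) (a ∷ q) acc ≡ double f
      expand = ∑-cong symbols (λ x → ∑-* symbols (ρ (a ∷ q) x) (λ y → ρ (q ++ [ x ]) y * V x y))
      V-symmetric : ∀ x y → V x y ≡ V y x
      V-symmetric x y = trans (cong (λ q → value R q (y ∷ x ∷ acc)) (++-assoc q [ x ] [ y ]))
        (trans (value-swap B C q x y [] eq (Perm.swap y x Perm.refl))
          (cong (λ q → value R q (x ∷ y ∷ acc)) (sym (++-assoc q [ y ] [ x ]))))
      to-exchange : ∀ x y → (f x y + f x y) - (g x y + h x y) ≡ - (Exchange₁ ρ a q x y * V x y)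
      to-exchange x y = trans
        (cong₂ (λ r s → (ρ (a ∷ q) x * (r * V x y) + ρ (a ∷ q) x * (r * V x y)) -
            (ρ q x * (r * V x y) + ρ (a ∷ q) x * (s * V x y)))
          (ρ-↭ (∷ʳ↭∷ q x) y) (ρ-↭ (Perm.prep a (∷ʳ↭∷ q x)) y))
        (lemma (ρ (a ∷ q) x) (ρ (x ∷ q) y) (ρ q x) (ρ (a ∷ x ∷ q) y) (V x y))
        where
        lemma : ∀ ax xy qx axy v → (ax * (xy * v) + ax * (xy * v)) - (qx * (xy * v) + ax * (axy * v))
          ≡ - ((qx * xy - 2ℚ * (ax * xy) + ax * axy) * v)
        lemma = solve-∀ ℚ-ring
      antisymmetric : ∀ x y → ((f x y + f x y) - (g x y + h x y)) + ((f y x + f y x) - (g y x + h y x)) ≡ 0ℚ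
      antisymmetric x y = begin
        ((f x y + f x y) - (g x y + h x y)) + ((f y x + f y x) - (g y x + h y x))
          ≡⟨ cong₂ _+_ (to-exchange x y) (trans (to-exchange y x) (cong (λ v → - (Exchange₁ ρ a q y x * v)) (V-symmetric y x))) ⟩
        - (Exchange₁ ρ a q x y * V x y) + - (Exchange₁ ρ a q y x * V x y)
          ≡⟨ factor (Exchange₁ ρ a q x y) (Exchange₁ ρ a q y x) (V x y) ⟩
        - (Exchange₁ ρ a q x y + Exchange₁ ρ a q y x) * V x y
          ≡⟨ cong (λ e → - e * V x y) (exchange₁ x y a∉) ⟩
        - 0ℚ * V x y
          ≡⟨ ℚ.*-zeroˡ (V x y) ⟩
        0ℚ ∎
        where
        factor : ∀ e e′ v → - (e * v) + - (e′ * v) ≡ - (e + e′) * v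
        factor = solve-∀ ℚ-ring

    module Law₂ (C : Word) (q₀ : List S) (x y : S) where
      weight : S → S → ℚ
      weight x y = ρ q₀ x * ρ (x ∷ q₀) y

      Δ : Word → List S → List S → ℚ
      Δ B = defect (B ++ dud ++ C) (B ++ ddu ++ C) (B ++ udd ++ C)

      -- Until the twins reach the front of the queue, the arrivals in B have the same weight for
      -- both orders, so the cancellation at the front carries back. An arrival of nonzero weight is
      -- new, which keeps x and y out of q₂.
      pair-cancels : ∀ B q₁ q₂ {acc acc′} → #d B ≡ length q₁ → x ∉ q₂ → y ∉ q₂ → acc ↭ acc′ →
        weight x y * Δ B (q₁ ++ x ∷ y ∷ q₂) acc + weight y x * Δ B (q₁ ++ y ∷ x ∷ q₂) acc′ ≡ 0ℚ
      pair-cancels [] [] q₂ {acc} {acc′} eq x∉ y∉ p = begin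
        weight x y * Δ [] (x ∷ y ∷ q₂) acc + weight y x * Δ [] (y ∷ x ∷ q₂) acc′
          ≡⟨ cong₂ (λ s t → weight x y * s + weight y x * t) (expand x y acc)
              (trans (expand y x acc′) (∑-cong symbols (λ z → cong (bracket y x z *_) (sym (V-↭ z))))) ⟩
        weight x y * ∑ symbols (λ z → bracket x y z * V z) + weight y x * ∑ symbols (λ z → bracket y x z * V z)
          ≡⟨ cong₂ _+_ (∑-* symbols (weight x y) _) (∑-* symbols (weight y x) _) ⟩
        ∑ symbols (λ z → weight x y * (bracket x y z * V z)) + ∑ symbols (λ z → weight y x * (bracket y x z * V z))
          ≡⟨ ∑-+ symbols _ _ ⟩
        ∑ symbols (λ z → weight x y * (bracket x y z * V z) + weight y x * (bracket y x z * V z))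
          ≡⟨ ∑-0 symbols vanish ⟩
        0ℚ ∎
        where
        V : S → ℚ
        V z = value C (q₂ ++ [ z ]) (z ∷ acc)
        V-↭ : ∀ z → V z ≡ value C (q₂ ++ [ z ]) (z ∷ acc′)
        V-↭ z = value-↭ C (q₂ ++ [ z ]) (Perm.prep z p)
        bracket : S → S → S → ℚ
        bracket x y z = (ρ (y ∷ q₂) z + ρ (y ∷ q₂) z) - (ρ q₂ z + ρ (x ∷ y ∷ q₂) z)
        expand : ∀ x y acc → Δ [] (x ∷ y ∷ q₂) acc ≡ ∑ symbols (λ z → bracket x y z * value C (q₂ ++ [ z ]) (z ∷ acc))
        expand x y acc = trans (∑-defect symbols (λ z → ρ (y ∷ q₂) z * v z) (λ z → ρ q₂ z * v z) (λ z → ρ (x ∷ y ∷ q₂) z * v z))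
          (∑-cong symbols (λ z → lemma (ρ (y ∷ q₂) z) (ρ q₂ z) (ρ (x ∷ y ∷ q₂) z) (v z)))
          where
          v : S → ℚ
          v z = value C (q₂ ++ [ z ]) (z ∷ acc)
          lemma : ∀ a b c v → (a * v + a * v) - (b * v + c * v) ≡ ((a + a) - (b + c)) * v
          lemma = solve-∀ ℚ-ring
        vanish : ∀ z → weight x y * (bracket x y z * V z) + weight y x * (bracket y x z * V z) ≡ 0ℚ
        vanish z = begin
          weight x y * (bracket x y z * V z) + weight y x * (bracket y x z * V z)
            ≡⟨ lemma (weight x y) (ρ (y ∷ q₂) z) (ρ q₂ z) (ρ (x ∷ y ∷ q₂) z)
                (weight y x) (ρ (x ∷ q₂) z) (ρ (y ∷ x ∷ q₂) z) (V z) ⟩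
          - (Exchange₂ ρ q₀ q₂ x y z + Exchange₂ ρ q₀ q₂ y x z) * V z
            ≡⟨ cong (λ e → - e * V z) (exchange₂ x y z x∉ y∉) ⟩
          - 0ℚ * V z
            ≡⟨ ℚ.*-zeroˡ (V z) ⟩
          0ℚ ∎
          where
          lemma : ∀ w a b c w′ a′ c′ v →
            w * (((a + a) - (b + c)) * v) + w′ * (((a′ + a′) - (b + c′)) * v)
            ≡ - (w * (c - 2ℚ * a + b) + w′ * (c′ - 2ℚ * a′ + b)) * v
          lemma = solve-∀ ℚ-ring
      pair-cancels (d ∷ B) (_ ∷ q₁) q₂ eq x∉ y∉ p = pair-cancels B q₁ q₂ (ℕ.suc-injective eq) x∉ y∉ p
      pair-cancels (u ∷ B) q₁ q₂ {acc} {acc′} eq x∉ y∉ p = begin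
        weight x y * Δ (u ∷ B) qxy acc + weight y x * Δ (u ∷ B) qyx acc′
          ≡⟨ cong₂ (λ s t → weight x y * s + weight y x * t) (defect-u (B ++ w₁) (B ++ w₂) (B ++ w₃) qxy acc)
              (trans (defect-u (B ++ w₁) (B ++ w₂) (B ++ w₃) qyx acc′)
                  (∑-cong symbols (λ z → cong (_* Δyx z) (sym (ρ-swap z))))) ⟩
        weight x y * ∑ symbols (λ z → ρ qxy z * Δxy z) + weight y x * ∑ symbols (λ z → ρ qxy z * Δyx z)
          ≡⟨ cong₂ _+_ (∑-* symbols (weight x y) _) (∑-* symbols (weight y x) _) ⟩
        ∑ symbols (λ z → weight x y * (ρ qxy z * Δxy z)) + ∑ symbols (λ z → weight y x * (ρ qxy z * Δyx z))
          ≡⟨ ∑-+ symbols _ _ ⟩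
        ∑ symbols (λ z → weight x y * (ρ qxy z * Δxy z) + weight y x * (ρ qxy z * Δyx z))
          ≡⟨ ∑-0 symbols (λ z → trans (factor (weight x y) (weight y x) (ρ qxy z) (Δxy z) (Δyx z)) (vanish z)) ⟩
        0ℚ ∎
        where
        w₁ = dud ++ C
        w₂ = ddu ++ C
        w₃ = udd ++ C
        qxy = q₁ ++ x ∷ y ∷ q₂
        qyx = q₁ ++ y ∷ x ∷ q₂
        Δxy Δyx : S → ℚ
        Δxy z = Δ B (qxy ++ [ z ]) (z ∷ acc)
        Δyx z = Δ B (qyx ++ [ z ]) (z ∷ acc′)
        ρ-swap : ∀ z → ρ qxy z ≡ ρ qyx z
        ρ-swap z = ρ-↭ (Perm.++⁺ˡ q₁ (Perm.swap x y Perm.refl)) z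
        factor : ∀ w w′ r a b → w * (r * a) + w′ * (r * b) ≡ r * (w * a + w′ * b)
        factor = solve-∀ ℚ-ring
        vanish : ∀ z → ρ qxy z * (weight x y * Δxy z + weight y x * Δyx z) ≡ 0ℚ
        vanish z with fresh qxy z
        ... | inj₁ eq₀ = zero-*ˡ (weight x y * Δxy z + weight y x * Δyx z) eq₀
        ... | inj₂ z∉ = zero-*ʳ (ρ qxy z) (trans
            (cong₂ (λ s t → weight x y * Δ B s (z ∷ acc) + weight y x * Δ B t (z ∷ acc′))
                (++-assoc q₁ (x ∷ y ∷ q₂) [ z ]) (++-assoc q₁ (y ∷ x ∷ q₂) [ z ]))
            (pair-cancels B q₁ (q₂ ++ [ z ]) eq (∉-∷ʳ x∉ (λ eq → z∉ (∈-++⁺ʳ q₁ (here eq))))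
                (∉-∷ʳ y∉ (λ eq → z∉ (∈-++⁺ʳ q₁ (there (here eq))))) (Perm.prep z p)))
          where
          ∉-∷ʳ : ∀ {t} → t ∉ q₂ → (z ≢ t) → t ∉ q₂ ++ [ z ]
          ∉-∷ʳ t∉ z≢t t∈ with ∈-++⁻ q₂ t∈
          ... | inj₁ t∈′ = t∉ t∈′
          ... | inj₂ (here refl) = z≢t refl

    law₂-at : ∀ B C q acc → #d B ≡ length q →
      defect (uu ++ B ++ dud ++ C) (uu ++ B ++ ddu ++ C) (uu ++ B ++ udd ++ C) q acc ≡ 0ℚ
    law₂-at B C q acc eq = begin
      defect (uu ++ B ++ dud ++ C) (uu ++ B ++ ddu ++ C) (uu ++ B ++ udd ++ C) q acc
        ≡⟨ defect-u (u ∷ w₁) (u ∷ w₂) (u ∷ w₃) q acc ⟩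
      ∑ symbols (λ x → ρ q x * defect (u ∷ B ++ dud ++ C) (u ∷ B ++ ddu ++ C) (u ∷ B ++ udd ++ C) (q ++ [ x ]) (x ∷ acc))
        ≡⟨ ∑-cong symbols (λ x → trans (cong (ρ q x *_) (defect-u w₁ w₂ w₃ (q ++ [ x ]) (x ∷ acc)))
            (trans (∑-* symbols (ρ q x) (λ y → ρ (q ++ [ x ]) y * Δ x y B
                ((q ++ [ x ]) ++ [ y ]) (y ∷ x ∷ acc))) (∑-cong symbols (term x)))) ⟩
      double f
        ≡⟨ ∑-antisymmetric symbols f (λ x y → Law₂.pair-cancels C q x y B q [] eq (λ ()) (λ ()) (Perm.swap y x Perm.refl)) ⟩
      0ℚ ∎
      where
      open Law₂ C q using (Δ; weight)
      w₁ = B ++ dud ++ C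
      w₂ = B ++ ddu ++ C
      w₃ = B ++ udd ++ C
      f : S → S → ℚ
      f x y = weight x y x y * Δ x y B (q ++ x ∷ y ∷ []) (y ∷ x ∷ acc)
      term : ∀ x y → ρ q x * (ρ (q ++ [ x ]) y * Δ x y B ((q ++ [ x ]) ++ [ y ]) (y ∷ x ∷ acc)) ≡ f x y
      term x y = trans (cong₂ (λ r s → ρ q x * (r * Δ x y B s (y ∷ x ∷ acc))) (ρ-↭ (∷ʳ↭∷ q x) y) (++-assoc q [ x ] [ y ]))
        (sym (ℚ.*-assoc (ρ q x) (ρ (x ∷ q) y) (Δ x y B (q ++ x ∷ y ∷ []) (y ∷ x ∷ acc))))

    law-from-defect : ∀ w₁ w₂ w₃ → defect w₁ w₂ w₃ [] [] ≡ 0ℚ →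
      value w₁ [] [] + value w₁ [] [] ≡ value w₂ [] [] + value w₃ [] []
    law-from-defect w₁ w₂ w₃ = difference-0

    modular : Modular (λ w → value w [] [])
    modular = record { law₁ = law₁ ; law₂ = law₂ }
      where
      law₁ : ∀ A B C → #u A ≡ #d A ℕ.+ suc (#d B) →
        value (A ++ udu ++ B ++ dd ++ C) [] [] + value (A ++ udu ++ B ++ dd ++ C) [] []
          ≡ value (A ++ duu ++ B ++ dd ++ C) [] [] + value (A ++ uud ++ B ++ dd ++ C) [] []
      law₁ A B C eq = law-from-defect (A ++ udu ++ R) (A ++ duu ++ R) (A ++ uud ++ R)
        (defect-prefix A (udu ++ R) (duu ++ R) (uud ++ R) [] [] AllPairs.[] at)
        where
        R = B ++ dd ++ C
        at : ∀ q acc → Unique q → length q ℕ.+ #d A ≡ #u A → defect (udu ++ R) (duu ++ R) (uud ++ R) q acc ≡ 0ℚ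
        at q acc uq eq′ with q | uq | ℕ.+-cancelʳ-≡ (#d A) (length q) (suc (#d B))
                                        (trans eq′ (trans eq (ℕ.+-comm (#d A) (suc (#d B)))))
        ... | a ∷ q′ | a∉ AllPairs.∷ _ | eq″ =
          law₁-at B C a q′ acc (λ a∈ → All.lookup a∉ a∈ refl) (ℕ.suc-injective (sym eq″))
      law₂ : ∀ A C → TwinAt A (#d A) →
        value (A ++ dud ++ C) [] [] + value (A ++ dud ++ C) [] []
          ≡ value (A ++ ddu ++ C) [] [] + value (A ++ udd ++ C) [] []
      law₂ _ C (A , B , refl , eq) = law-from-defect ((A ++ uu ++ B) ++ dud ++ C)
          ((A ++ uu ++ B) ++ ddu ++ C) ((A ++ uu ++ B) ++ udd ++ C)
        (subst₂ (λ w₁ w₂ → defect w₁ w₂ ((A ++ uu ++ B) ++ udd ++ C) [] [] ≡ 0ℚ) (sym (assoc dud)) (sym (assoc ddu))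
          (subst (λ w₃ → defect (A ++ uu ++ B ++ dud ++ C) (A ++ uu ++ B ++ ddu ++ C) w₃ [] [] ≡ 0ℚ) (sym (assoc udd))
            (defect-prefix A (uu ++ B ++ dud ++ C) (uu ++ B ++ ddu ++ C) (uu ++ B ++ udd ++ C) [] [] AllPairs.[]
              (λ q acc uq eq′ → law₂-at B C q acc (ℕ.+-cancelˡ-≡ (#d A) (#d B) (length q)
                (trans (sym (#d-++ A (uu ++ B))) (trans (sym eq) (trans (sym eq′) (ℕ.+-comm (length q) (#d A))))))))))
        where
        assoc : ∀ w → (A ++ uu ++ B) ++ w ++ C ≡ A ++ uu ++ B ++ w ++ C
        assoc w = ++-assoc A (uu ++ B) (w ++ C)

-- Proper colourings

indicator : Bool → ℚ
indicator true = 1ℚ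
indicator false = 0ℚ

factorial-product : List ℕ → ℕ
factorial-product as = product (map _! as)

blocks-word : List ℕ → Word
blocks-word [] = []
blocks-word (a ∷ as) = u^ a ++ d^ a ++ blocks-word as

∑-cong-∈ : ∀ {A : Set} (xs : List A) {f g : A → ℚ} → (∀ {x} → x ∈ xs → f x ≡ g x) → ∑ xs f ≡ ∑ xs g
∑-cong-∈ [] eq = refl
∑-cong-∈ (x ∷ xs) eq = cong₂ _+_ (eq (here refl)) (∑-cong-∈ xs (eq ∘ there))

∑-++ : ∀ {A : Set} (xs ys : List A) (f : A → ℚ) → ∑ (xs ++ ys) f ≡ ∑ xs f + ∑ ys f
∑-++ [] ys f = sym (ℚ.+-identityˡ (∑ ys f))
∑-++ (x ∷ xs) ys f = trans (cong (f x +_) (∑-++ xs ys f)) (sym (ℚ.+-assoc (f x) (∑ xs f) (∑ ys f)))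

∑-map : ∀ {A B : Set} (h : A → B) (xs : List A) (f : B → ℚ) → ∑ (map h xs) f ≡ ∑ xs (f ∘ h)
∑-map h [] f = refl
∑-map h (x ∷ xs) f = cong (f (h x) +_) (∑-map h xs f)

∑-concatMap : ∀ {A B : Set} (h : A → List B) (xs : List A) (f : B → ℚ) → ∑ (concatMap h xs) f ≡ ∑ xs (λ x → ∑ (h x) f)
∑-concatMap h [] f = refl
∑-concatMap h (x ∷ xs) f = trans (∑-++ (h x) (concatMap h xs) f) (cong (∑ (h x) f +_) (∑-concatMap h xs f))

∑-filter : ∀ {A : Set} {P : A → Set} (P? : ∀ x → Dec (P x)) (xs : List A) (f : A → ℚ) →
  ∑ (filter P? xs) f ≡ ∑ xs (λ x → indicator ⌊ P? x ⌋ * f x)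
∑-filter P? [] f = refl
∑-filter P? (x ∷ xs) f with P? x
... | yes _ = cong₂ _+_ (sym (ℚ.*-identityˡ (f x))) (∑-filter P? xs f)
... | no _ = trans (∑-filter P? xs f) (sym (trans (cong (_+ rest) (ℚ.*-zeroˡ (f x))) (ℚ.+-identityˡ rest)))
  where rest = ∑ xs (λ x → indicator ⌊ P? x ⌋ * f x)

ι-countB : ∀ {A : Set} (p : A → Bool) (xs : List A) → ι (countB p xs) ≡ ∑ xs (indicator ∘ p)
ι-countB p [] = refl
ι-countB p (x ∷ xs) with p x
... | true = cong (1ℚ +_) (ι-countB p xs)
... | false = trans (ι-countB p xs) (sym (ℚ.+-identityˡ (∑ xs (indicator ∘ p))))

module _ {S : Set} (symbols : List S) (ρ : List S → S → ℚ) (T : List S → ℚ) where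
  open Process symbols ρ T

  value-length : ∀ {n} → (∀ acc → length acc ≢ n → T acc ≡ 0ℚ) →
    ∀ w q acc → #u w ℕ.+ length acc ≢ n → value w q acc ≡ 0ℚ
  value-length h [] q acc ≢n = h acc ≢n
  value-length h (u ∷ w) q acc ≢n = ∑-0 symbols (λ z →
    zero-*ʳ (ρ q z) (value-length h w (q ++ [ z ]) (z ∷ acc) (≢n ∘ trans (sym (ℕ.+-suc (#u w) (length acc))))))
  value-length h (d ∷ w) [] acc ≢n = refl
  value-length h (d ∷ w) (_ ∷ q) acc ≢n = value-length h w q acc ≢n

  value-d^ : ∀ w q acc → value (d^ (length q) ++ w) q acc ≡ value w [] acc
  value-d^ w [] acc = refl
  value-d^ w (_ ∷ q) acc = value-d^ w q acc

module Colouring (N : ℕ) where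

  differ : Fin N → Fin N → ℚ
  differ z a with z Fin.≟ a
  ... | yes _ = 0ℚ
  ... | no _ = 1ℚ

  χ : List (Fin N) → Fin N → ℚ
  χ [] z = 1ℚ
  χ (a ∷ C) z = differ z a * χ C z

  differ-self : ∀ a → differ a a ≡ 0ℚ
  differ-self a with a Fin.≟ a
  ... | yes _ = refl
  ... | no a≢a = ⊥-elim (a≢a refl)

  differ-≢ : ∀ {z a} → z ≢ a → differ z a ≡ 1ℚ
  differ-≢ {z} {a} z≢a with z Fin.≟ a
  ... | yes z≡a = ⊥-elim (z≢a z≡a)
  ... | no _ = refl

  differ-sym : ∀ a b → differ a b ≡ differ b a
  differ-sym a b with a Fin.≟ b
  ... | yes refl = sym (differ-self a)
  ... | no a≢b = sym (differ-≢ (a≢b ∘ sym))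

  -- If x and y both equal a, they equal each other: both exchange identities for `χ` come down to
  -- this.
  exclusive : ∀ x y a → differ y x * ((1ℚ - differ x a) * (1ℚ - differ y a)) ≡ 0ℚ
  exclusive x y a with x Fin.≟ a | y Fin.≟ a
  ... | yes refl | yes refl = cong (_* (1ℚ * 1ℚ)) (differ-self x)
  ... | yes refl | no y≢ = ℚ.*-zeroʳ (differ y x)
  ... | no _ | yes refl = ℚ.*-zeroʳ (differ y x)
  ... | no _ | no _ = ℚ.*-zeroʳ (differ y x)

  χ-↭ : ∀ {C C′} → C ↭ C′ → ∀ z → χ C z ≡ χ C′ z
  χ-↭ Perm.refl z = refl
  χ-↭ (Perm.prep a p) z = cong (differ z a *_) (χ-↭ p z)
  χ-↭ (Perm.swap {ys = C′} a b p) z = trans (cong (λ t → differ z a * (differ z b * t)) (χ-↭ p z))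
      (lemma (differ z a) (differ z b) (χ C′ z))
    where
    lemma : ∀ a b c → a * (b * c) ≡ b * (a * c)
    lemma = solve-∀ ℚ-ring
  χ-↭ (Perm.trans p q) z = trans (χ-↭ p z) (χ-↭ q z)

  χ-kernel : Kernel χ
  χ-kernel = record { ρ-↭ = χ-↭ ; fresh = fresh ; exchange₁ = exchange₁ ; exchange₂ = λ {C₀} → exchange₂ {C₀} }
    where
    fresh : ∀ C z → χ C z ≡ 0ℚ ⊎ z ∉ C
    fresh [] z = inj₂ (λ ())
    fresh (a ∷ C) z with z Fin.≟ a
    ... | yes _ = inj₁ (ℚ.*-zeroˡ (χ C z))
    ... | no z≢a with fresh C z
    ...   | inj₁ eq = inj₁ (zero-*ʳ 1ℚ eq)
    ...   | inj₂ z∉ = inj₂ (λ { (here z≡a) → z≢a z≡a ; (there z∈) → z∉ z∈ })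
    exchange₁ : ∀ {a C} x y → a ∉ C → Exchange₁ χ a C x y + Exchange₁ χ a C y x ≡ 0ℚ
    exchange₁ {a} {C} x y _ = trans
      (cong (λ t → Exchange₁ χ a C x y + (χ C y * (t * χ C x) - 2ℚ * (differ y a * χ C y *
          (t * χ C x)) + differ y a * χ C y * (differ x a * (t * χ C x)))) (differ-sym x y))
      (trans (lemma (χ C x) (χ C y) (differ y x) (differ x a) (differ y a))
        (zero-*ʳ (2ℚ * (χ C x * χ C y)) (exclusive x y a)))
      where
      lemma : ∀ cx cy yx xa ya →
        (cx * (yx * cy) - 2ℚ * (xa * cx * (yx * cy)) + xa * cx * (ya * (yx * cy)))
        + (cy * (yx * cx) - 2ℚ * (ya * cy * (yx * cx)) + ya * cy * (xa * (yx * cx)))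
        ≡ 2ℚ * (cx * cy) * (yx * ((1ℚ - xa) * (1ℚ - ya)))
      lemma = solve-∀ ℚ-ring
    exchange₂ : ∀ {C₀ C} a b z → a ∉ C → b ∉ C → Exchange₂ χ C₀ C a b z + Exchange₂ χ C₀ C b a z ≡ 0ℚ
    exchange₂ {C₀} {C} a b z _ _ = trans
      (cong (λ t → Exchange₂ χ C₀ C a b z + χ C₀ b * (t * χ C₀ a) * (differ z b *
          (differ z a * χ C z) - 2ℚ * (differ z a * χ C z) + χ C z)) (differ-sym a b))
      (trans (lemma (χ C₀ a) (χ C₀ b) (χ C z) (differ b a) (differ z a) (differ z b))
        (zero-*ʳ (2ℚ * (χ C₀ a * χ C₀ b * χ C z))
            (trans (cong₂ (λ s t → differ b a * ((1ℚ - s) * (1ℚ - t))) (differ-sym z a) (differ-sym z b)) (exclusive a b z))))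
      where
      lemma : ∀ ca cb cz ba za zb →
        ca * (ba * cb) * (za * (zb * cz) - 2ℚ * (zb * cz) + cz)
        + cb * (ba * ca) * (zb * (za * cz) - 2ℚ * (za * cz) + cz)
        ≡ 2ℚ * (ca * cb * cz) * (ba * ((1ℚ - za) * (1ℚ - zb)))
      lemma = solve-∀ ℚ-ring

  -- An elementary symmetric sum: each k-element subset of the list is weighted by the product of φ
  -- over it and handed to g together with acc.
  subset-sum : (List (Fin N) → ℚ) → (Fin N → ℚ) → List (Fin N) → ℕ → List (Fin N) → ℚ
  subset-sum g φ [] zero acc = g acc
  subset-sum g φ [] (suc k) acc = 0ℚ
  subset-sum g φ (x ∷ xs) zero acc = g acc
  subset-sum g φ (x ∷ xs) (suc k) acc = φ x * subset-sum g φ xs k (x ∷ acc) + subset-sum g φ xs (suc k) acc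

  SymmetricFn : (List (Fin N) → ℚ) → Set
  SymmetricFn g = ∀ {a b} → a ↭ b → g a ≡ g b

  module _ {g : List (Fin N) → ℚ} (g-↭ : SymmetricFn g) where

    subset-sum-0 : ∀ φ xs acc → subset-sum g φ xs 0 acc ≡ g acc
    subset-sum-0 φ [] acc = refl
    subset-sum-0 φ (x ∷ xs) acc = refl

    subset-sum-↭ : ∀ φ xs k {acc acc′} → acc ↭ acc′ → subset-sum g φ xs k acc ≡ subset-sum g φ xs k acc′
    subset-sum-↭ φ [] zero p = g-↭ p
    subset-sum-↭ φ [] (suc k) p = refl
    subset-sum-↭ φ (x ∷ xs) zero p = g-↭ p
    subset-sum-↭ φ (x ∷ xs) (suc k) p =
      cong₂ (λ s t → φ x * s + t) (subset-sum-↭ φ xs k (Perm.prep x p)) (subset-sum-↭ φ xs (suc k) p)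

    subset-sum-cong : ∀ {φ ψ} xs k acc → (∀ {x} → x ∈ xs → φ x ≡ ψ x) → subset-sum g φ xs k acc ≡ subset-sum g ψ xs k acc
    subset-sum-cong [] zero acc eq = refl
    subset-sum-cong [] (suc k) acc eq = refl
    subset-sum-cong (x ∷ xs) zero acc eq = refl
    subset-sum-cong (x ∷ xs) (suc k) acc eq = cong₂ _+_
      (cong₂ _*_ (eq (here refl)) (subset-sum-cong xs k (x ∷ acc) (eq ∘ there))) (subset-sum-cong xs (suc k) acc (eq ∘ there))

    without : (Fin N → ℚ) → Fin N → Fin N → ℚ
    without φ z x = differ x z * φ x

    -- Each (k + 1)-subset arises k + 1 times by choosing one of its elements first.
    choose-first : ∀ φ xs k acc → Unique xs →
      ∑ xs (λ z → φ z * subset-sum g (without φ z) xs k (z ∷ acc)) ≡ ι (suc k) * subset-sum g φ xs (suc k) acc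
    choose-first φ [] k acc uq = sym (ℚ.*-zeroʳ (ι (suc k)))
    choose-first φ (x ∷ xs) zero acc (x∉ AllPairs.∷ uq) = begin
      φ x * g (x ∷ acc) + ∑ xs (λ z → φ z * g (z ∷ acc))
        ≡⟨ cong₂ (λ s t → φ x * s + t) (sym (subset-sum-0 φ xs (x ∷ acc)))
             (trans (∑-cong xs (λ z → cong (φ z *_) (sym (subset-sum-0 (without φ z) xs (z ∷ acc)))))
                 (choose-first φ xs 0 acc uq)) ⟩
      φ x * subset-sum g φ xs 0 (x ∷ acc) + ι 1 * subset-sum g φ xs 1 acc
        ≡⟨ lemma (φ x * subset-sum g φ xs 0 (x ∷ acc)) (subset-sum g φ xs 1 acc) ⟩
      ι 1 * (φ x * subset-sum g φ xs 0 (x ∷ acc) + subset-sum g φ xs 1 acc) ∎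
      where
      lemma : ∀ a b → a + (1ℚ + 0ℚ) * b ≡ (1ℚ + 0ℚ) * (a + b)
      lemma = solve-∀ ℚ-ring
    choose-first φ (x ∷ xs) (suc k) acc (x∉ AllPairs.∷ uq) = begin
      φ x * (without φ x x * s₁ + s₂) + ∑ xs (λ z → φ z * (without φ z x * t₁ z + t₂ z))
        ≡⟨ cong₂ _+_ (trans (cong (λ w → φ x * (w * φ x * s₁ + s₂)) (differ-self x)) (drop (φ x) s₁ s₂))
             (∑-cong-∈ xs (λ {z} z∈ → trans (cong (λ w → φ z * (w * φ x * t₁ z + t₂ z))
                 (differ-≢ (All.lookup x∉ z∈))) (distribute (φ z) (φ x) (t₁ z) (t₂ z)))) ⟩
      φ x * s₂ + ∑ xs (λ z → φ x * (φ z * t₁ z) + φ z * t₂ z)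
        ≡⟨ cong₂ (λ a b → φ x * a + b) (subset-sum-cong xs (suc k) (x ∷ acc) (λ {y} y∈ → trans
            (cong (_* φ y) (differ-≢ (All.lookup x∉ y∈ ∘ sym))) (ℚ.*-identityˡ (φ y))))
             (sym (∑-+ xs (λ z → φ x * (φ z * t₁ z)) (λ z → φ z * t₂ z))) ⟩
      φ x * S + (∑ xs (λ z → φ x * (φ z * t₁ z)) + ∑ xs (λ z → φ z * t₂ z))
        ≡⟨ cong₂ (λ a b → φ x * S + (a + b)) (sym (∑-* xs (φ x) (λ z → φ z * t₁ z))) (choose-first φ xs (suc k) acc uq) ⟩
      φ x * S + (φ x * ∑ xs (λ z → φ z * t₁ z) + ι (suc (suc k)) * R)
        ≡⟨ cong (λ a → φ x * S + (φ x * a + ι (suc (suc k)) * R))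
             (trans (∑-cong xs (λ z → cong (φ z *_) (subset-sum-↭ (without φ z) xs k (Perm.swap x z Perm.refl))))
                 (choose-first φ xs k (x ∷ acc) uq)) ⟩
      φ x * S + (φ x * (ι (suc k) * S) + ι (suc (suc k)) * R)
        ≡⟨ collect (φ x) S R (ι (suc k)) ⟩
      ι (suc (suc k)) * (φ x * S + R) ∎
      where
      s₁ = subset-sum g (without φ x) xs k (x ∷ x ∷ acc)
      s₂ = subset-sum g (without φ x) xs (suc k) (x ∷ acc)
      t₁ t₂ : Fin N → ℚ
      t₁ z = subset-sum g (without φ z) xs k (x ∷ z ∷ acc)
      t₂ z = subset-sum g (without φ z) xs (suc k) (z ∷ acc)
      S = subset-sum g φ xs (suc k) (x ∷ acc)
      R = subset-sum g φ xs (suc (suc k)) acc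
      drop : ∀ f a b → f * (0ℚ * f * a + b) ≡ f * b
      drop = solve-∀ ℚ-ring
      distribute : ∀ z x a b → z * (1ℚ * x * a + b) ≡ x * (z * a) + z * b
      distribute = solve-∀ ℚ-ring
      collect : ∀ x S R k → x * S + (x * (k * S) + (1ℚ + k) * R) ≡ (1ℚ + k) * (x * S + R)
      collect = solve-∀ ℚ-ring

    module _ (w : Word) where
      open Process (allFin N) χ using (value)

      -- Colouring a clique means choosing a different colours in order, and each subset of a
      -- colours arises in a! ways.
      value-clique : ∀ T → (∀ acc → value T w [] acc ≡ g acc) → ∀ a q acc →
        value T (u^ a ++ d^ (length q ℕ.+ a) ++ w) q acc ≡ ι (a !) * subset-sum g (χ q) (allFin N) a acc
      value-clique T hg zero q acc = begin
        value T (d^ (length q ℕ.+ 0) ++ w) q acc  ≡⟨ cong (λ l → value T (d^ l ++ w) q acc) (ℕ.+-identityʳ (length q)) ⟩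
        value T (d^ (length q) ++ w) q acc        ≡⟨ trans (value-d^ (allFin N) χ T w q acc) (hg acc) ⟩
        g acc                                     ≡⟨ sym (subset-sum-0 (χ q) (allFin N) acc) ⟩
        subset-sum g (χ q) (allFin N) 0 acc       ≡⟨ lemma (subset-sum g (χ q) (allFin N) 0 acc) ⟩
        ι 1 * subset-sum g (χ q) (allFin N) 0 acc ∎
        where
        lemma : ∀ x → x ≡ (1ℚ + 0ℚ) * x
        lemma = solve-∀ ℚ-ring
      value-clique T hg (suc a) q acc = begin
        ∑ (allFin N) (λ z → χ q z * value T (u^ a ++ d^ (length q ℕ.+ suc a) ++ w) (q ++ [ z ]) (z ∷ acc))
          ≡⟨ ∑-cong (allFin N) (λ z → cong (χ q z *_) (step z)) ⟩
        ∑ (allFin N) (λ z → χ q z * (ι (a !) * subset-sum g (without (χ q) z) (allFin N) a (z ∷ acc)))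
          ≡⟨ trans (∑-cong (allFin N) (λ z → commute (χ q z) (ι (a !)) (subset-sum g (without (χ q) z) (allFin N) a (z ∷ acc))))
               (sym (∑-* (allFin N) (ι (a !)) (λ z → χ q z * subset-sum g (without (χ q) z) (allFin N) a (z ∷ acc)))) ⟩
        ι (a !) * ∑ (allFin N) (λ z → χ q z * subset-sum g (without (χ q) z) (allFin N) a (z ∷ acc))
          ≡⟨ cong (ι (a !) *_) (choose-first (χ q) (allFin N) a acc (Unique.allFin⁺ N)) ⟩
        ι (a !) * (ι (suc a) * R)
          ≡⟨ trans (swap (ι (a !)) (ι (suc a)) R) (cong (_* R) (sym (ι-* (suc a) (a !)))) ⟩
        ι (suc a !) * R ∎
        where
        R = subset-sum g (χ q) (allFin N) (suc a) acc
        commute : ∀ x f s → x * (f * s) ≡ f * (x * s)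
        commute = solve-∀ ℚ-ring
        swap : ∀ f s r → f * (s * r) ≡ s * f * r
        swap = solve-∀ ℚ-ring
        step : ∀ z → value T (u^ a ++ d^ (length q ℕ.+ suc a) ++ w) (q ++ [ z ]) (z ∷ acc)
          ≡ ι (a !) * subset-sum g (without (χ q) z) (allFin N) a (z ∷ acc)
        step z = begin
          value T (u^ a ++ d^ (length q ℕ.+ suc a) ++ w) (q ++ [ z ]) (z ∷ acc)
            ≡⟨ cong (λ l → value T (u^ a ++ d^ l ++ w) (q ++ [ z ]) (z ∷ acc))
                 (sym (trans (cong (ℕ._+ a) (length-++ q)) (ℕ.+-assoc (length q) 1 a))) ⟩
          value T (u^ a ++ d^ (length (q ++ [ z ]) ℕ.+ a) ++ w) (q ++ [ z ]) (z ∷ acc)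
            ≡⟨ value-clique T hg a (q ++ [ z ]) (z ∷ acc) ⟩
          ι (a !) * subset-sum g (χ (q ++ [ z ])) (allFin N) a (z ∷ acc)
            ≡⟨ cong (ι (a !) *_) (subset-sum-cong (allFin N) a (z ∷ acc) (λ {x} _ → χ-↭ (↭-sym (Perm.∷↭∷ʳ z q)) x)) ⟩
          ι (a !) * subset-sum g (without (χ q) z) (allFin N) a (z ∷ acc) ∎

  members : ∀ {m} → (Fin m → Fin N) → Vec Bool m → List (Fin N)
  members f [] = []
  members f (true ∷ S) = f zero ∷ members (f ∘ suc) S
  members f (false ∷ S) = members (f ∘ suc) S

  size : ∀ {m} → Vec Bool m → ℕ
  size S = countB (λ b → b) (toList S)

  bools : List Bool
  bools = true ∷ false ∷ []

  has-size : ∀ {m} → ℕ → Vec Bool m → ℚ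
  has-size k S = indicator ⌊ size S ℕ.≟ k ⌋

  ∑-allVecs : ∀ {A : Set} (xs : List A) m (f : Vec A (suc m) → ℚ) →
    ∑ (allVecs xs (suc m)) f ≡ ∑ xs (λ x → ∑ (allVecs xs m) (λ v → f (x ∷ v)))
  ∑-allVecs xs m f = trans (∑-concatMap (λ x → map (x ∷_) (allVecs xs m)) xs f)
    (∑-cong xs (λ x → ∑-map (x ∷_) (allVecs xs m) f))

  ∑-bool-vectors : ∀ m (f : Vec Bool (suc m) → ℚ) →
    ∑ (allVecs bools (suc m)) f ≡ ∑ (allVecs bools m) (λ S → f (true ∷ S)) + ∑ (allVecs bools m) (λ S → f (false ∷ S))
  ∑-bool-vectors m f = trans (∑-allVecs bools m f) (cong (∑ (allVecs bools m) (λ S → f (true ∷ S)) +_)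
      (ℚ.+-identityʳ (∑ (allVecs bools m) (λ S → f (false ∷ S)))))

  indicator-suc : ∀ m k → indicator ⌊ suc m ℕ.≟ suc k ⌋ ≡ indicator ⌊ m ℕ.≟ k ⌋
  indicator-suc m k with m ℕ.≟ k | suc m ℕ.≟ suc k
  ... | yes _ | yes _ = refl
  ... | no _ | no _ = refl
  ... | yes m≡k | no ≢ = ⊥-elim (≢ (cong suc m≡k))
  ... | no m≢k | yes eq = ⊥-elim (m≢k (ℕ.suc-injective eq))

  module _ {g : List (Fin N) → ℚ} (g-↭ : SymmetricFn g) where

    members-true : ∀ {m} (f : Fin (suc m) → Fin N) S acc →
      g (members (f ∘ suc) S ++ f zero ∷ acc) ≡ g (members f (true ∷ S) ++ acc)
    members-true f S acc = g-↭ (Perm.shift (f zero) (members (f ∘ suc) S) acc)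

    subset-sum-vectors : ∀ m (f : Fin m → Fin N) k acc → subset-sum g (χ []) (tabulate f) k acc
      ≡ ∑ (allVecs bools m) (λ S → has-size k S * g (members f S ++ acc))
    subset-sum-vectors zero f zero acc = lemma (g acc)
      where
      lemma : ∀ x → x ≡ 1ℚ * x + 0ℚ
      lemma = solve-∀ ℚ-ring
    subset-sum-vectors zero f (suc k) acc = sym (trans (cong (_+ 0ℚ) (ℚ.*-zeroˡ (g acc))) refl)
    subset-sum-vectors (suc m) f zero acc = begin
      g acc
        ≡⟨ sym (subset-sum-0 g-↭ (χ []) (tabulate (f ∘ suc)) acc) ⟩
      subset-sum g (χ []) (tabulate (f ∘ suc)) 0 acc
        ≡⟨ subset-sum-vectors m (f ∘ suc) 0 acc ⟩
      ∑ (allVecs bools m) (λ S → has-size 0 S * g (members (f ∘ suc) S ++ acc))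
        ≡⟨ sym (ℚ.+-identityˡ _) ⟩
      0ℚ + ∑ (allVecs bools m) (λ S → has-size 0 S * g (members (f ∘ suc) S ++ acc))
        ≡⟨ cong (_+ ∑ (allVecs bools m) (λ S → has-size 0 S * g (members (f ∘ suc) S ++ acc)))
             (sym (∑-0 (allVecs bools m) (λ S → ℚ.*-zeroˡ (g (members f (true ∷ S) ++ acc))))) ⟩
      _ ≡⟨ sym (∑-bool-vectors m (λ S → has-size 0 S * g (members f S ++ acc))) ⟩
      ∑ (allVecs bools (suc m)) (λ S → has-size 0 S * g (members f S ++ acc)) ∎
    subset-sum-vectors (suc m) f (suc k) acc = begin
      1ℚ * subset-sum g (χ []) (tabulate (f ∘ suc)) k (f zero ∷ acc) + subset-sum g (χ []) (tabulate (f ∘ suc)) (suc k) acc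
        ≡⟨ cong₂ _+_ (trans (ℚ.*-identityˡ (subset-sum g (χ []) (tabulate (f ∘ suc)) k (f zero ∷ acc)))
             (trans (subset-sum-vectors m (f ∘ suc) k (f zero ∷ acc))
               (∑-cong (allVecs bools m) (λ S → cong₂ _*_ (sym (indicator-suc (size S) k)) (members-true f S acc)))))
             (subset-sum-vectors m (f ∘ suc) (suc k) acc) ⟩
      ∑ (allVecs bools m) (λ S → has-size (suc k) (true ∷ S) * g (members f (true ∷ S) ++ acc))
        + ∑ (allVecs bools m) (λ S → has-size (suc k) (false ∷ S) * g (members f (false ∷ S) ++ acc))
        ≡⟨ sym (∑-bool-vectors m (λ S → has-size (suc k) S * g (members f S ++ acc))) ⟩
      ∑ (allVecs bools (suc m)) (λ S → has-size (suc k) S * g (members f S ++ acc)) ∎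

    subset-sum-subsets : ∀ k acc → subset-sum g (χ []) (allFin N) k acc
      ≡ ∑ (subsetsOfSize N k) (λ S → g (members (λ c → c) S ++ acc))
    subset-sum-subsets k acc = trans (subset-sum-vectors N (λ c → c) k acc)
      (sym (∑-filter (λ S → size S ℕ.≟ k) (allVecs bools N) (λ S → g (members (λ c → c) S ++ acc))))

  members-of : Vec Bool N → List (Fin N)
  members-of = members (λ c → c)

  module _ (T : List (Fin N) → ℚ) (T-↭ : SymmetricFn T) where
    open Process (allFin N) χ T using (value; value-↭)

    tuple-sum : List ℕ → List (Fin N) → ℚ
    tuple-sum [] acc = T acc
    tuple-sum (a ∷ as) acc = ∑ (subsetsOfSize N a) (λ S → tuple-sum as (members-of S ++ acc))

    tuple-sum-↭-acc : ∀ as → SymmetricFn (tuple-sum as)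
    tuple-sum-↭-acc [] p = T-↭ p
    tuple-sum-↭-acc (a ∷ as) p = ∑-cong (subsetsOfSize N a) (λ S → tuple-sum-↭-acc as (Perm.++⁺ˡ (members-of S) p))

    tuple-sum-↭ : ∀ {as bs} → as ↭ bs → ∀ acc → tuple-sum as acc ≡ tuple-sum bs acc
    tuple-sum-↭ Perm.refl acc = refl
    tuple-sum-↭ (Perm.prep a p) acc = ∑-cong (subsetsOfSize N a) (λ S → tuple-sum-↭ p (members-of S ++ acc))
    tuple-sum-↭ (Perm.trans p q) acc = trans (tuple-sum-↭ p acc) (tuple-sum-↭ q acc)
    tuple-sum-↭ (Perm.swap {xs = as} {bs} a b p) acc = trans
      (∑-swap (subsetsOfSize N a) (subsetsOfSize N b) (λ S S′ → tuple-sum as (members-of S′ ++ members-of S ++ acc)))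
      (∑-cong (subsetsOfSize N b) (λ S′ → ∑-cong (subsetsOfSize N a) (λ S →
        trans (tuple-sum-↭-acc as (exchange (members-of S′) (members-of S)))
            (tuple-sum-↭ p (members-of S ++ members-of S′ ++ acc)))))
      where
      exchange : ∀ xs ys → xs ++ ys ++ acc ↭ ys ++ xs ++ acc
      exchange xs ys = Perm.trans (Perm.↭-reflexive (sym (++-assoc xs ys acc)))
        (Perm.trans (Perm.++⁺ʳ acc (Perm.++-comm xs ys)) (Perm.↭-reflexive (++-assoc ys xs acc)))

    value-blocks : ∀ as acc → value (blocks-word as) [] acc ≡ ι (factorial-product as) * tuple-sum as acc
    value-blocks [] acc = lemma (T acc)
      where
      lemma : ∀ x → x ≡ (1ℚ + 0ℚ) * x
      lemma = solve-∀ ℚ-ring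
    value-blocks (a ∷ as) acc = begin
      value (u^ a ++ d^ a ++ blocks-word as) [] acc
        ≡⟨ value-clique (λ p → cong (ι (factorial-product as) *_) (tuple-sum-↭-acc as p))
            (blocks-word as) T (value-blocks as) a [] acc ⟩
      ι (a !) * subset-sum g (χ []) (allFin N) a acc
        ≡⟨ cong (ι (a !) *_) (trans (subset-sum-subsets (λ p → cong (ι (factorial-product as) *_) (tuple-sum-↭-acc as p)) a acc)
             (sym (∑-* (subsetsOfSize N a) (ι (factorial-product as)) (λ S → tuple-sum as (members-of S ++ acc))))) ⟩
      ι (a !) * (ι (factorial-product as) * tuple-sum (a ∷ as) acc)
        ≡⟨ trans (sym (ℚ.*-assoc (ι (a !)) (ι (factorial-product as)) (tuple-sum (a ∷ as) acc)))
             (cong (_* tuple-sum (a ∷ as) acc) (sym (ι-* (a !) (factorial-product as)))) ⟩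
      ι (factorial-product (a ∷ as)) * tuple-sum (a ∷ as) acc ∎
      where
      g : List (Fin N) → ℚ
      g acc = ι (factorial-product as) * tuple-sum as acc

-- Unions of cliques

countB-↭ : ∀ {A : Set} (p : A → Bool) {xs ys : List A} → xs ↭ ys → countB p xs ≡ countB p ys
countB-↭ p Perm.refl = refl
countB-↭ p (Perm.prep x r) = cong ((if p x then 1 else 0) ℕ.+_) (countB-↭ p r)
countB-↭ p (Perm.swap {ys = ys} x y r) = trans (cong (λ t → a ℕ.+ (b ℕ.+ t)) (countB-↭ p r)) (lemma a b (countB p ys))
  where
  a = if p x then 1 else 0
  b = if p y then 1 else 0
  lemma : ∀ a b c → a ℕ.+ (b ℕ.+ c) ≡ b ℕ.+ (a ℕ.+ c)
  lemma = NatSolver.solve-∀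
countB-↭ p (Perm.trans r s) = trans (countB-↭ p r) (countB-↭ p s)

countB-++ : ∀ {A : Set} (p : A → Bool) (xs ys : List A) → countB p (xs ++ ys) ≡ countB p xs ℕ.+ countB p ys
countB-++ p [] ys = refl
countB-++ p (x ∷ xs) ys = trans (cong ((if p x then 1 else 0) ℕ.+_) (countB-++ p xs ys))
    (sym (ℕ.+-assoc (if p x then 1 else 0) (countB p xs) (countB p ys)))

allB-cong : ∀ {A : Set} {p q : A → Bool} (xs : List A) → (∀ x → p x ≡ q x) → allB p xs ≡ allB q xs
allB-cong [] eq = refl
allB-cong (x ∷ xs) eq = cong₂ _∧_ (eq x) (allB-cong xs eq)

indicator-yes : ∀ {P : Set} (P? : Dec P) → P → indicator ⌊ P? ⌋ ≡ 1ℚ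
indicator-yes (yes _) p = refl
indicator-yes (no ¬p) p = ⊥-elim (¬p p)

indicator-no : ∀ {P : Set} (P? : Dec P) → ¬ P → indicator ⌊ P? ⌋ ≡ 0ℚ
indicator-no (yes p) ¬p = ⊥-elim (¬p p)
indicator-no (no _) ¬p = refl

module Monomial (n N : ℕ) (α : Vec ℕ N) where
  open Colouring N

  occurrences : Fin N → List (Fin N) → ℕ
  occurrences c = countB (λ v → ⌊ v Fin.≟ c ⌋)

  has-monomial : List (Fin N) → Bool
  has-monomial acc = allB (λ c → ⌊ occurrences c acc ℕ.≟ lookup α c ⌋) (allFin N)

  -- With the length factor the value of a word without exactly n letters u is 0. `shape-value` has
  -- the same factor, so the two functionals agree trivially on clique unions of any other size.
  content-test : List (Fin N) → ℚ
  content-test acc = indicator ⌊ length acc ℕ.≟ n ⌋ * indicator (has-monomial acc)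

  has-monomial-↭ : ∀ {a b} → a ↭ b → has-monomial a ≡ has-monomial b
  has-monomial-↭ p = allB-cong (allFin N) (λ c → cong (λ k → ⌊ k ℕ.≟ lookup α c ⌋) (countB-↭ (λ v → ⌊ v Fin.≟ c ⌋) p))

  content-test-↭ : SymmetricFn content-test
  content-test-↭ p = cong₂ (λ l b → indicator ⌊ l ℕ.≟ n ⌋ * indicator b) (Perm.↭-length p) (has-monomial-↭ p)

  content-test-length : ∀ acc → length acc ≢ n → content-test acc ≡ 0ℚ
  content-test-length acc ≢n = zero-*ˡ (indicator (has-monomial acc)) (indicator-no (length acc ℕ.≟ n) ≢n)

  open Process (allFin N) χ content-test public using () renaming (value to coloured)

  clique-coefficient : List ℕ → ℚ
  clique-coefficient as = ι (factorial-product as) * tuple-sum content-test content-test-↭ as []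

  coloured-blocks : ∀ as → coloured (blocks-word as) [] [] ≡ clique-coefficient as
  coloured-blocks as = value-blocks content-test content-test-↭ as []

  clique-coefficient-↭ : ∀ {as bs} → as ↭ bs → clique-coefficient as ≡ clique-coefficient bs
  clique-coefficient-↭ p = cong₂ (λ f t → ι f * t) (product-↭ (Perm.map⁺ _! p)) (tuple-sum-↭ content-test content-test-↭ p [])

  length-members : ∀ {m} (f : Fin m → Fin N) S → length (members f S) ≡ size S
  length-members f [] = refl
  length-members f (true ∷ S) = cong suc (length-members (f ∘ suc) S)
  length-members f (false ∷ S) = length-members (f ∘ suc) S

  occurrences-∉ : ∀ {m} (f : Fin m → Fin N) c S → (∀ i → f i ≢ c) → occurrences c (members f S) ≡ 0
  occurrences-∉ f c [] h = refl
  occurrences-∉ f c (true ∷ S) h with f zero Fin.≟ c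
  ... | yes eq = ⊥-elim (h zero eq)
  ... | no _ = occurrences-∉ (f ∘ suc) c S (h ∘ suc)
  occurrences-∉ f c (false ∷ S) h = occurrences-∉ (f ∘ suc) c S (h ∘ suc)

  occurrences-members : ∀ {m} (f : Fin m → Fin N) → (∀ {i j} → f i ≡ f j → i ≡ j) → ∀ S i →
    occurrences (f i) (members f S) ≡ (if lookup S i then 1 else 0)
  occurrences-members f inj (true ∷ S) zero with f zero Fin.≟ f zero
  ... | yes _ = cong suc (occurrences-∉ (f ∘ suc) (f zero) S (λ i eq → case inj eq of λ ()))
  ... | no ≢ = ⊥-elim (≢ refl)
  occurrences-members f inj (false ∷ S) zero = occurrences-∉ (f ∘ suc) (f zero) S (λ i eq → case inj eq of λ ())
  occurrences-members f inj (true ∷ S) (suc i) with f zero Fin.≟ f (suc i)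
  ... | yes eq = case inj eq of λ ()
  ... | no _ = occurrences-members (f ∘ suc) (Fin.suc-injective ∘ inj) S i
  occurrences-members f inj (false ∷ S) (suc i) = occurrences-members (f ∘ suc) (Fin.suc-injective ∘ inj) S i

  flatten : List (Vec Bool N) → List (Fin N) → List (Fin N)
  flatten [] acc = acc
  flatten (S ∷ T) acc = flatten T (members-of S ++ acc)

  occurrences-flatten : ∀ T acc c →
    occurrences c (flatten T acc) ≡ countB (λ S → lookup S c) T ℕ.+ occurrences c acc
  occurrences-flatten [] acc c = refl
  occurrences-flatten (S ∷ T) acc c = begin
    occurrences c (flatten T (members-of S ++ acc))
      ≡⟨ occurrences-flatten T (members-of S ++ acc) c ⟩
    countB (λ S → lookup S c) T ℕ.+ occurrences c (members-of S ++ acc)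
      ≡⟨ cong (countB (λ S → lookup S c) T ℕ.+_) (trans (countB-++ (λ v → ⌊ v Fin.≟ c ⌋) (members-of S) acc)
           (cong (ℕ._+ occurrences c acc) (occurrences-members (λ c → c) (λ eq → eq) S c))) ⟩
    countB (λ S → lookup S c) T ℕ.+ ((if lookup S c then 1 else 0) ℕ.+ occurrences c acc)
      ≡⟨ lemma (countB (λ S → lookup S c) T) (if lookup S c then 1 else 0) (occurrences c acc) ⟩
    (if lookup S c then 1 else 0) ℕ.+ countB (λ S → lookup S c) T ℕ.+ occurrences c acc ∎
    where
    lemma : ∀ t s o → t ℕ.+ (s ℕ.+ o) ≡ s ℕ.+ t ℕ.+ o
    lemma = NatSolver.solve-∀

  tuple-sum-tuples : ∀ as acc → sum as ℕ.+ length acc ≡ n → tuple-sum content-test content-test-↭ as acc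
    ≡ ∑ (subsetTuples N as) (λ T → indicator (has-monomial (flatten T acc)))
  tuple-sum-tuples [] acc eq = trans (cong (_* indicator (has-monomial acc))
      (indicator-yes (length acc ℕ.≟ n) eq)) (lemma (indicator (has-monomial acc)))
    where
    lemma : ∀ x → 1ℚ * x ≡ x + 0ℚ
    lemma = solve-∀ ℚ-ring
  tuple-sum-tuples (a ∷ as) acc eq = trans
    (∑-cong-∈ (subsetsOfSize N a) (λ {S} S∈ → trans
      (tuple-sum-tuples as (members-of S ++ acc)
          (trans (cong (sum as ℕ.+_) (trans (length-++ (members-of S)) (cong (ℕ._+ length acc)
          (trans (length-members (λ c → c) S) (proj₂ (∈-filter⁻ (λ S → size S ℕ.≟ a) {xs = allVecs bools N} S∈))))))
        (trans (lemma (sum as) a (length acc)) eq)))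
      (sym (∑-map (S ∷_) (subsetTuples N as) (λ T → indicator (has-monomial (flatten T acc)))))))
    (sym (∑-concatMap (λ S → map (S ∷_) (subsetTuples N as)) (subsetsOfSize N a)
        (λ T → indicator (has-monomial (flatten T acc)))))
    where
    lemma : ∀ s a l → s ℕ.+ (a ℕ.+ l) ≡ a ℕ.+ s ℕ.+ l
    lemma = NatSolver.solve-∀

  clique-coefficient-E : ∀ as → sum as ≡ n → clique-coefficient as ≡ ι (factorial-product as) * ι (coeffE N as α)
  clique-coefficient-E as eq = cong (ι (factorial-product as) *_)
      (trans (tuple-sum-tuples as [] (trans (ℕ.+-identityʳ (sum as)) eq))
    (sym (trans (ι-countB (λ T → allB (λ c → ⌊ countB (λ S → lookup S c) T ℕ.≟ lookup α c ⌋) (allFin N)) (subsetTuples N as))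
      (∑-cong (subsetTuples N as) (λ T → cong indicator (allB-cong (allFin N) (λ c →
        cong (λ k → ⌊ k ℕ.≟ lookup α c ⌋) (sym (trans (occurrences-flatten T [] c)
            (ℕ.+-identityʳ (countB (λ S → lookup S c) T)))))))))))

-- Young diagrams recorded by their columns

-- Recovers the row lengths of a Young diagram from its column multiplicities.
rows-from : ℕ → (ℕ → ℕ) → List ℕ
rows-from zero m = []
rows-from (suc l) m = replicate (m l ∸ m (suc l)) (suc l) ++ rows-from l m

rows-from-cong : ∀ l {m m′} → (∀ i → m i ≡ m′ i) → rows-from l m ≡ rows-from l m′
rows-from-cong zero eq = refl
rows-from-cong (suc l) eq = cong₂ (λ k r → replicate k (suc l) ++ r) (cong₂ _∸_ (eq l) (eq (suc l))) (rows-from-cong l eq)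

-- The length of column l + 1 of the diagram with rows `as`, that is, a part of the conjugate
-- partition.
longer : List ℕ → ℕ → ℕ
longer as l = countB (λ a → ⌊ l ℕ.<? a ⌋) as

longer-yes : ∀ {a l} as → l ℕ.< a → longer (a ∷ as) l ≡ suc (longer as l)
longer-yes {a} {l} as lt with l ℕ.<? a
... | yes _ = refl
... | no ≮ = ⊥-elim (≮ lt)

longer-no : ∀ {a l} as → ¬ l ℕ.< a → longer (a ∷ as) l ≡ longer as l
longer-no {a} {l} as ≮ with l ℕ.<? a
... | yes lt = ⊥-elim (≮ lt)
... | no _ = refl

longer-mono : ∀ as l → longer as (suc l) ℕ.≤ longer as l
longer-mono [] l = ℕ.z≤n
longer-mono (a ∷ as) l with suc l ℕ.<? a | l ℕ.<? a
... | yes _ | yes _ = ℕ.s≤s (longer-mono as l)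
... | yes lt | no ≮ = ⊥-elim (≮ (ℕ.<-trans (ℕ.n<1+n l) lt))
... | no _ | yes _ = ℕ.m≤n⇒m≤1+n (longer-mono as l)
... | no _ | no _ = longer-mono as l

rows-from-short : ∀ b {a} as → b ℕ.< a → rows-from b (longer (a ∷ as)) ≡ rows-from b (longer as)
rows-from-short zero as lt = refl
rows-from-short (suc b) as lt = cong₂ (λ k r → replicate k (suc b) ++ r)
  (cong₂ _∸_ (longer-yes as (ℕ.<-trans (ℕ.n<1+n b) lt)) (longer-yes as lt)) (rows-from-short b as (ℕ.<-trans (ℕ.n<1+n b) lt))

-- A further row of length a adds one to each of the first a columns, so only the difference that
-- counts rows of length a changes.
rows-from-∷ : ∀ b {a} as → 1 ℕ.≤ a → a ℕ.≤ b → rows-from b (longer (a ∷ as)) ↭ a ∷ rows-from b (longer as)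
rows-from-∷ zero as (ℕ.s≤s _) ()
rows-from-∷ (suc b) {a} as 1≤a a≤ with ℕ.m≤n⇒m<n∨m≡n a≤
... | inj₁ (ℕ.s≤s a≤b) = Perm.trans
  (Perm.↭-reflexive (cong (λ k → replicate k (suc b) ++ rows-from b (longer (a ∷ as)))
    (cong₂ _∸_ (longer-no as (ℕ.≤⇒≯ a≤b)) (longer-no as (ℕ.≤⇒≯ (ℕ.m≤n⇒m≤1+n a≤b))))))
  (Perm.trans (Perm.++⁺ˡ r (rows-from-∷ b as 1≤a a≤b)) (Perm.shift a r (rows-from b (longer as))))
  where r = replicate (longer as b ∸ longer as (suc b)) (suc b)
... | inj₂ refl = Perm.↭-reflexive (cong₂ (λ k r → replicate k (suc b) ++ r)
  (trans (cong₂ _∸_ (longer-yes as (ℕ.n<1+n b)) (longer-no as (ℕ.<-irrefl refl))) (ℕ.+-∸-assoc 1 (longer-mono as b)))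
  (rows-from-short b as (ℕ.n<1+n b)))

rows-from-longer : ∀ b as → All (λ a → 1 ℕ.≤ a × a ℕ.≤ b) as → rows-from b (longer as) ↭ as
rows-from-longer b [] _ = Perm.↭-reflexive (none b)
  where
  none : ∀ b → rows-from b (longer []) ≡ []
  none zero = refl
  none (suc b) = none b
rows-from-longer b (a ∷ as) ((1≤a , a≤b) All.∷ h) = Perm.trans (rows-from-∷ b as 1≤a a≤b) (Perm.prep a (rows-from-longer b as h))

module Columns (n : ℕ) where

  multiplicity : List ℕ → ℕ → ℕ
  multiplicity acc l = countB (λ s → ⌊ s ℕ.≟ l ⌋) acc

  rows : List ℕ → List ℕ
  rows acc = rows-from n (multiplicity acc)

  add-row : ℕ → ℕ → List ℕ → List ℕ
  add-row i zero acc = acc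
  add-row i (suc b) acc = add-row (suc i) b (i ∷ acc)

  add-rows : List ℕ → List ℕ → List ℕ
  add-rows [] acc = acc
  add-rows (a ∷ as) acc = add-rows as (add-row 0 a acc)

  length-add-rows : ∀ as acc → length (add-rows as acc) ≡ sum as ℕ.+ length acc
  length-add-rows [] acc = refl
  length-add-rows (a ∷ as) acc = trans (length-add-rows as (add-row 0 a acc))
    (trans (cong (sum as ℕ.+_) (length-add-row 0 a acc)) (lemma (sum as) a (length acc)))
    where
    length-add-row : ∀ i b acc → length (add-row i b acc) ≡ b ℕ.+ length acc
    length-add-row i zero acc = refl
    length-add-row i (suc b) acc = trans (length-add-row (suc i) b (i ∷ acc)) (ℕ.+-suc b (length acc))
    lemma : ∀ s a l → s ℕ.+ (a ℕ.+ l) ≡ a ℕ.+ s ℕ.+ l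
    lemma = NatSolver.solve-∀

  multiplicity-here : ∀ l acc → multiplicity (l ∷ acc) l ≡ suc (multiplicity acc l)
  multiplicity-here l acc with l ℕ.≟ l
  ... | yes _ = refl
  ... | no ≢ = ⊥-elim (≢ refl)

  multiplicity-there : ∀ {i l} acc → i ≢ l → multiplicity (i ∷ acc) l ≡ multiplicity acc l
  multiplicity-there {i} {l} acc i≢l with i ℕ.≟ l
  ... | yes eq = ⊥-elim (i≢l eq)
  ... | no _ = refl

  multiplicity-out : ∀ i b acc l → l ℕ.< i ⊎ i ℕ.+ b ℕ.≤ l → multiplicity (add-row i b acc) l ≡ multiplicity acc l
  multiplicity-out i zero acc l h = refl
  multiplicity-out i (suc b) acc l (inj₁ l<i) = trans (multiplicity-out (suc i) b (i ∷ acc) l (inj₁ (ℕ.m<n⇒m<1+n l<i)))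
    (multiplicity-there acc (ℕ.<⇒≢ l<i ∘ sym))
  multiplicity-out i (suc b) acc l (inj₂ le) = trans (multiplicity-out (suc i) b (i ∷ acc) l (inj₂ le′))
    (multiplicity-there acc (ℕ.<⇒≢ (ℕ.≤-trans (ℕ.s≤s (ℕ.m≤m+n i b)) le′)))
    where
    le′ : suc i ℕ.+ b ℕ.≤ l
    le′ = subst (ℕ._≤ l) (ℕ.+-suc i b) le

  multiplicity-in : ∀ i b acc l → i ℕ.≤ l → l ℕ.< i ℕ.+ b → multiplicity (add-row i b acc) l ≡ suc (multiplicity acc l)
  multiplicity-in i zero acc l i≤l l< = ⊥-elim (ℕ.<⇒≱ l< (subst (ℕ._≤ l) (sym (ℕ.+-identityʳ i)) i≤l))
  multiplicity-in i (suc b) acc l i≤l l< with ℕ.m≤n⇒m<n∨m≡n i≤l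
  ... | inj₁ i<l = trans (multiplicity-in (suc i) b (i ∷ acc) l i<l (subst (l ℕ.<_) (ℕ.+-suc i b) l<))
    (cong suc (multiplicity-there acc (ℕ.<⇒≢ i<l)))
  ... | inj₂ refl = trans (multiplicity-out (suc i) b (i ∷ acc) l (inj₁ (ℕ.n<1+n i))) (multiplicity-here l acc)

  multiplicity-add-rows : ∀ as acc l → multiplicity (add-rows as acc) l ≡ longer as l ℕ.+ multiplicity acc l
  multiplicity-add-rows [] acc l = refl
  multiplicity-add-rows (a ∷ as) acc l with l ℕ.<? a
  ... | yes l<a = trans (multiplicity-add-rows as (add-row 0 a acc) l)
    (trans (cong (longer as l ℕ.+_) (multiplicity-in 0 a acc l ℕ.z≤n l<a)) (ℕ.+-suc (longer as l) (multiplicity acc l)))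
  ... | no l≮a = trans (multiplicity-add-rows as (add-row 0 a acc) l)
    (cong (longer as l ℕ.+_) (multiplicity-out 0 a acc l (inj₂ (ℕ.≮⇒≥ l≮a))))

  rows-add-rows : ∀ as → All (λ a → 1 ℕ.≤ a × a ℕ.≤ n) as → rows (add-rows as []) ↭ as
  rows-add-rows as h = Perm.trans (Perm.↭-reflexive (rows-from-cong n
      (λ l → trans (multiplicity-add-rows as [] l) (ℕ.+-identityʳ (longer as l)))))
    (rows-from-longer n as h)

  ∑-single : ∀ {A : Set} (xs : List A) (f : A → ℚ) i → Unique xs → i ∈ xs → (∀ x → x ≢ i → f x ≡ 0ℚ) → ∑ xs f ≡ f i
  ∑-single (x ∷ xs) f i (x∉ AllPairs.∷ uq) (here refl) h = trans (cong (f i +_)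
    (trans (∑-cong-∈ xs (λ {y} y∈ → h y (λ y≡ → All.lookup x∉ y∈ (sym y≡)))) (∑-0 xs (λ _ → refl)))) (ℚ.+-identityʳ (f i))
  ∑-single (x ∷ xs) f i (x∉ AllPairs.∷ uq) (there i∈) h =
    trans (cong₂ _+_ (h x (All.lookup x∉ i∈)) (∑-single xs f i uq i∈ h)) (ℚ.+-identityˡ (f i))

  length-firstColumns : ∀ i → length (firstColumns i) ≡ i
  length-firstColumns zero = refl
  length-firstColumns (suc i) = trans (length-++ (firstColumns i))
      (trans (ℕ.+-comm (length (firstColumns i)) 1) (cong suc (length-firstColumns i)))

  module _ (T : List ℕ → ℚ) where
    open Process (upTo n) μ T using (value)

    -- While a clique arrives, the queue holds columns 0, ..., i - 1, where `μ` is concentrated at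
    -- i: the process writes one full row.
    value-row : ∀ w i b acc → i ℕ.+ b ℕ.≤ n →
      value (u^ b ++ d^ (i ℕ.+ b) ++ w) (firstColumns i) acc ≡ value w [] (add-row i b acc)
    value-row w i zero acc le = trans
      (cong (λ l → value (d^ l ++ w) (firstColumns i) acc) (trans (ℕ.+-identityʳ i) (sym (length-firstColumns i))))
      (value-d^ (upTo n) μ T w (firstColumns i) acc)
    value-row w i (suc b) acc le = begin
      ∑ (upTo n) f    ≡⟨ ∑-single (upTo n) f i (Unique.upTo⁺ n) (∈-upTo⁺ (ℕ.≤-trans (ℕ.m≤m+n (suc i) b) le′)) off ⟩
      μ (firstColumns i) i * v i
                      ≡⟨ cong (_* v i) (μ-firstColumns i) ⟩
      1ℚ * v i        ≡⟨ ℚ.*-identityˡ (v i) ⟩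
      v i             ≡⟨ cong (λ l → value (u^ b ++ d^ l ++ w) (firstColumns (suc i)) (i ∷ acc)) (ℕ.+-suc i b) ⟩
      value (u^ b ++ d^ (suc i ℕ.+ b) ++ w) (firstColumns (suc i)) (i ∷ acc)
                      ≡⟨ value-row w (suc i) b (i ∷ acc) le′ ⟩
      value w [] (add-row (suc i) b (i ∷ acc)) ∎
      where
      v f : ℕ → ℚ
      v z = value (u^ b ++ d^ (i ℕ.+ suc b) ++ w) (firstColumns i ++ [ z ]) (z ∷ acc)
      f z = μ (firstColumns i) z * v z
      le′ : suc i ℕ.+ b ℕ.≤ n
      le′ = subst (ℕ._≤ n) (ℕ.+-suc i b) le
      off : ∀ z → z ≢ i → f z ≡ 0ℚ
      off z z≢i = zero-*ˡ (v z) (μ-firstColumns-≢ i z z≢i)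

    value-rows : ∀ as acc → All (λ a → 1 ℕ.≤ a × a ℕ.≤ n) as → value (blocks-word as) [] acc ≡ T (add-rows as acc)
    value-rows [] acc h = refl
    value-rows (a ∷ as) acc ((_ , a≤n) All.∷ h) = trans
        (value-row (blocks-word as) 0 a acc a≤n) (value-rows as (add-row 0 a acc) h)

-- Comparison of proper colourings with the process

μ-kernel : Kernel μ
μ-kernel = record { ρ-↭ = μ-↭ ; fresh = μ-fresh ; exchange₁ = μ-exchange₁ ; exchange₂ = λ {C₀} → μ-exchange₂ {C₀} }

Modular-- : ∀ {D E : Word → ℚ} → Modular D → Modular E → Modular (λ w → D w - E w)
Modular-- {D} {E} MD ME = record
  { law₁ = λ A B C eq → combine (D (A ++ udu ++ B ++ dd ++ C)) (D (A ++ duu ++ B ++ dd ++ C)) (D (A ++ uud ++ B ++ dd ++ C))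
      (E (A ++ udu ++ B ++ dd ++ C)) (E (A ++ duu ++ B ++ dd ++ C)) (E (A ++ uud ++ B ++ dd ++ C))
      (Modular.law₁ MD A B C eq) (Modular.law₁ ME A B C eq)
  ; law₂ = λ A C t → combine (D (A ++ dud ++ C)) (D (A ++ ddu ++ C)) (D (A ++ udd ++ C))
      (E (A ++ dud ++ C)) (E (A ++ ddu ++ C)) (E (A ++ udd ++ C))
      (Modular.law₂ MD A C t) (Modular.law₂ ME A C t)
  }
  where
  combine : ∀ x y z x′ y′ z′ → x + x ≡ y + z → x′ + x′ ≡ y′ + z′ → (x - x′) + (x - x′) ≡ (y - y′) + (z - z′)
  combine x y z x′ y′ z′ h h′ = trans (lemma x x′) (trans (cong₂ _-_ h h′) (lemma′ y z y′ z′))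
    where
    lemma : ∀ x x′ → (x - x′) + (x - x′) ≡ (x + x) - (x′ + x′)
    lemma = solve-∀ ℚ-ring
    lemma′ : ∀ y z y′ z′ → (y + z) - (y′ + z′) ≡ (y - y′) + (z - z′)
    lemma′ = solve-∀ ℚ-ring

blocks-word-∷ʳ : ∀ as a → blocks-word (as ++ [ a ]) ≡ blocks-word as ++ u^ a ++ d^ a
blocks-word-∷ʳ [] a = cong (u^ a ++_) (++-identityʳ (d^ a))
blocks-word-∷ʳ (b ∷ as) a = trans (cong (λ w → u^ b ++ d^ b ++ w) (blocks-word-∷ʳ as a))
  (sym (trans (++-assoc (u^ b) (d^ b ++ blocks-word as) (u^ a ++ d^ a))
      (cong (u^ b ++_) (++-assoc (d^ b) (blocks-word as) (u^ a ++ d^ a)))))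

CliqueUnion-blocks : ∀ {K} → CliqueUnion K → ∃ λ as → K ≡ blocks-word as × All (1 ℕ.≤_) as
CliqueUnion-blocks empty = [] , refl , All.[]
CliqueUnion-blocks (_▹_ {K} K∪ a) with CliqueUnion-blocks K∪
... | as , refl , pos with a
...   | zero = as , ++-identityʳ (blocks-word as) , pos
...   | suc a′ = as ++ [ suc a′ ] , sym (blocks-word-∷ʳ as (suc a′)) , All.++⁺ pos (ℕ.s≤s ℕ.z≤n All.∷ All.[])

#u-blocks-word : ∀ as → #u (blocks-word as) ≡ sum as
#u-blocks-word [] = refl
#u-blocks-word (a ∷ as) = trans (#u-++ (u^ a) (d^ a ++ blocks-word as))
  (cong₂ ℕ._+_ (#u-u^ a) (trans (#u-++ (d^ a) (blocks-word as))
      (trans (cong (ℕ._+ #u (blocks-word as)) (#u-d^ a)) (#u-blocks-word as))))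

All-≤-sum : ∀ as → All (ℕ._≤ sum as) as
All-≤-sum [] = All.[]
All-≤-sum (a ∷ as) = ℕ.m≤m+n a (sum as) All.∷ All.map (λ le → ℕ.≤-trans le (ℕ.m≤n+m (sum as) a)) (All-≤-sum as)

module Hikita (n N : ℕ) (α : Vec ℕ N) where
  open Colouring N using (χ; χ-kernel)
  open Monomial n N α
  open Columns n

  -- An outcome with rows λ counts as the coefficient of x^α in λ₁! e_λ₁ ⋯ λ_ℓ! e_λ_ℓ, so that the
  -- value of the process is the claimed expansion.
  shape-value : List ℕ → ℚ
  shape-value acc = indicator ⌊ length acc ℕ.≟ n ⌋ * clique-coefficient (rows acc)

  shape-value-↭ : ∀ {a b} → a ↭ b → shape-value a ≡ shape-value b
  shape-value-↭ p = cong₂ (λ l r → indicator ⌊ l ℕ.≟ n ⌋ * clique-coefficient r) (Perm.↭-length p)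
    (rows-from-cong n (λ l → countB-↭ (λ s → ⌊ s ℕ.≟ l ⌋) p))

  shape-value-length : ∀ acc → length acc ≢ n → shape-value acc ≡ 0ℚ
  shape-value-length acc ≢n = zero-*ˡ (clique-coefficient (rows acc)) (indicator-no (length acc ℕ.≟ n) ≢n)

  -- The laws hold over any finite list of symbols; n columns suffice for the rows of clique unions
  -- with n vertices.
  open Process (upTo n) μ shape-value public using () renaming (value to tableau-value)

  difference : Word → ℚ
  difference w = coloured w [] [] - tableau-value w [] []

  difference-modular : Modular difference
  difference-modular = Modular-- (Process.modular (allFin N) χ content-test χ-kernel content-test-↭)
    (Process.modular (upTo n) μ shape-value μ-kernel shape-value-↭)

  difference-base : ∀ {K} → CliqueUnion K → difference K ≡ 0ℚ
  difference-base K∪ with CliqueUnion-blocks K∪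
  ... | as , refl , pos with sum as ℕ.≟ n
  ...   | no ≢n = cong₂ _-_
    (value-length (allFin N) χ content-test content-test-length (blocks-word as) [] [] wrong)
    (value-length (upTo n) μ shape-value shape-value-length (blocks-word as) [] [] wrong)
    where
    wrong : #u (blocks-word as) ℕ.+ 0 ≢ n
    wrong eq = ≢n (trans (sym (#u-blocks-word as)) (trans (sym (ℕ.+-identityʳ (#u (blocks-word as)))) eq))
  ...   | yes eq = trans (cong₂ _-_ (coloured-blocks as) (trans (value-rows shape-value as [] bounds) shape))
      (ℚ.+-inverseʳ (clique-coefficient as))
    where
    bounds : All (λ a → 1 ℕ.≤ a × a ℕ.≤ n) as
    bounds = All.zip (pos , subst (λ n → All (ℕ._≤ n) as) eq (All-≤-sum as))
    shape : shape-value (add-rows as []) ≡ clique-coefficient as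
    shape = trans (cong₂ _*_ (indicator-yes (length (add-rows as []) ℕ.≟ n)
        (trans (length-add-rows as []) (trans (ℕ.+-identityʳ (sum as)) eq)))
        (clique-coefficient-↭ (rows-add-rows as bounds)))
      (ℚ.*-identityˡ (clique-coefficient as))

  coloured≡tableau-value : ∀ {w} → Dyck 0 w → coloured w [] [] ≡ tableau-value w [] []
  coloured≡tableau-value {w} dy = difference-0
    (modular-determined difference-modular difference-base (length w) w ℕ.≤-refl empty dy)

-- The expansion with rational coefficients

E-sum : List (ℚ × List ℕ) → (List ℕ → ℚ) → ℚ
E-sum L F = ∑ L (λ t → proj₁ t * F (proj₂ t))

evaluate : List (ℚ × List ℕ) → (N : ℕ) → Vec ℕ N → ℚ
evaluate L N α = E-sum L (λ κ → ι (coeffE N κ α))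

module Terms (n : ℕ) where
  open Columns n

  -- The outcomes with their probabilities, as a list that depends on neither N nor α: one expansion
  -- has to serve all numbers of variables and all monomials.
  terms : Word → List ℕ → List ℕ → List (ℚ × List ℕ)
  terms [] q acc = [ 1ℚ , acc ]
  terms (u ∷ w) q acc = concatMap (λ z → map (λ t → μ q z * proj₁ t , proj₂ t) (terms w (q ++ [ z ]) (z ∷ acc))) (upTo n)
  terms (d ∷ w) [] acc = []
  terms (d ∷ w) (_ ∷ q) acc = terms w q acc

  value-terms : ∀ T w q acc → Process.value (upTo n) μ T w q acc ≡ E-sum (terms w q acc) T
  value-terms T [] q acc = lemma (T acc)
    where
    lemma : ∀ x → x ≡ 1ℚ * x + 0ℚ
    lemma = solve-∀ ℚ-ring
  value-terms T (u ∷ w) q acc = trans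
    (∑-cong (upTo n) (λ z → trans (cong (μ q z *_) (value-terms T w (q ++ [ z ]) (z ∷ acc)))
      (trans (∑-* (rest z) (μ q z) (λ t → proj₁ t * T (proj₂ t)))
        (trans (∑-cong (rest z) (λ t → sym (ℚ.*-assoc (μ q z) (proj₁ t) (T (proj₂ t)))))
          (sym (∑-map (λ t → μ q z * proj₁ t , proj₂ t) (rest z) (λ t → proj₁ t * T (proj₂ t))))))))
    (sym (∑-concatMap (λ z → map (λ t → μ q z * proj₁ t , proj₂ t) (rest z)) (upTo n) (λ t → proj₁ t * T (proj₂ t))))
    where
    rest : ℕ → List (ℚ × List ℕ)
    rest z = terms w (q ++ [ z ]) (z ∷ acc)
  value-terms T (d ∷ w) [] acc = refl
  value-terms T (d ∷ w) (_ ∷ q) acc = value-terms T w q acc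

  terms-nonneg : ∀ w q acc → All (λ t → 0ℚ ℚ.≤ proj₁ t) (terms w q acc)
  terms-nonneg [] q acc = 0≤1 All.∷ All.[]
  terms-nonneg (u ∷ w) q acc = All.concat⁺ (All.map⁺ {xs = upTo n} (All.tabulate (λ {z} _ →
    All.map⁺ (All.map (λ 0≤r → *-nonneg (μ-nonneg q z) 0≤r) (terms-nonneg w (q ++ [ z ]) (z ∷ acc))))))
  terms-nonneg (d ∷ w) [] acc = All.[]
  terms-nonneg (d ∷ w) (_ ∷ q) acc = terms-nonneg w q acc

  rows-from-partition : ∀ l m → All (λ k → 1 ℕ.≤ k × k ℕ.≤ l) (rows-from l m) × Linked ℕ._≥_ (rows-from l m)
  rows-from-partition zero m = All.[] , Linked.[]
  rows-from-partition (suc l) m with rows-from-partition l m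
  ... | bounds , linked = All.++⁺ (All.replicate⁺ k (ℕ.s≤s ℕ.z≤n , ℕ.≤-refl)) bounds′ , replicate-linked k
    where
    k = m l ∸ m (suc l)
    bounds′ : All (λ k → 1 ℕ.≤ k × k ℕ.≤ suc l) (rows-from l m)
    bounds′ = All.map (λ { (p , q) → p , ℕ.m≤n⇒m≤1+n q }) bounds
    cons-linked : ∀ xs → All (λ k → 1 ℕ.≤ k × k ℕ.≤ suc l) xs → Linked ℕ._≥_ xs → Linked ℕ._≥_ (suc l ∷ xs)
    cons-linked [] _ _ = Linked.[-]
    cons-linked (x ∷ xs) ((_ , le) All.∷ _) lk = le Linked.∷ lk
    replicate-linked : ∀ k → Linked ℕ._≥_ (replicate k (suc l) ++ rows-from l m)
    replicate-linked zero = linked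
    replicate-linked (suc k) = cons-linked (replicate k (suc l) ++ rows-from l m)
      (All.++⁺ (All.replicate⁺ k (ℕ.s≤s ℕ.z≤n , ℕ.≤-refl)) bounds′) (replicate-linked k)

  -- Row lengths come from truncated differences, so columns that do not form a Young diagram may
  -- give rows of the wrong total. Such entries are dropped; `clique-coefficient-sum` shows that
  -- they contribute 0.
  shapes : List (ℚ × List ℕ) → List (ℚ × List ℕ)
  shapes [] = []
  shapes ((r , c) ∷ ts) with length c ℕ.≟ n | sum (rows c) ℕ.≟ n
  ... | yes _ | yes _ = (r * ι (factorial-product (rows c)) , rows c) ∷ shapes ts
  ... | _ | _ = shapes ts

  shapes-partition : ∀ ts → All (λ t → IsPartition n (proj₂ t)) (shapes ts)
  shapes-partition [] = All.[]
  shapes-partition ((r , c) ∷ ts) with length c ℕ.≟ n | sum (rows c) ℕ.≟ n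
  ... | yes _ | yes eq = record { positive = All.map proj₁
      (proj₁ part) ; decreasing = proj₂ part ; sums = eq } All.∷ shapes-partition ts
    where part = rows-from-partition n (multiplicity c)
  ... | yes _ | no _ = shapes-partition ts
  ... | no _ | _ = shapes-partition ts

  shapes-nonneg : ∀ ts → All (λ t → 0ℚ ℚ.≤ proj₁ t) ts → All (λ t → 0ℚ ℚ.≤ proj₁ t) (shapes ts)
  shapes-nonneg [] _ = All.[]
  shapes-nonneg ((r , c) ∷ ts) (0≤r All.∷ h) with length c ℕ.≟ n | sum (rows c) ℕ.≟ n
  ... | yes _ | yes _ = *-nonneg 0≤r (ι-nonneg (factorial-product (rows c))) All.∷ shapes-nonneg ts h
  ... | yes _ | no _ = shapes-nonneg ts h
  ... | no _ | _ = shapes-nonneg ts h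

  module _ (N : ℕ) (α : Vec ℕ N) where
    open Monomial n N α
    open Hikita n N α using (shape-value)

    -- The number is the coloured value of a union of cliques, and the length factor makes that 0
    -- unless there are n vertices.
    clique-coefficient-sum : ∀ as → sum as ≢ n → clique-coefficient as ≡ 0ℚ
    clique-coefficient-sum as ≢n = trans (sym (coloured-blocks as))
      (value-length (allFin N) (Colouring.χ N) content-test content-test-length (blocks-word as) [] []
        (λ eq → ≢n (trans (sym (#u-blocks-word as)) (trans (sym (ℕ.+-identityʳ (#u (blocks-word as)))) eq))))

    shapes-value : ∀ ts → E-sum ts shape-value ≡ evaluate (shapes ts) N α
    shapes-value [] = refl
    shapes-value ((r , c) ∷ ts) with length c ℕ.≟ n | sum (rows c) ℕ.≟ n
    ... | yes _ | yes eq = cong₂ _+_ (trans (cong (λ x → r * (1ℚ * x)) (clique-coefficient-E (rows c) eq))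
        (lemma r (ι (factorial-product (rows c))) (ι (coeffE N (rows c) α)))) (shapes-value ts)
      where
      lemma : ∀ r f e → r * (1ℚ * (f * e)) ≡ r * f * e
      lemma = solve-∀ ℚ-ring
    ... | yes _ | no ≢n = trans (cong₂ _+_ (trans (cong (λ x → r * (1ℚ * x))
        (clique-coefficient-sum (rows c) ≢n)) (ℚ.*-zeroʳ r)) (shapes-value ts))
        (ℚ.+-identityˡ (evaluate (shapes ts) N α))
    ... | no _ | _ = trans (cong₂ _+_ (zero-*ʳ r (ℚ.*-zeroˡ (clique-coefficient (rows c)))) (shapes-value ts))
        (ℚ.+-identityˡ (evaluate (shapes ts) N α))

  expansion : ∀ {w} → Dyck 0 w → ∀ N α →
    Monomial.coloured n N α w [] [] ≡ evaluate (shapes (terms w [] [])) N α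
  expansion {w} dy N α = trans (Hikita.coloured≡tableau-value n N α dy)
    (trans (value-terms (Hikita.shape-value n N α) w [] []) (shapes-value N α (terms w [] [])))

-- Unitriangularity and integrality

-- The lexicographic order; being total, it gives every nonempty finite list of shapes a least one.
data _≼_ : List ℕ → List ℕ → Set where
  nil  : ∀ {ν} → [] ≼ ν
  less : ∀ {k l ks ls} → k ℕ.< l → (k ∷ ks) ≼ (l ∷ ls)
  same : ∀ {k ks ls} → ks ≼ ls → (k ∷ ks) ≼ (k ∷ ls)

≼-refl : ∀ λ′ → λ′ ≼ λ′
≼-refl [] = nil
≼-refl (k ∷ ks) = same (≼-refl ks)

≼-total : ∀ κ ν → κ ≼ ν ⊎ ν ≼ κ
≼-total [] ν = inj₁ nil
≼-total (k ∷ ks) [] = inj₂ nil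
≼-total (k ∷ ks) (l ∷ ls) with ℕ.<-cmp k l
... | tri< k<l _ _ = inj₁ (less k<l)
... | tri> _ _ l<k = inj₂ (less l<k)
... | tri≈ _ refl _ with ≼-total ks ls
...   | inj₁ p = inj₁ (same p)
...   | inj₂ p = inj₂ (same p)

≼-trans : ∀ {κ ν π} → κ ≼ ν → ν ≼ π → κ ≼ π
≼-trans nil q = nil
≼-trans (less p) (less q) = less (ℕ.<-trans p q)
≼-trans (less p) (same q) = less p
≼-trans (same p) (less q) = less q
≼-trans (same p) (same q) = same (≼-trans p q)

≼-antisym : ∀ {κ ν} → κ ≼ ν → ν ≼ κ → κ ≡ ν
≼-antisym nil nil = refl
≼-antisym (less p) (less q) = ⊥-elim (ℕ.<-asym p q)
≼-antisym (less p) (same q) = ⊥-elim (ℕ.<-irrefl refl p)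
≼-antisym (same p) (less q) = ⊥-elim (ℕ.<-irrefl refl q)
≼-antisym (same p) (same q) = cong (_ ∷_) (≼-antisym p q)

allB-true : ∀ {A : Set} (p : A → Bool) (xs : List A) → allB p xs ≡ true → ∀ {x} → x ∈ xs → p x ≡ true
allB-true p (x ∷ xs) eq (here refl) with p x
... | true = refl
allB-true p (x ∷ xs) eq (there x∈) with p x
... | true = allB-true p xs eq x∈

true-allB : ∀ {A : Set} (p : A → Bool) (xs : List A) → (∀ {x} → x ∈ xs → p x ≡ true) → allB p xs ≡ true
true-allB p [] h = refl
true-allB p (x ∷ xs) h = cong₂ _∧_ (h (here refl)) (true-allB p xs (h ∘ there))

⌊⌋-true : ∀ {P : Set} (P? : Dec P) → ⌊ P? ⌋ ≡ true → P
⌊⌋-true (yes p) _ = p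

true-⌊⌋ : ∀ {P : Set} (P? : Dec P) → P → ⌊ P? ⌋ ≡ true
true-⌊⌋ (yes _) _ = refl
true-⌊⌋ (no ¬p) p = ⊥-elim (¬p p)

countB-zero : ∀ {A : Set} (p : A → Bool) (xs : List A) → (∀ {x} → x ∈ xs → p x ≢ true) → countB p xs ≡ 0
countB-zero p [] h = refl
countB-zero p (x ∷ xs) h with p x in eq
... | true = ⊥-elim (h (here refl) eq)
... | false = countB-zero p xs (h ∘ there)

longer-head : ∀ l ls → Linked ℕ._≥_ (l ∷ ls) → ∀ c → longer (l ∷ ls) c ≢ 0 → c ℕ.< l
longer-head l ls lk c ≢0 with c ℕ.<? l
... | yes c<l = c<l
longer-head l [] lk c ≢0 | no _ = ⊥-elim (≢0 refl)
longer-head l (k ∷ ls) (k≤l Linked.∷ lk) c ≢0 | no c≮l = ⊥-elim (c≮l (ℕ.<-≤-trans (longer-head k ls lk c ≢0) k≤l))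

module Unitriangular (N : ℕ) where
  open Colouring N using (size; bools; has-size; ∑-bool-vectors)

  covers : Fin N → List (Vec Bool N) → ℕ
  covers c T = countB (λ S → lookup S c) T

  fits : List ℕ → List (Vec Bool N) → Bool
  fits ν T = allB (λ c → ⌊ covers c T ℕ.≟ longer ν (toℕ c) ⌋) (allFin N)

  fits-covers : ∀ ν T → fits ν T ≡ true → ∀ c → covers c T ≡ longer ν (toℕ c)
  fits-covers ν T eq c = ⌊⌋-true (covers c T ℕ.≟ longer ν (toℕ c))
    (allB-true (λ c → ⌊ covers c T ℕ.≟ longer ν (toℕ c) ⌋) (allFin N) eq (∈-allFin c))

  Within : ∀ {m} → ℕ → Vec Bool m → Set
  Within l S = ∀ c → lookup S c ≡ true → toℕ c ℕ.< l

  initial : ∀ m → ℕ → Vec Bool m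
  initial zero l = []
  initial (suc m) zero = false ∷ initial m zero
  initial (suc m) (suc l) = true ∷ initial m l

  size-initial : ∀ m l → l ℕ.≤ m → size (initial m l) ≡ l
  size-initial zero zero _ = refl
  size-initial (suc m) zero _ = size-initial m zero ℕ.z≤n
  size-initial (suc m) (suc l) (ℕ.s≤s le) = cong suc (size-initial m l le)

  lookup-initial : ∀ m l (c : Fin m) → lookup (initial m l) c ≡ ⌊ toℕ c ℕ.<? l ⌋
  lookup-initial (suc m) zero zero = refl
  lookup-initial (suc m) zero (suc c) = trans (lookup-initial m zero c) refl
  lookup-initial (suc m) (suc l) zero = refl
  lookup-initial (suc m) (suc l) (suc c) with toℕ c ℕ.<? l | suc (toℕ c) ℕ.<? suc l | lookup-initial m l c
  ... | yes _ | yes _ | eq = eq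
  ... | no _ | no _ | eq = eq
  ... | yes p | no ¬q | _ = ⊥-elim (¬q (ℕ.s≤s p))
  ... | no ¬p | yes (ℕ.s≤s q) | _ = ⊥-elim (¬p q)

  Within-tail : ∀ {m l b} {S : Vec Bool m} → Within (suc l) (b ∷ S) → Within l S
  Within-tail w c eq = ℕ.≤-pred (w (suc c) eq)

  size-within : ∀ {m} l (S : Vec Bool m) → Within l S → size S ℕ.≤ l
  size-within l [] w = ℕ.z≤n
  size-within zero (true ∷ S) w = case w zero refl of λ ()
  size-within zero (false ∷ S) w = size-within zero S (λ c eq → case w (suc c) eq of λ ())
  size-within (suc l) (true ∷ S) w = ℕ.s≤s (size-within l S (Within-tail w))
  size-within (suc l) (false ∷ S) w = ℕ.m≤n⇒m≤1+n (size-within l S (Within-tail w))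

  initial-unique : ∀ {m} l (S : Vec Bool m) → Within l S → size S ≡ l → S ≡ initial m l
  initial-unique l [] w eq = refl
  initial-unique zero (true ∷ S) w eq = case w zero refl of λ ()
  initial-unique zero (false ∷ S) w eq = cong (false ∷_) (initial-unique zero S (λ c e → case w (suc c) e of λ ()) eq)
  initial-unique (suc l) (true ∷ S) w eq = cong (true ∷_) (initial-unique l S (Within-tail w) (ℕ.suc-injective eq))
  initial-unique (suc l) (false ∷ S) w eq = ⊥-elim (ℕ.<⇒≱ (ℕ.≤-reflexive (sym eq)) (size-within l S (Within-tail w)))

  fits-within : ∀ l ls S T → Linked ℕ._≥_ (l ∷ ls) → (∀ c → covers c (S ∷ T) ≡ longer (l ∷ ls) (toℕ c)) → Within l S
  fits-within l ls S T lk cov c eq = longer-head l ls lk (toℕ c) (λ zero′ → ℕ.1+n≢0 (begin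
    suc (covers c T)                                  ≡⟨ cong (λ b → (if b then 1 else 0) ℕ.+ covers c T) (sym eq) ⟩
    (if lookup S c then 1 else 0) ℕ.+ covers c T      ≡⟨ cov c ⟩
    longer (l ∷ ls) (toℕ c)                           ≡⟨ zero′ ⟩
    0                                                 ∎))

  covers-tail : ∀ l ls T c → covers c (initial N l ∷ T) ≡ longer (l ∷ ls) (toℕ c) → covers c T ≡ longer ls (toℕ c)
  covers-tail l ls T c eq = ℕ.+-cancelˡ-≡ (if ⌊ toℕ c ℕ.<? l ⌋ then 1 else 0) (covers c T) (longer ls (toℕ c))
    (trans (cong (λ b → (if b then 1 else 0) ℕ.+ covers c T) (sym (lookup-initial N l c))) eq)

  covers-cons : ∀ l ls T c → covers c T ≡ longer ls (toℕ c) → covers c (initial N l ∷ T) ≡ longer (l ∷ ls) (toℕ c)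
  covers-cons l ls T c eq = cong₂ (λ b x → (if b then 1 else 0) ℕ.+ x) (lookup-initial N l c) eq

  tuple-∷ : ∀ k ks {T} → T ∈ subsetTuples N (k ∷ ks) → ∃₂ λ S T′ → T ≡ S ∷ T′ × size S ≡ k × T′ ∈ subsetTuples N ks
  tuple-∷ k ks T∈ with ∈-concatMap⁻ (λ S → map (S ∷_) (subsetTuples N ks)) {xs = subsetsOfSize N k} T∈
  ... | any with find any
  ...   | S , S∈ , T∈′ with ∈-map⁻ (S ∷_) T∈′
  ...     | T′ , T′∈ , refl = S , T′ , refl , proj₂ (∈-filter⁻ (λ S → size S ℕ.≟ k) {xs = allVecs bools N} S∈) , T′∈

  -- Only the first ν₁ variables have a positive exponent, so the first subset has at most ν₁
  -- elements. If it has exactly ν₁, it is the initial segment, and removing it leaves the same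
  -- question for the tails.
  fits-≼ : ∀ κ ν T → T ∈ subsetTuples N κ → All (1 ℕ.≤_) κ → Linked ℕ._≥_ ν →
    (∀ c → covers c T ≡ longer ν (toℕ c)) → κ ≼ ν
  fits-≼ [] ν T T∈ pos lk cov = nil
  fits-≼ (k ∷ ks) ν T T∈ (1≤k All.∷ pos) lk cov with tuple-∷ k ks T∈
  fits-≼ (k ∷ ks) [] _ T∈ (1≤k All.∷ pos) lk cov | S , T′ , refl , refl , T′∈ =
    ⊥-elim (ℕ.<⇒≱ 1≤k (size-within 0 S (λ c eq → case trans
        (sym (cong (λ b → (if b then 1 else 0) ℕ.+ covers c T′) eq)) (cov c) of λ ())))
  fits-≼ (k ∷ ks) (l ∷ ls) _ T∈ (1≤k All.∷ pos) lk cov | S , T′ , refl , refl , T′∈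
    with ℕ.m≤n⇒m<n∨m≡n (size-within l S (fits-within l ls S T′ lk cov))
  ... | inj₁ k<l = less k<l
  ... | inj₂ refl = same (fits-≼ ks ls T′ T′∈ pos (Linked.tail lk) (λ c → covers-tail l ls T′ c
    (trans (cong (λ S → covers c (S ∷ T′)) (sym (initial-unique l S (fits-within l ls S T′ lk cov) refl))) (cov c))))

  conjugate : List ℕ → Vec ℕ N
  conjugate ν = Vec.tabulate (λ c → longer ν (toℕ c))

  coeffE-fits : ∀ κ ν → coeffE N κ (conjugate ν) ≡ countB (fits ν) (subsetTuples N κ)
  coeffE-fits κ ν = countB-cong (subsetTuples N κ) (λ T → allB-cong (allFin N) (λ c →
    cong (λ k → ⌊ covers c T ℕ.≟ k ⌋) (Vec.lookup∘tabulate (λ c → longer ν (toℕ c)) c)))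
    where
    countB-cong : ∀ {A : Set} {p q : A → Bool} (xs : List A) → (∀ x → p x ≡ q x) → countB p xs ≡ countB q xs
    countB-cong [] h = refl
    countB-cong (x ∷ xs) h = cong₂ (λ b n → (if b then 1 else 0) ℕ.+ n) (h x) (countB-cong xs h)

  coeffE-conjugate-0 : ∀ κ ν → All (1 ℕ.≤_) κ → Linked ℕ._≥_ ν → ¬ κ ≼ ν → coeffE N κ (conjugate ν) ≡ 0
  coeffE-conjugate-0 κ ν pos lk κ⋠ν = trans (coeffE-fits κ ν)
    (countB-zero (fits ν) (subsetTuples N κ) (λ {T} T∈ eq → κ⋠ν (fits-≼ κ ν T T∈ pos lk (fits-covers ν T eq))))

  ∑-vector-single : ∀ m (f : Vec Bool m → ℚ) S₀ → (∀ S → S ≢ S₀ → f S ≡ 0ℚ) → ∑ (allVecs bools m) f ≡ f S₀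
  ∑-vector-single zero f [] h = ℚ.+-identityʳ (f [])
  ∑-vector-single (suc m) f (true ∷ S₀) h = trans (∑-bool-vectors m f)
    (trans (cong₂ _+_ (∑-vector-single m (λ S → f (true ∷ S)) S₀ (λ S ≢ → h (true ∷ S) (≢ ∘ Vec.∷-injectiveʳ)))
      (∑-0 (allVecs bools m) (λ S → h (false ∷ S) (λ ())))) (ℚ.+-identityʳ (f (true ∷ S₀))))
  ∑-vector-single (suc m) f (false ∷ S₀) h = trans (∑-bool-vectors m f)
    (trans (cong₂ _+_ (∑-0 (allVecs bools m) (λ S → h (true ∷ S) (λ ())))
      (∑-vector-single m (λ S → f (false ∷ S)) S₀ (λ S ≢ → h (false ∷ S) (≢ ∘ Vec.∷-injectiveʳ))))
          (ℚ.+-identityˡ (f (false ∷ S₀))))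

  fits-initial : ∀ l ls T → fits (l ∷ ls) (initial N l ∷ T) ≡ fits ls T
  fits-initial l ls T = Bool.⇔→≡ (mk⇔
    (λ eq → true-allB (λ c → ⌊ covers c T ℕ.≟ longer ls (toℕ c) ⌋) (allFin N) (λ {c} _ →
      true-⌊⌋ (covers c T ℕ.≟ longer ls (toℕ c)) (covers-tail l ls T c (fits-covers (l ∷ ls) (initial N l ∷ T) eq c))))
    (λ eq → true-allB (λ c → ⌊ covers c (initial N l ∷ T) ℕ.≟ longer (l ∷ ls) (toℕ c) ⌋) (allFin N) (λ {c} _ →
      true-⌊⌋ (covers c (initial N l ∷ T) ℕ.≟ longer (l ∷ ls) (toℕ c)) (covers-cons l ls T c (fits-covers ls T eq c)))))

  -- Every subset of a fitting tuple is forced to be an initial segment; one of size l exists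
  -- because l ≤ N.
  fits-count-1 : ∀ ν → Linked ℕ._≥_ ν → All (ℕ._≤ N) ν → ∑ (subsetTuples N ν) (indicator ∘ fits ν) ≡ 1ℚ
  fits-count-1 [] lk le = cong (λ b → indicator b + 0ℚ)
    (true-allB (λ c → ⌊ covers c [] ℕ.≟ longer [] (toℕ c) ⌋) (allFin N)
        (λ {c} _ → true-⌊⌋ (covers c [] ℕ.≟ longer [] (toℕ c)) refl))
  fits-count-1 (l ∷ ls) lk (l≤N All.∷ le) = begin
    ∑ (subsetTuples N (l ∷ ls)) (indicator ∘ fits (l ∷ ls))
      ≡⟨ ∑-concatMap (λ S → map (S ∷_) (subsetTuples N ls)) (subsetsOfSize N l) (indicator ∘ fits (l ∷ ls)) ⟩
    ∑ (subsetsOfSize N l) (λ S → ∑ (map (S ∷_) (subsetTuples N ls)) (indicator ∘ fits (l ∷ ls)))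
      ≡⟨ ∑-cong (subsetsOfSize N l) (λ S → ∑-map (S ∷_) (subsetTuples N ls) (indicator ∘ fits (l ∷ ls))) ⟩
    ∑ (subsetsOfSize N l) f
      ≡⟨ ∑-filter (λ S → size S ℕ.≟ l) (allVecs bools N) f ⟩
    ∑ (allVecs bools N) (λ S → has-size l S * f S)
      ≡⟨ ∑-vector-single N (λ S → has-size l S * f S) (initial N l) others ⟩
    has-size l (initial N l) * f (initial N l)
      ≡⟨ cong₂ _*_ (indicator-yes (size (initial N l) ℕ.≟ l) (size-initial N l l≤N))
           (∑-cong (subsetTuples N ls) (λ T → cong indicator (fits-initial l ls T))) ⟩
    1ℚ * ∑ (subsetTuples N ls) (indicator ∘ fits ls)
      ≡⟨ cong (1ℚ *_) (fits-count-1 ls (Linked.tail lk) le) ⟩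
    1ℚ * 1ℚ ≡⟨⟩
    1ℚ ∎
    where
    f : Vec Bool N → ℚ
    f S = ∑ (subsetTuples N ls) (λ T → indicator (fits (l ∷ ls) (S ∷ T)))
    unfit : ∀ S T → S ≢ initial N l → size S ≡ l → indicator (fits (l ∷ ls) (S ∷ T)) ≡ 0ℚ
    unfit S T S≢ sz with fits (l ∷ ls) (S ∷ T) in eq
    ... | false = refl
    ... | true = ⊥-elim (S≢ (initial-unique l S (fits-within l ls S T lk (fits-covers (l ∷ ls) (S ∷ T) eq)) sz))
    others : ∀ S → S ≢ initial N l → has-size l S * f S ≡ 0ℚ
    others S S≢ with size S ℕ.≟ l
    ... | yes sz = trans (ℚ.*-identityˡ (f S)) (∑-0 (subsetTuples N ls) (λ T → unfit S T S≢ sz))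
    ... | no _ = ℚ.*-zeroˡ (f S)

  coeffE-conjugate-1 : ∀ ν → Linked ℕ._≥_ ν → All (ℕ._≤ N) ν → ι (coeffE N ν (conjugate ν)) ≡ 1ℚ
  coeffE-conjugate-1 ν lk le = trans (cong ι (coeffE-fits ν ν))
      (trans (ι-countB (fits ν) (subsetTuples N ν)) (fits-count-1 ν lk le))

IsInteger : ℚ → Set
IsInteger x = ∃₂ λ a b → x ≡ ι a - ι b

nonneg-integer : ∀ {x} → 0ℚ ℚ.≤ x → IsInteger x → ∃ λ m → x ≡ ι m
nonneg-integer 0≤x (a , b , refl) with ℕ.≤-total b a
... | inj₁ b≤a with ℕ.m≤n⇒∃[o]m+o≡n b≤a
...   | k , refl = k , trans (cong (_- ι b) (ι-+ b k)) (cancel (ι b) (ι k))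
  where
  cancel : ∀ b k → (b + k) - b ≡ k
  cancel = solve-∀ ℚ-ring
nonneg-integer 0≤x (a , b , refl) | inj₂ a≤b with ℕ.m≤n⇒∃[o]m+o≡n a≤b
... | k , refl = 0 , ℚ.≤-antisym (subst (ℚ._≤ 0ℚ) (sym value) (ℚ.neg-antimono-≤ (ι-nonneg k))) 0≤x
  where
  cancel : ∀ a k → a - (a + k) ≡ - k
  cancel = solve-∀ ℚ-ring
  value : ι a - ι (a ℕ.+ k) ≡ - ι k
  value = trans (cong (λ x → ι a - x) (ι-+ a k)) (cancel (ι a) (ι k))

_≟ₗ_ : (κ ν : List ℕ) → Dec (κ ≡ ν)
_≟ₗ_ = List.≡-dec ℕ._≟_

coefficient-of : List ℕ → List (ℚ × List ℕ) → ℚ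
coefficient-of ν L = ∑ L (λ t → indicator ⌊ proj₂ t ≟ₗ ν ⌋ * proj₁ t)

remove : List ℕ → List (ℚ × List ℕ) → List (ℚ × List ℕ)
remove ν = filter (λ t → ¬? (proj₂ t ≟ₗ ν))

E-sum-split : ∀ ν L F → E-sum L F ≡ coefficient-of ν L * F ν + E-sum (remove ν L) F
E-sum-split ν [] F = lemma (F ν)
  where
  lemma : ∀ x → 0ℚ ≡ 0ℚ * x + 0ℚ
  lemma = solve-∀ ℚ-ring
E-sum-split ν ((q , κ) ∷ L) F with κ ≟ₗ ν
... | yes refl = trans (cong (q * F ν +_) (E-sum-split ν L F)) (lemma q (F ν) (coefficient-of ν L) (E-sum (remove ν L) F))
  where
  lemma : ∀ q f c r → q * f + (c * f + r) ≡ (1ℚ * q + c) * f + r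
  lemma = solve-∀ ℚ-ring
... | no _ = trans (cong (q * F κ +_) (E-sum-split ν L F)) (lemma q (F κ) (F ν) (coefficient-of ν L) (E-sum (remove ν L) F))
  where
  lemma : ∀ q k f c r → q * k + (c * f + r) ≡ (0ℚ * q + c) * f + (q * k + r)
  lemma = solve-∀ ℚ-ring

coefficient-nonneg : ∀ ν L → All (λ t → 0ℚ ℚ.≤ proj₁ t) L → 0ℚ ℚ.≤ coefficient-of ν L
coefficient-nonneg ν [] h = ℚ.≤-refl
coefficient-nonneg ν ((q , κ) ∷ L) (0≤q All.∷ h) with κ ≟ₗ ν
... | yes _ = +-nonneg (*-nonneg 0≤1 0≤q) (coefficient-nonneg ν L h)
... | no _ = +-nonneg (*-nonneg ℚ.≤-refl 0≤q) (coefficient-nonneg ν L h)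

minimal-shape : ∀ (t : ℚ × List ℕ) L → ∃ λ ν → Any (λ t → proj₂ t ≡ ν) (t ∷ L) × All (λ t → ν ≼ proj₂ t) (t ∷ L)
minimal-shape (q , κ) [] = κ , here refl , ≼-refl κ All.∷ All.[]
minimal-shape (q , κ) (t ∷ L) with minimal-shape t L
... | ν , ν∈ , min with ≼-total κ ν
...   | inj₁ κ≼ν = κ , here refl , ≼-refl κ All.∷ All.map (≼-trans κ≼ν) min
...   | inj₂ ν≼κ = ν , there ν∈ , ν≼κ All.∷ min

-- The conjugate of a lexicographically minimal shape ν isolates the coefficient of e_ν,
-- so the coefficients are integers one after the other.
module Isolate (n : ℕ) (L : List (ℚ × List ℕ)) (ν : List ℕ)
  (nn : All (λ t → 0ℚ ℚ.≤ proj₁ t) L) (part : All (λ t → IsPartition n (proj₂ t)) L)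
  (int : ∀ N α → IsInteger (evaluate L N α))
  (ν∈ : Any (λ t → proj₂ t ≡ ν) L) (min : All (λ t → ν ≼ proj₂ t) L) where

  keep? : (t : ℚ × List ℕ) → Dec (proj₂ t ≢ ν)
  keep? t = ¬? (proj₂ t ≟ₗ ν)

  shorter : length (remove ν L) ℕ.< length L
  shorter = filter-notAll keep? L (Any.map (λ eq ≢ → ≢ eq) ν∈)

  ν-partition : IsPartition n ν
  ν-partition with find ν∈
  ... | t′ , t′∈ , refl = All.lookup part t′∈
  open Unitriangular n
  isolate : ∀ L → All (λ t → IsPartition n (proj₂ t)) L → All (λ t → ν ≼ proj₂ t) L →
    evaluate L n (conjugate ν) ≡ coefficient-of ν L
  isolate [] _ _ = refl
  isolate ((q , κ) ∷ L) (p All.∷ ps) (ν≼κ All.∷ m) with κ ≟ₗ ν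
  ... | yes refl = cong₂ _+_ (trans (cong (q *_) (coeffE-conjugate-1 ν (IsPartition.decreasing ν-partition)
      (subst (λ n → All (ℕ._≤ n) ν) (IsPartition.sums ν-partition) (All-≤-sum ν)))) (ℚ.*-comm q 1ℚ)) (isolate L ps m)
  ... | no κ≢ν = cong₂ _+_ (trans (cong (λ c → q * ι c) (coeffE-conjugate-0 κ ν
      (IsPartition.positive p) (IsPartition.decreasing ν-partition)
      (λ κ≼ν → κ≢ν (≼-antisym κ≼ν ν≼κ)))) (trans (ℚ.*-zeroʳ q) (sym (ℚ.*-zeroˡ q)))) (isolate L ps m)
  b-integer : ∃ λ m → coefficient-of ν L ≡ ι m
  b-integer = nonneg-integer (coefficient-nonneg ν L nn) (subst IsInteger (isolate L part min) (int n (conjugate ν)))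
  -- What has been removed from L amounts to an integer multiple of e_ν, by `b-integer`.
  int′ : ∀ N α → IsInteger (evaluate (remove ν L) N α)
  int′ N α with int N α | b-integer
  ... | x , y , eq | m , b≡ = x , y ℕ.+ m ℕ.* coeffE N ν α , (begin
    R                                          ≡⟨ add-sub R (coefficient-of ν L * ι (coeffE N ν α)) ⟩
    (coefficient-of ν L * ι (coeffE N ν α) + R) - coefficient-of ν L * ι (coeffE N ν α)
      ≡⟨ cong₂ _-_ (trans (sym (E-sum-split ν L (λ κ → ι (coeffE N κ α)))) eq) (cong (_* ι (coeffE N ν α)) b≡) ⟩
    (ι x - ι y) - ι m * ι (coeffE N ν α)       ≡⟨ cong (λ z → (ι x - ι y) - z) (sym (ι-* m (coeffE N ν α))) ⟩
    (ι x - ι y) - ι (m ℕ.* coeffE N ν α)       ≡⟨ regroup (ι x) (ι y) (ι (m ℕ.* coeffE N ν α)) ⟩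
    ι x - (ι y + ι (m ℕ.* coeffE N ν α))       ≡⟨ cong (λ z → ι x - z) (sym (ι-+ y (m ℕ.* coeffE N ν α))) ⟩
    ι x - ι (y ℕ.+ m ℕ.* coeffE N ν α)         ∎)
    where
    R = evaluate (remove ν L) N α
    add-sub : ∀ r c → r ≡ (c + r) - c
    add-sub = solve-∀ ℚ-ring
    regroup : ∀ x y z → (x - y) - z ≡ x - (y + z)
    regroup = solve-∀ ℚ-ring

-- Each round collects all entries of the least shape into one natural coefficient and removes them,
-- so the list becomes shorter and keeps integer values.
integral-expansion : ∀ n k L → length L ℕ.≤ k → All (λ t → 0ℚ ℚ.≤ proj₁ t) L → All (λ t → IsPartition n (proj₂ t)) L →
  (∀ N α → IsInteger (evaluate L N α)) →
  ∃ λ L′ → All (λ t → IsPartition n (proj₂ t)) L′ × (∀ N α → evaluate L N α ≡ ι (coeffESum N L′ α))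
integral-expansion n k [] len nn part int = [] , All.[] , λ N α → refl
integral-expansion n (suc k) (t ∷ L₀) len nn part int with minimal-shape t L₀
... | ν , ν∈ , min = extend b-integer (integral-expansion n k (remove ν L) (ℕ.≤-pred (ℕ.<-≤-trans shorter len))
    (All.filter⁺ keep? nn) (All.filter⁺ keep? part) int′)
  where
  L : List (ℚ × List ℕ)
  L = t ∷ L₀
  open Isolate n L ν nn part int ν∈ min
  extend : (∃ λ m → coefficient-of ν L ≡ ι m) →
    (∃ λ L′ → All (λ t → IsPartition n (proj₂ t)) L′ × (∀ N α → evaluate (remove ν L) N α ≡ ι (coeffESum N L′ α))) →
    ∃ λ L′ → All (λ t → IsPartition n (proj₂ t)) L′ × (∀ N α → evaluate L N α ≡ ι (coeffESum N L′ α))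
  extend (m , b≡) (L′ , part′ , eval) = (m , ν) ∷ L′ , ν-partition All.∷ part′ , λ N α → begin
    evaluate L N α
      ≡⟨ E-sum-split ν L (λ κ → ι (coeffE N κ α)) ⟩
    coefficient-of ν L * ι (coeffE N ν α) + evaluate (remove ν L) N α
      ≡⟨ cong₂ (λ b e → b * ι (coeffE N ν α) + e) b≡ (eval N α) ⟩
    ι m * ι (coeffE N ν α) + ι (coeffESum N L′ α)
      ≡⟨ cong (_+ ι (coeffESum N L′ α)) (sym (ι-* m (coeffE N ν α))) ⟩
    ι (m ℕ.* coeffE N ν α) + ι (coeffESum N L′ α)
      ≡⟨ sym (ι-+ (m ℕ.* coeffE N ν α) (coeffESum N L′ α)) ⟩
    ι (coeffESum N ((m , ν) ∷ L′) α) ∎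

-- Dyck words of Hessenberg functions

Sorted : List ℕ → Set
Sorted = AllPairs ℕ._≤_

-- The word of the graph whose remaining vertices j, j + 1, … are adjacent to the later vertices
-- up to the given bounds; `open′` lists the bounds of the vertices that are still in the queue.
word-from : ℕ → List ℕ → List ℕ → Word
word-from j open′ [] = d^ (length open′)
word-from j [] (x ∷ xs) = u ∷ word-from (suc j) [ x ] xs
word-from j (t ∷ ts) (x ∷ xs) =
  -- For sorted bounds the oldest vertex has the least one, so it is the only candidate to leave
  -- before vertex j arrives.
  if ⌊ t ℕ.<? j ⌋ then d ∷ word-from j ts (x ∷ xs) else u ∷ word-from (suc j) ((t ∷ ts) ++ [ x ]) xs

if-elim : ∀ {A P : Set} (Q : A → Set) {x y} (P? : Dec P) → (P → Q x) → (¬ P → Q y) → Q (if ⌊ P? ⌋ then x else y)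
if-elim Q (yes p) f g = f p
if-elim Q (no ¬p) f g = g ¬p

Dyck-word-from : ∀ j ts xs → Dyck (length ts) (word-from j ts xs)
Dyck-word-from j ts [] = subst (λ w → Dyck (length ts) w) (++-identityʳ (d^ (length ts)))
  (subst (λ h → Dyck h (d^ (length ts) ++ [])) (ℕ.+-identityʳ (length ts)) (Dyck-d^ (length ts) stop))
Dyck-word-from j [] (x ∷ xs) = up (Dyck-word-from (suc j) [ x ] xs)
Dyck-word-from j (t ∷ ts) (x ∷ xs) = if-elim (Dyck (suc (length ts))) (t ℕ.<? j)
  (λ _ → down (Dyck-word-from j ts (x ∷ xs)))
  (λ _ → up (subst (λ h → Dyck h (word-from (suc j) ((t ∷ ts) ++ [ x ]) xs))
    (trans (length-++ (t ∷ ts)) (ℕ.+-comm (length (t ∷ ts)) 1)) (Dyck-word-from (suc j) ((t ∷ ts) ++ [ x ]) xs)))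

-- Colourings of the graph as weights along its word

module Bridge (N : ℕ) where
  open Colouring N using (χ; differ; ∑-allVecs)

  -- The contribution to the process of one prescribed sequence of colours.
  weight : Word → List (Fin N) → List (Fin N) → ℚ
  weight [] q [] = 1ℚ
  weight [] q (_ ∷ _) = 0ℚ
  weight (u ∷ w) q [] = 0ℚ
  weight (u ∷ w) q (z ∷ κ) = χ q z * weight w (q ++ [ z ]) κ
  weight (d ∷ w) [] κ = 0ℚ
  weight (d ∷ w) (_ ∷ q) κ = weight w q κ

  value-weights : ∀ T w q acc → Process.value (allFin N) χ T w q acc
    ≡ ∑ (allVecs (allFin N) (#u w)) (λ κ → weight w q (toList κ) * T (toList κ ʳ++ acc))
  value-weights T [] q acc = lemma (T acc)
    where
    lemma : ∀ x → x ≡ 1ℚ * x + 0ℚ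
    lemma = solve-∀ ℚ-ring
  value-weights T (u ∷ w) q acc = trans
    (∑-cong (allFin N) (λ z → trans (cong (χ q z *_) (value-weights T w (q ++ [ z ]) (z ∷ acc)))
      (trans (∑-* (allVecs (allFin N) (#u w)) (χ q z) (λ κ → weight w (q ++ [ z ]) (toList κ) * T (toList κ ʳ++ (z ∷ acc))))
        (∑-cong (allVecs (allFin N) (#u w)) (λ κ → sym (ℚ.*-assoc (χ q z)
            (weight w (q ++ [ z ]) (toList κ)) (T (toList κ ʳ++ (z ∷ acc)))))))))
    (sym (∑-allVecs (allFin N) (#u w) (λ κ → weight (u ∷ w) q (toList κ) * T (toList κ ʳ++ acc))))
  value-weights T (d ∷ w) [] acc = sym (∑-0 (allVecs (allFin N) (#u w)) (λ κ → ℚ.*-zeroˡ (T (toList κ ʳ++ acc))))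
  value-weights T (d ∷ w) (_ ∷ q) acc = value-weights T w q acc

  indicator-∧ : ∀ a b → indicator (a ∧ b) ≡ indicator a * indicator b
  indicator-∧ true b = sym (ℚ.*-identityˡ (indicator b))
  indicator-∧ false b = sym (ℚ.*-zeroˡ (indicator b))

  -- compatible t c j: a vertex of colour c, adjacent to the later vertices up to t, against vertices j, j + 1, …
  compatible : ℕ → Fin N → ℕ → List (Fin N) → Bool
  compatible t c j [] = true
  compatible t c j (z ∷ κ) = (⌊ t ℕ.<? j ⌋ ∨ not ⌊ c Fin.≟ z ⌋) ∧ compatible t c (suc j) κ

  proper : ℕ → List ℕ → List (Fin N) → Bool
  proper j [] [] = true
  proper j (x ∷ xs) (z ∷ κ) = compatible x z (suc j) κ ∧ proper (suc j) xs κ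
  proper j _ _ = false

  queue-compatible : ℕ → List ℕ → List (Fin N) → List (Fin N) → Bool
  queue-compatible j [] [] κ = true
  queue-compatible j (t ∷ ts) (c ∷ q) κ = compatible t c j κ ∧ queue-compatible j ts q κ
  queue-compatible j _ _ κ = false

  compatible-expired : ∀ t c j κ → t ℕ.< j → compatible t c j κ ≡ true
  compatible-expired t c j [] lt = refl
  compatible-expired t c j (z ∷ κ) lt with t ℕ.<? j
  ... | yes _ = compatible-expired t c (suc j) κ (ℕ.m<n⇒m<1+n lt)
  ... | no ≮ = ⊥-elim (≮ lt)

  queue-compatible-[] : ∀ j ts q → length ts ≡ length q → queue-compatible j ts q [] ≡ true
  queue-compatible-[] j [] [] eq = refl
  queue-compatible-[] j (t ∷ ts) (c ∷ q) eq = queue-compatible-[] j ts q (ℕ.suc-injective eq)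

  queue-compatible-∷ʳ : ∀ j ts q x z κ → length ts ≡ length q →
    queue-compatible j (ts ++ [ x ]) (q ++ [ z ]) κ ≡ queue-compatible j ts q κ ∧ compatible x z j κ
  queue-compatible-∷ʳ j [] [] x z κ eq = Bool.∧-identityʳ (compatible x z j κ)
  queue-compatible-∷ʳ j (t ∷ ts) (c ∷ q) x z κ eq = trans
    (cong (compatible t c j κ ∧_) (queue-compatible-∷ʳ j ts q x z κ (ℕ.suc-injective eq)))
    (sym (Bool.∧-assoc (compatible t c j κ) (queue-compatible j ts q κ) (compatible x z j κ)))

  -- Every queued bound is at least j, so vertex j is adjacent to the whole queue and `χ` performs
  -- exactly the tests at position j.
  queue-compatible-step : ∀ j ts q z κ → length ts ≡ length q → All (j ℕ.≤_) ts →
    χ q z * indicator (queue-compatible (suc j) ts q κ) ≡ indicator (queue-compatible j ts q (z ∷ κ))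
  queue-compatible-step j [] [] z κ eq h = refl
  queue-compatible-step j (t ∷ ts) (c ∷ q) z κ eq (j≤t All.∷ h) = begin
    differ z c * χ q z * indicator (C ∧ Q)
      ≡⟨ cong (differ z c * χ q z *_) (indicator-∧ C Q) ⟩
    differ z c * χ q z * (indicator C * indicator Q)
      ≡⟨ lemma (differ z c) (χ q z) (indicator C) (indicator Q) ⟩
    differ z c * indicator C * (χ q z * indicator Q)
      ≡⟨ cong₂ _*_ head (queue-compatible-step j ts q z κ (ℕ.suc-injective eq) h) ⟩
    indicator (compatible t c j (z ∷ κ)) * indicator (queue-compatible j ts q (z ∷ κ))
      ≡⟨ sym (indicator-∧ (compatible t c j (z ∷ κ)) (queue-compatible j ts q (z ∷ κ))) ⟩
    indicator (compatible t c j (z ∷ κ) ∧ queue-compatible j ts q (z ∷ κ)) ∎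
    where
    C = compatible t c (suc j) κ
    Q = queue-compatible (suc j) ts q κ
    lemma : ∀ a b c d → a * b * (c * d) ≡ a * c * (b * d)
    lemma = solve-∀ ℚ-ring
    different : differ z c ≡ indicator (not ⌊ c Fin.≟ z ⌋)
    different with c Fin.≟ z
    ... | yes refl = Colouring.differ-self N c
    ... | no c≢z = Colouring.differ-≢ N (c≢z ∘ sym)
    head : differ z c * indicator C ≡ indicator (compatible t c j (z ∷ κ))
    head with t ℕ.<? j
    ... | yes t<j = ⊥-elim (ℕ.<⇒≱ t<j j≤t)
    ... | no _ = trans (cong (_* indicator C) different) (sym (indicator-∧ (not ⌊ c Fin.≟ z ⌋) C))

  #u-word-from : ∀ j ts xs → #u (word-from j ts xs) ≡ length xs
  #u-word-from j ts [] = #u-d^ (length ts)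
  #u-word-from j [] (x ∷ xs) = cong suc (#u-word-from (suc j) [ x ] xs)
  #u-word-from j (t ∷ ts) (x ∷ xs) = if-elim (λ w → #u w ≡ suc (length xs)) (t ℕ.<? j)
    (λ _ → #u-word-from j ts (x ∷ xs))
    (λ _ → cong suc (#u-word-from (suc j) ((t ∷ ts) ++ [ x ]) xs))

  weight-d^ : ∀ q → weight (d^ (length q)) q [] ≡ 1ℚ
  weight-d^ [] = refl
  weight-d^ (_ ∷ q) = weight-d^ q

  -- If the oldest bound is below j, the remaining tests of that vertex are void and it may leave
  -- the queue. Otherwise, by sortedness, all queued bounds are at least j, and the arrival is
  -- tested against all of them.
  weight-word-from : ∀ j ts xs q κ → length ts ≡ length q → length κ ≡ length xs → Sorted (ts ++ xs) →
    weight (word-from j ts xs) q κ ≡ indicator (queue-compatible j ts q κ ∧ proper j xs κ)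
  weight-push : ∀ j ts x xs q z κ → length ts ≡ length q → length κ ≡ length xs → Sorted (ts ++ x ∷ xs) → All (j ℕ.≤_) ts →
    χ q z * weight (word-from (suc j) (ts ++ [ x ]) xs) (q ++ [ z ]) κ
      ≡ indicator (queue-compatible j ts q (z ∷ κ) ∧ (compatible x z (suc j) κ ∧ proper (suc j) xs κ))
  weight-push j ts x xs q z κ lq lκ sorted late = begin
    χ q z * weight (word-from (suc j) (ts ++ [ x ]) xs) (q ++ [ z ]) κ
      ≡⟨ cong (χ q z *_) (weight-word-from (suc j) (ts ++ [ x ]) xs (q ++ [ z ]) κ
           (trans (length-++ ts) (trans (cong (ℕ._+ 1) lq) (sym (length-++ q)))) lκ
           (subst Sorted (sym (++-assoc ts [ x ] xs)) sorted)) ⟩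
    χ q z * indicator (queue-compatible (suc j) (ts ++ [ x ]) (q ++ [ z ]) κ ∧ P)
      ≡⟨ cong (λ b → χ q z * indicator (b ∧ P)) (queue-compatible-∷ʳ (suc j) ts q x z κ lq) ⟩
    χ q z * indicator ((Q ∧ C) ∧ P)
      ≡⟨ cong (χ q z *_) (trans (cong indicator (Bool.∧-assoc Q C P)) (indicator-∧ Q (C ∧ P))) ⟩
    χ q z * (indicator Q * indicator (C ∧ P))
      ≡⟨ sym (ℚ.*-assoc (χ q z) (indicator Q) (indicator (C ∧ P))) ⟩
    χ q z * indicator Q * indicator (C ∧ P)
      ≡⟨ cong (_* indicator (C ∧ P)) (queue-compatible-step j ts q z κ lq late) ⟩
    indicator (queue-compatible j ts q (z ∷ κ)) * indicator (C ∧ P)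
      ≡⟨ sym (indicator-∧ (queue-compatible j ts q (z ∷ κ)) (C ∧ P)) ⟩
    indicator (queue-compatible j ts q (z ∷ κ) ∧ (C ∧ P)) ∎
    where
    Q = queue-compatible (suc j) ts q κ
    C = compatible x z (suc j) κ
    P = proper (suc j) xs κ
  weight-word-from j ts [] q [] lq lκ sorted = trans (trans (cong (λ l → weight (d^ l) q []) lq) (weight-d^ q))
    (cong (λ b → indicator (b ∧ true)) (sym (queue-compatible-[] j ts q lq)))
  weight-word-from j [] (x ∷ xs) [] (z ∷ κ) lq lκ sorted = weight-push j [] x xs [] z κ refl (ℕ.suc-injective lκ) sorted All.[]
  weight-word-from j (t ∷ ts) (x ∷ xs) (c ∷ q) (z ∷ κ) lq lκ sorted@(t≤ AllPairs.∷ sorted′) =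
    if-elim (λ w → weight w (c ∷ q) (z ∷ κ) ≡ indicator (queue-compatible j
        (t ∷ ts) (c ∷ q) (z ∷ κ) ∧ proper j (x ∷ xs) (z ∷ κ))) (t ℕ.<? j)
      (λ t<j → trans (weight-word-from j ts (x ∷ xs) q (z ∷ κ) (ℕ.suc-injective lq) lκ sorted′)
        (cong (λ b → indicator ((b ∧ queue-compatible j ts q (z ∷ κ)) ∧ proper j (x ∷ xs) (z ∷ κ)))
          (sym (compatible-expired t c j (z ∷ κ) t<j))))
      (λ t≮j → weight-push j (t ∷ ts) x xs (c ∷ q) z κ lq (ℕ.suc-injective lκ) sorted
        (ℕ.≮⇒≥ t≮j All.∷ All.map (ℕ.≤-trans (ℕ.≮⇒≥ t≮j)) (All.++⁻ˡ ts t≤)))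

  Separated : ∀ {m} → ℕ → (Fin m → ℕ) → Vec (Fin N) m → Set
  Separated j g κ = ∀ a b → toℕ a ℕ.< toℕ b → j ℕ.+ toℕ b ℕ.≤ g a → lookup κ a ≢ lookup κ b

  ∧-true : ∀ {a b} → a ∧ b ≡ true → a ≡ true × b ≡ true
  ∧-true {true} {true} _ = refl , refl

  not-true : ∀ {P : Set} (P? : Dec P) → not ⌊ P? ⌋ ≡ true → ¬ P
  not-true (no ¬p) _ = ¬p

  compatible-correct : ∀ {m} t c j (κ : Vec (Fin N) m) →
    compatible t c j (toList κ) ≡ true → ∀ b → j ℕ.+ toℕ b ℕ.≤ t → c ≢ lookup κ b
  compatible-correct t c j (z ∷ κ) eq b le with t ℕ.<? j
  ... | yes t<j = ⊥-elim (ℕ.<⇒≱ t<j (ℕ.≤-trans (ℕ.m≤m+n j (toℕ b)) le))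
  compatible-correct t c j (z ∷ κ) eq zero le | no _ = not-true (c Fin.≟ z) (proj₁ (∧-true {not ⌊ c Fin.≟ z ⌋} eq))
  compatible-correct t c j (z ∷ κ) eq (suc b) le | no _ =
    compatible-correct t c (suc j) κ (proj₂ (∧-true {not ⌊ c Fin.≟ z ⌋} eq)) b
        (ℕ.≤-trans (ℕ.≤-reflexive (sym (ℕ.+-suc j (toℕ b)))) le)

  compatible-complete : ∀ {m} t c j (κ : Vec (Fin N) m) →
    (∀ b → j ℕ.+ toℕ b ℕ.≤ t → c ≢ lookup κ b) → compatible t c j (toList κ) ≡ true
  compatible-complete t c j [] h = refl
  compatible-complete t c j (z ∷ κ) h = cong₂ _∧_ head
    (compatible-complete t c (suc j) κ (λ b le → h (suc b) (ℕ.≤-trans (ℕ.≤-reflexive (ℕ.+-suc j (toℕ b))) le)))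
    where
    head : ⌊ t ℕ.<? j ⌋ ∨ not ⌊ c Fin.≟ z ⌋ ≡ true
    head with t ℕ.<? j
    ... | yes _ = refl
    ... | no t≮j with c Fin.≟ z
    ...   | yes c≡z = ⊥-elim (h zero (ℕ.≤-trans (ℕ.≤-reflexive (ℕ.+-identityʳ j)) (ℕ.≮⇒≥ t≮j)) c≡z)
    ...   | no _ = refl

  proper-correct : ∀ {m} j (g : Fin m → ℕ) (κ : Vec (Fin N) m) → proper j (tabulate g) (toList κ) ≡ true → Separated j g κ
  proper-correct j g (z ∷ κ) eq zero (suc b) lt le =
    compatible-correct (g zero) z (suc j) κ (proj₁ (∧-true eq)) b (ℕ.≤-trans (ℕ.≤-reflexive (sym (ℕ.+-suc j (toℕ b)))) le)
  proper-correct j g (z ∷ κ) eq (suc a) (suc b) (ℕ.s≤s lt) le =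
    proper-correct (suc j) (g ∘ suc) κ (proj₂ (∧-true {compatible (g zero) z (suc j) (toList κ)} eq)) a b lt
      (ℕ.≤-trans (ℕ.≤-reflexive (sym (ℕ.+-suc j (toℕ b)))) le)

  proper-complete : ∀ {m} j (g : Fin m → ℕ) (κ : Vec (Fin N) m) → Separated j g κ → proper j (tabulate g) (toList κ) ≡ true
  proper-complete j g [] h = refl
  proper-complete j g (z ∷ κ) h = cong₂ _∧_
    (compatible-complete (g zero) z (suc j) κ (λ b le → h zero (suc b)
        (ℕ.s≤s ℕ.z≤n) (ℕ.≤-trans (ℕ.≤-reflexive (ℕ.+-suc j (toℕ b))) le)))
    (proper-complete (suc j) (g ∘ suc) κ (λ a b lt le → h (suc a) (suc b)
        (ℕ.s≤s lt) (ℕ.≤-trans (ℕ.≤-reflexive (ℕ.+-suc j (toℕ b))) le)))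

  properB-correct : ∀ {n} (f : Fin n → Fin n) (κ : Vec (Fin N) n) → properB f κ ≡ true → Separated 0 (toℕ ∘ f) κ
  properB-correct {n} f κ eq a b lt le = separate (toℕ a ℕ.<? toℕ b) (toℕ b ℕ.≤? toℕ (f a)) (lookup κ a Fin.≟ lookup κ b)
    (allB-true _ (allFin n) (allB-true _ (allFin n) eq (∈-allFin a)) (∈-allFin b))
    where
    separate : ∀ {P : Set} (lt? : Dec (toℕ a ℕ.< toℕ b)) (le? : Dec (toℕ b ℕ.≤ toℕ (f a))) (P? : Dec P) →
      not (⌊ lt? ⌋ ∧ ⌊ le? ⌋) ∨ not ⌊ P? ⌋ ≡ true → ¬ P
    separate (yes _) (yes _) (no ¬p) _ = ¬p
    separate (no ≮) _ _ _ = ⊥-elim (≮ lt)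
    separate _ (no ≰) _ _ = ⊥-elim (≰ le)

  properB-complete : ∀ {n} (f : Fin n → Fin n) (κ : Vec (Fin N) n) → Separated 0 (toℕ ∘ f) κ → properB f κ ≡ true
  properB-complete {n} f κ sep = true-allB _ (allFin n) (λ {a} _ → true-allB _ (allFin n) (λ {b} _ →
    combine a b (toℕ a ℕ.<? toℕ b) (toℕ b ℕ.≤? toℕ (f a)) (lookup κ a Fin.≟ lookup κ b)))
    where
    combine : ∀ a b (lt? : Dec (toℕ a ℕ.< toℕ b)) (le? : Dec (toℕ b ℕ.≤ toℕ (f a))) (P? : Dec (lookup κ a ≡ lookup κ b)) →
      not (⌊ lt? ⌋ ∧ ⌊ le? ⌋) ∨ not ⌊ P? ⌋ ≡ true
    combine a b (no _) _ _ = refl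
    combine a b (yes _) (no _) _ = refl
    combine a b (yes _) (yes _) (no _) = refl
    combine a b (yes lt) (yes le) (yes eq) = ⊥-elim (sep a b lt le eq)

  coeffX-value : ∀ {n} (f : Fin n → Fin n) → IsHessenberg f → ∀ α →
    ι (coeffX f N α) ≡ Monomial.coloured n N α (word-from 0 [] (tabulate (toℕ ∘ f))) [] []
  coeffX-value {n} f hess α = begin
    ι (coeffX f N α)
      ≡⟨ ι-countB (λ κ → properB f κ ∧ hasMonomialB α κ) (allVecs (allFin N) n) ⟩
    ∑ (allVecs (allFin N) n) (λ κ → indicator (properB f κ ∧ hasMonomialB α κ))
      ≡⟨ ∑-cong (allVecs (allFin N) n) term ⟩
    ∑ (allVecs (allFin N) n) (λ κ → weight w [] (toList κ) * content-test (reverse (toList κ)))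
      ≡⟨ cong (λ m → ∑ (allVecs (allFin N) m) (λ κ → weight w [] (toList κ) * content-test (reverse (toList κ))))
           (sym (trans (#u-word-from 0 [] xs) (List.length-tabulate (toℕ ∘ f)))) ⟩
    ∑ (allVecs (allFin N) (#u w)) (λ κ → weight w [] (toList κ) * content-test (reverse (toList κ)))
      ≡⟨ sym (value-weights content-test w [] []) ⟩
    coloured w [] [] ∎
    where
    open Monomial n N α
    xs = tabulate (toℕ ∘ f)
    w = word-from 0 [] xs
    sorted : Sorted xs
    sorted = sorted-tabulate (toℕ ∘ f) (λ i j le → IsHessenberg.monotone hess i j le)
      where
      sorted-tabulate : ∀ {m} (g : Fin m → ℕ) → (∀ i j → toℕ i ℕ.≤ toℕ j → g i ℕ.≤ g j) → Sorted (tabulate g)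
      sorted-tabulate {zero} g mono = AllPairs.[]
      sorted-tabulate {suc m} g mono = All.tabulate⁺ (λ j → mono zero (suc j) ℕ.z≤n)
        AllPairs.∷ sorted-tabulate (g ∘ suc) (λ i j le → mono (suc i) (suc j) (ℕ.s≤s le))
    term : ∀ κ → indicator (properB f κ ∧ hasMonomialB α κ) ≡ weight w [] (toList κ) * content-test (reverse (toList κ))
    term κ = begin
      indicator (properB f κ ∧ hasMonomialB α κ)
        ≡⟨ indicator-∧ (properB f κ) (hasMonomialB α κ) ⟩
      indicator (properB f κ) * indicator (hasMonomialB α κ)
        ≡⟨ cong₂ _*_ proper-part monomial-part ⟩
      weight w [] (toList κ) * content-test (reverse (toList κ)) ∎
      where
      proper-part : indicator (properB f κ) ≡ weight w [] (toList κ)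
      proper-part = sym (trans (weight-word-from 0 [] xs [] (toList κ) refl
          (trans (Vec.length-toList κ) (sym (List.length-tabulate (toℕ ∘ f)))) sorted)
        (cong indicator (Bool.⇔→≡ (mk⇔ (λ eq → properB-complete f κ (proper-correct 0 (toℕ ∘ f) κ eq))
            (λ eq → proper-complete 0 (toℕ ∘ f) κ (properB-correct f κ eq))))))
      monomial-part : indicator (hasMonomialB α κ) ≡ content-test (reverse (toList κ))
      monomial-part = sym (trans (content-test-↭ (Perm.↭-reverse (toList κ)))
        (trans (cong (_* indicator (has-monomial (toList κ))) (indicator-yes (length (toList κ) ℕ.≟ n)
            (Vec.length-toList κ))) (ℚ.*-identityˡ (indicator (has-monomial (toList κ))))))

theorem1p8 : (n : ℕ) → 1 ≤ n → (f : Fin n → Fin n) → IsHessenberg f →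
    LongestChainHas f 3 →
    Σ (List (ℕ × List ℕ)) λ L →
    All (λ p → IsPartition n (proj₂ p)) L ×
    (∀ (N : ℕ) (α : Vec ℕ N) → coeffX f N α ≡ coeffESum N L α)
theorem1p8 n _ f hess _ = conclude (integral-expansion n (length L) L ℕ.≤-refl
    (shapes-nonneg ts (terms-nonneg w [] [])) (shapes-partition ts)
    -- The coefficients of X are counts of colourings, so the rational expansion takes integer
    -- values at every monomial; unitriangularity starts from this.
    (λ N α → coeffX f N α , 0 , trans (sym (X-expansion N α)) (lemma (ι (coeffX f N α)))))
  where
  open Terms n
  w = word-from 0 [] (tabulate (toℕ ∘ f))
  ts = terms w [] []
  L = shapes ts
  lemma : ∀ x → x ≡ x - 0ℚ
  lemma = solve-∀ ℚ-ring
  X-expansion : ∀ N α → ι (coeffX f N α) ≡ evaluate L N α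
  X-expansion N α = trans (Bridge.coeffX-value N f hess α) (expansion (Dyck-word-from 0 [] (tabulate (toℕ ∘ f))) N α)
  conclude : (∃ λ L′ → All (λ t → IsPartition n (proj₂ t)) L′ × (∀ N α → evaluate L N α ≡ ι (coeffESum N L′ α))) →
    Σ (List (ℕ × List ℕ)) λ L → All (λ p → IsPartition n (proj₂ p)) L × (∀ (N : ℕ) (α : Vec ℕ N) → coeffX f N α ≡ coeffESum N L α)
  conclude (L′ , part , eval) = L′ , part , λ N α → ι-injective (trans (X-expansion N α) (eval N α))
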